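{- The EDNR problem is NP-hard even when restricted to instances in which the graph is a grid of height three and every edge resistance satisfies $r_e \in \{0,1\}$.
   Context: The electrical distribution network reconfiguration (EDNR) problem: given a connected undirected graph $G=(V,E)$ with a fixed root $r\in V$, a demand $d_v\ge 0$ for each $v\in V\setminus\{r\}$, and a resistance $r_e\ge 0$ for each $e\in E$, find a spanning tree $T=(V,F)$ of $G$ minimizing the loss $L(T)=\sum_{e\in F} r_e\big(\sum_{v\in D_T(e)} d_v\big)^2$, where $D_T(e)$ is the vertex set of the connected component of $T-e$ not containing $r$. (NP-hardness refers to the associated decision version: given in addition a bound $B$, decide whether some spanning tree has loss at most $B$.) An $n\times m$-grid is the graph with vertex set $\{(i,j): 0\le i\le n-1,\ 0\le j\le m-1\}$ and edges $\{(i,j),(i',j')\}$ with $|i-i'|+|j-j'|=1$, or any graph isomorphic to it; its height is $n$. -}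

module Defs where

open import Data.Nat using (ℕ; zero; suc; _+_; _*_; _^_; _≤_)
open import Data.Nat.Binary using (ℕᵇ; 2[1+_]; 1+[2_]) renaming (zero to zeroᵇ; fromℕ to toℕᵇ)
open import Data.Fin using (Fin; zero; suc; toℕ; inject₁)
open import Data.List using (List; []; _∷_; _++_; map; concatMap; length; allFin)
open import Data.Nat.ListAction using (sum)
open import Data.List.Relation.Unary.Unique.Propositional using (Unique)
open import Data.Bool using (Bool; true; false; if_then_else_)
open import Data.Maybe using (Maybe; just; nothing)
open import Data.Product using (Σ; ∃; _×_; _,_; proj₁; proj₂)
open import Data.Sum using (_⊎_)
open import Relation.Nullary using (¬_)
open import Relation.Binary.PropositionalEquality using (_≡_; _≢_)

-- Part 1. A standard model of computation: deterministic single-tape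
-- Turing machines over the tape alphabet {blank, 0, 1}, with a tape
-- that is unbounded in both directions.

data Sym : Set where
  blank b0 b1 : Sym

data Move : Set where
  moveL moveR stay : Move

record TM : Set where
  field
    Q         : ℕ
    start     : Fin Q
    δ         : Fin Q → Sym → Maybe (Fin Q × Sym × Move)  -- nothing = halt
    accepting : Fin Q → Bool

record Config (Q : ℕ) : Set where
  constructor conf
  field
    state : Fin Q
    left  : List Sym     -- cells to the left of the head, nearest first
    head  : Sym
    right : List Sym     -- cells to the right of the head, nearest first

open Config public

writeMove : ∀ {Q} → Fin Q → Sym → Move → Config Q → Config Q
writeMove q s moveL (conf _ [] _ rs)       = conf q [] blank (s ∷ rs)
writeMove q s moveL (conf _ (l ∷ ls) _ rs) = conf q ls l (s ∷ rs)
writeMove q s moveR (conf _ ls _ [])       = conf q (s ∷ ls) blank []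
writeMove q s moveR (conf _ ls _ (r ∷ rs)) = conf q (s ∷ ls) r rs
writeMove q s stay  (conf _ ls _ rs)       = conf q ls s rs

step : (M : TM) → Config (TM.Q M) → Maybe (Config (TM.Q M))
step M c with TM.δ M (state c) (head c)
... | nothing            = nothing
... | just (q , s , mv)  = just (writeMove q s mv c)

run : (M : TM) → ℕ → Config (TM.Q M) → Config (TM.Q M)
run M zero    c = c
run M (suc t) c with step M c
... | nothing = c
... | just c' = run M t c'

Halted : (M : TM) → Config (TM.Q M) → Set
Halted M c = TM.δ M (state c) (head c) ≡ nothing

bitSym : Bool → Sym
bitSym false = b0
bitSym true  = b1

initConf : (M : TM) → List Bool → Config (TM.Q M)
initConf M []       = conf (TM.start M) [] blank []
initConf M (b ∷ bs) = conf (TM.start M) [] (bitSym b) (map bitSym bs)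

readBits : List Sym → List Bool
readBits []           = []
readBits (blank ∷ _)  = []
readBits (b0 ∷ ss)    = false ∷ readBits ss
readBits (b1 ∷ ss)    = true ∷ readBits ss

output : ∀ {Q} → Config Q → List Bool
output c = readBits (head c ∷ right c)

runOn : (M : TM) → ℕ → List Bool → Config (TM.Q M)
runOn M t x = run M t (initConf M x)

-- polynomial bounds: every polynomial is dominated by some c·n^c + c
polyBound : ℕ → ℕ → ℕ
polyBound c n = c * n ^ c + c

PolyTime : TM → Set
PolyTime M = ∃ λ c → ∀ x → Halted M (runOn M (polyBound c (length x)) x)

Accepts : TM → List Bool → Set
Accepts M x = ∃ λ t → Halted M (runOn M t x) × TM.accepting M (state (runOn M t x)) ≡ true

PolyComputable : (List Bool → List Bool) → Set
PolyComputable f = Σ TM λ M → PolyTime M ×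
  (∀ x t → Halted M (runOn M t x) → output (runOn M t x) ≡ f x)

Language : Set₁
Language = List Bool → Set

-- self-delimiting encoding of a pair of strings
pairEnc : List Bool → List Bool → List Bool
pairEnc x w = concatMap (λ b → b ∷ b ∷ []) x ++ (false ∷ true ∷ w)

InNP : Language → Set
InNP L = Σ TM λ V → PolyTime V × ∃ λ c → ∀ x →
  (L x → ∃ λ w → length w ≤ polyBound c (length x) × Accepts V (pairEnc x w)) ×
  ((∃ λ w → length w ≤ polyBound c (length x) × Accepts V (pairEnc x w)) → L x)

_≤ₚ_ : Language → Language → Set
L ≤ₚ L' = ∃ λ f → PolyComputable f × (∀ x → (L x → L' (f x)) × (L' (f x) → L x))

NPHard : Language → Set₁
NPHard L' = ∀ L → InNP L → L ≤ₚ L'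

V : ℕ → Set
V k = Fin 3 × Fin (suc k)

data Edge (k : ℕ) : Set where
  hor : Fin 3 → Fin k → Edge k
  ver : Fin 2 → Fin (suc k) → Edge k

ends : ∀ {k} → Edge k → V k × V k
ends (hor i j) = (i , inject₁ j) , (i , suc j)
ends (ver i j) = (inject₁ i , j) , (suc i , j)

Joins : ∀ {k} → Edge k → V k → V k → Set
Joins e u v = (ends e ≡ (u , v)) ⊎ (ends e ≡ (v , u))

allV : (k : ℕ) → List (V k)
allV k = concatMap (λ i → map (λ j → (i , j)) (allFin (suc k))) (allFin 3)

allE : (k : ℕ) → List (Edge k)
allE k = concatMap (λ i → map (hor i) (allFin k)) (allFin 3)
      ++ concatMap (λ i → map (ver i) (allFin (suc k))) (allFin 2)

data Reach {k} (P : Edge k → Set) (u : V k) : V k → Set where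
  here  : Reach P u u
  there : ∀ {w v} (e : Edge k) → Reach P u w → P e → Joins e w v → Reach P u v

AdjIn : ∀ {k} → (Edge k → Set) → V k → V k → Set
AdjIn P u v = ∃ λ e → P e × Joins e u v

AdjChain : ∀ {k} → (Edge k → Set) → V k → List (V k) → V k → Set
AdjChain P a []       b = AdjIn P a b
AdjChain P a (x ∷ xs) b = AdjIn P a x × AdjChain P x xs b

-- a cycle: distinct vertices v₀,…,v_{m-1} (m ≥ 3), consecutive ones
-- (cyclically) adjacent.  The grid is a simple graph.
HasCycle : ∀ {k} → (Edge k → Set) → Set
HasCycle {k} P = Σ (V k) λ v₀ → Σ (List (V k)) λ xs →
  2 ≤ length xs × Unique (v₀ ∷ xs) × AdjChain P v₀ xs v₀

InF : ∀ {k} → (Edge k → Bool) → Edge k → Set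
InF F e = F e ≡ true

SpanningTree : ∀ {k} → (Edge k → Bool) → Set
SpanningTree {k} F = (∀ (u v : V k) → Reach (InF F) u v) × ¬ HasCycle (InF F)

Minus : ∀ {k} → (Edge k → Bool) → Edge k → Edge k → Set
Minus F e e' = F e' ≡ true × e' ≢ e

record Instance : Set where
  field
    k      : ℕ
    root   : V k
    demand : V k → ℕ
    resist : Edge k → ℕ
    bound  : ℕ

ind : Bool → ℕ → ℕ
ind b n = if b then n else 0

IsDown : ∀ {k} → V k → (Edge k → Bool) → (Edge k → V k → Bool) → Set
IsDown {k} r F D = ∀ (e : Edge k) (v : V k) →
  (D e v ≡ true → ¬ Reach (Minus F e) r v) × (¬ Reach (Minus F e) r v → D e v ≡ true)

loss : ∀ {k} → (Edge k → ℕ) → (V k → ℕ) → (Edge k → Bool) → (Edge k → V k → Bool) → ℕ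
loss {k} res d F D = sum (map (λ e → ind (F e)
  (res e * (sum (map (λ v → ind (D e v) (d v)) (allV k)) ^ 2))) (allE k))

YesInstance : Instance → Set
YesInstance I = Σ (Edge k → Bool) λ F → SpanningTree F ×
  Σ (Edge k → V k → Bool) λ D → IsDown root F D × loss resist demand F D ≤ bound
  where open Instance I

bitsᵇ : ℕᵇ → List Bool
bitsᵇ zeroᵇ     = []
bitsᵇ 2[1+ n ]  = true ∷ bitsᵇ n
bitsᵇ 1+[2 n ]  = false ∷ bitsᵇ n

-- self-delimiting binary encoding of a natural number
encℕ : ℕ → List Bool
encℕ n = concatMap (λ b → b ∷ b ∷ []) (bitsᵇ (toℕᵇ n)) ++ (false ∷ true ∷ [])

encode : Instance → List Bool
encode I = encℕ k
  ++ encℕ (toℕ (proj₁ root)) ++ encℕ (toℕ (proj₂ root))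
  ++ concatMap (λ v → encℕ (demand v)) (allV k)
  ++ concatMap (λ e → encℕ (resist e)) (allE k)
  ++ encℕ bound
  where open Instance I

EDNR-grid3-01 : Language
EDNR-grid3-01 x = Σ Instance λ I → encode I ≡ x ×
  (∀ e → Instance.resist I e ≤ 1) × YesInstance I

{-# OPTIONS --safe #-}
module Submission where

-- From the verifier of an NP language we build a grid instance whose loss bound can be met exactly when a witness exists.
--
-- Only the two edges at the corner root have resistance 1, so the loss is A² + B² for the demands A, B behind them,
-- and with A + B = 2H it is at most 2H² exactly when A = B = H.  The neighbours of the root carry fixed demands p and q;
-- every other vertex of the middle row can be hung on the top or the bottom row independently of the rest.  So the
-- question is whether a subset of the demands of the middle row has sum H - p.
--
-- An accepting computation is a tiling: a configuration is rewritten into the next one by a left-to-right transducer,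
-- and a cell of the history is a tile (content below, state before, content above, state after).  Reading the rows one
-- after the other, tile s must match tile s + 1 and tile s + P, where P is the length of a row.  A tile at place s
-- becomes a number with digits at the places s, s + 1 and s + P, and a set of such numbers has the right sum exactly
-- when it picks one tile per place and all colours match.  The numbers p and q make H a power of two, so that the
-- bound is easy to write down.
--
-- The instance is written by a counter program, compiled to a Turing machine that keeps unary counters on interleaved
-- tracks and writes its output from right to left.

open import Defs
open import Data.Nat hiding (_/_; _%_)
open import Data.Nat.Properties
open import Data.Nat.Tactic.RingSolver using (solve-∀)
open import Data.Nat.Binary using (ℕᵇ; 2[1+_]; 1+[2_]) renaming (zero to zeroᵇ; fromℕ to toℕᵇ; toℕ to ofℕᵇ)
open import Data.Bool using (Bool; true; false; if_then_else_; not; _∧_)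
open import Data.Bool.Properties using (not-involutive)
open import Data.Fin using (Fin; zero; suc; toℕ; inject₁; _↑ˡ_; _↑ʳ_; splitAt)
open import Data.Fin.Properties using (splitAt-↑ˡ; splitAt-↑ʳ; toℕ<n; toℕ-injective; toℕ-inject₁)
open import Data.List using (List; []; _∷_; _++_; map; null; concatMap; length; allFin; replicate; reverse; lookup; tabulate; [_])
open import Tactic.MonoidSolver using (solve)
open import Data.List.Properties using (++-monoid; ++-assoc; ++-identityʳ; length-++; length-map; length-replicate; length-reverse; map-++; unfold-reverse; reverse-involutive; map-∘; map-cong; ∷-injective; concatMap-++)
open import Data.Nat.ListAction using (sum)
open import Data.Nat.ListAction.Properties using (sum-++)
open import Data.Vec using (Vec; []; _∷_) renaming (lookup to _!_; _[_]≔_ to infixl 6 _[_]≔_; replicate to vreplicate)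
open import Data.Vec.Properties using (lookup∘update; lookup∘update′; []≔-idempotent; []≔-lookup; []≔-commutes)
open import Data.Maybe using (Maybe; just; nothing; maybe′)
open import Data.Product using (∃; _×_; _,_; proj₁; proj₂)
open import Data.Sum using (_⊎_; inj₁; inj₂; [_,_]′)
open import Data.Unit using (⊤; tt)
open import Data.Empty using (⊥; ⊥-elim)
open import Function using (_∘_; id; case_of_)
open import Relation.Nullary using (¬_; Dec; yes; no; does)
open import Relation.Binary.PropositionalEquality using (_≡_; _≢_; refl; sym; trans; cong; cong₂; subst; subst₂)
open import Data.Nat.DivMod using (_divMod_; result; _%_; _/_; m%n<n; m≡m%n+[m/n]*n; m<n*o⇒m/o<n)
open import Relation.Binary.Definitions using (tri<; tri≈; tri>)
import Data.Fin as Fin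
open import Data.List.Relation.Unary.All using (All; []; _∷_) renaming (tabulate to tabulateAll)
open import Data.List.Relation.Unary.All.Properties using (¬Any⇒All¬)
open import Data.List.Relation.Unary.AllPairs using ([]; _∷_)
open import Data.List.Membership.Propositional using (_∈_; _∉_; lose; find)
import Data.List.Relation.Unary.Any as Any
open import Data.Product.Properties using (≡-dec)
open import Data.List.Relation.Unary.Unique.Propositional using (Unique)
open import Data.Fin.Induction using (<-weakInduction)
open import Data.List.Membership.Propositional.Properties using (∈-concatMap⁺; ∈-concatMap⁻; ∈-map⁺; ∈-map⁻; ∈-allFin; ∈-++⁺ˡ; ∈-++⁺ʳ)
open import Data.Nat.Binary.Properties using () renaming (toℕ-fromℕ to toℕ-fromℕᵇ; fromℕ-toℕ to fromℕ-toℕᵇ)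

-- Structured programs and their compilation to Turing machines

-- A spanning tree may omit an edge at the root or route demand in any way. The lower bound needs
-- only that every vertex other than the root lies behind one of the two edges, since otherwise
-- these would lie on a cycle. So `A + B` is at least the total demand `2H`, and a loss of at most
-- `2H²` forces equality.
--
-- Demands have exponential size, so the program never computes with them: it writes them digit by
-- digit, and no addition may carry. The base is so large that even all tiles together overflow no
-- digit. Then each digit of p and q depends only on the machine and on the kind of its block, and
-- it can be built into the program.
--
-- Numbers are encoded in bijective binary, which has an implicit leading one. In an item this one
-- is the unit that counts tiles; in p and q it is part of `H`.
--
-- Membership is a property of words, so soundness also needs that a word determines its instance,
-- up to pointwise equality of demands and resistances.

Tape : Set
Tape = ℕ → Sym

nth : List Sym → ℕ → Sym
nth []       _       = blank
nth (s ∷ ss) zero    = s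
nth (s ∷ ss) (suc i) = nth ss i

-- There is no left move from cell 0. Numbering the cells by `ℕ` still suffices: the input is placed
-- at an offset, chosen for each input, that exceeds every excursion to the left.
data Moves : Move → ℕ → ℕ → Set where
  mL : ∀ {p} → Moves moveL (suc p) p
  mR : ∀ {p} → Moves moveR p (suc p)
  mS : ∀ {p} → Moves stay p p

upd : Tape → ℕ → Sym → Tape
upd g p s j with j ≟ p
... | yes _ = s
... | no  _ = g j

upd-same : ∀ g p s → upd g p s p ≡ s
upd-same g p s with p ≟ p
... | yes _   = refl
... | no  p≢p = ⊥-elim (p≢p refl)

upd-other : ∀ g p s {j} → j ≢ p → upd g p s j ≡ g j
upd-other g p s {j} j≢p with j ≟ p
... | yes j≡p = ⊥-elim (j≢p j≡p)
... | no  _   = refl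

infixr 5 _⨾_
data Prog : Set where
  mv   : Move → Prog
  wr   : Sym → Prog
  _⨾_  : Prog → Prog → Prog
  ife  : (Sym → Bool) → Prog → Prog → Prog
  loop : (Sym → Bool) → Prog → Prog

data Exec : Prog → Tape → ℕ → ℕ → Tape → ℕ → Set where
  xmv   : ∀ {m g p p'} → Moves m p p' → Exec (mv m) g p 1 g p'
  xwr   : ∀ {s g p} → Exec (wr s) g p 1 (upd g p s) p
  xseq  : ∀ {c d g p t g' p' u g'' p''} → Exec c g p t g' p' → Exec d g' p' u g'' p'' →
          Exec (c ⨾ d) g p (t + u) g'' p''
  xif₁  : ∀ {b c d g p t g' p'} → b (g p) ≡ true → Exec c g p t g' p' → Exec (ife b c d) g p (suc t) g' p'
  xif₂  : ∀ {b c d g p t g' p'} → b (g p) ≡ false → Exec d g p t g' p' → Exec (ife b c d) g p (suc t) g' p'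
  xstop : ∀ {b c g p} → b (g p) ≡ false → Exec (loop b c) g p 1 g p
  xloop : ∀ {b c g p t g' p' u g'' p''} → b (g p) ≡ true → Exec c g p t g' p' →
          Exec (loop b c) g' p' u g'' p'' → Exec (loop b c) g p (suc (t + u)) g'' p''

-- Control points: one for each primitive and one, `nothing`, for the test of each branch or loop.
St : Prog → Set
St (mv _)      = ⊤
St (wr _)      = ⊤
St (c ⨾ d)     = St c ⊎ St d
St (ife _ c d) = Maybe (St c ⊎ St d)
St (loop _ c)  = Maybe (St c)

entry : ∀ c → St c
entry (mv _)      = tt
entry (wr _)      = tt
entry (c ⨾ d)     = inj₁ (entry c)
entry (ife _ _ _) = nothing
entry (loop _ _)  = nothing

-- nothing = control leaves the program
next : ∀ c → St c → Sym → Maybe (St c)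
next (mv _) _ _ = nothing
next (wr _) _ _ = nothing
next (c ⨾ d) (inj₁ q) s = maybe′ (just ∘ inj₁) (just (inj₂ (entry d))) (next c q s)
next (c ⨾ d) (inj₂ q) s = maybe′ (just ∘ inj₂) nothing (next d q s)
next (ife b c d) nothing s = just (just (if b s then inj₁ (entry c) else inj₂ (entry d)))
next (ife b c d) (just (inj₁ q)) s = maybe′ (just ∘ just ∘ inj₁) nothing (next c q s)
next (ife b c d) (just (inj₂ q)) s = maybe′ (just ∘ just ∘ inj₂) nothing (next d q s)
next (loop b c) nothing s = if b s then just (just (entry c)) else nothing
next (loop b c) (just q) s = just (next c q s)

act : ∀ c → St c → Sym → Sym × Move
act (mv m) _ s = s , m
act (wr a) _ s = a , stay
act (c ⨾ d) (inj₁ q) s = act c q s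
act (c ⨾ d) (inj₂ q) s = act d q s
act (ife b c d) nothing s = s , stay
act (ife b c d) (just (inj₁ q)) s = act c q s
act (ife b c d) (just (inj₂ q)) s = act d q s
act (loop b c) nothing s = s , stay
act (loop b c) (just q) s = act c q s

size : Prog → ℕ
size (mv _)      = 1
size (wr _)      = 1
size (c ⨾ d)     = size c + size d
size (ife _ c d) = suc (size c + size d)
size (loop _ c)  = suc (size c)

enc : ∀ c → St c → Fin (size c)
enc (mv _) _ = zero
enc (wr _) _ = zero
enc (c ⨾ d) (inj₁ q) = enc c q ↑ˡ size d
enc (c ⨾ d) (inj₂ q) = size c ↑ʳ enc d q
enc (ife _ c d) nothing = zero
enc (ife _ c d) (just (inj₁ q)) = suc (enc c q ↑ˡ size d)
enc (ife _ c d) (just (inj₂ q)) = suc (size c ↑ʳ enc d q)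
enc (loop _ c) nothing = zero
enc (loop _ c) (just q) = suc (enc c q)

dec : ∀ c → Fin (size c) → St c
dec (mv _) _ = tt
dec (wr _) _ = tt
dec (c ⨾ d) i = [ inj₁ ∘ dec c , inj₂ ∘ dec d ]′ (splitAt (size c) i)
dec (ife _ c d) zero = nothing
dec (ife _ c d) (suc i) = just ([ inj₁ ∘ dec c , inj₂ ∘ dec d ]′ (splitAt (size c) i))
dec (loop _ c) zero = nothing
dec (loop _ c) (suc i) = just (dec c i)

dec-enc : ∀ c q → dec c (enc c q) ≡ q
dec-enc (mv _) tt = refl
dec-enc (wr _) tt = refl
dec-enc (c ⨾ d) (inj₁ q) rewrite splitAt-↑ˡ (size c) (enc c q) (size d) = cong inj₁ (dec-enc c q)
dec-enc (c ⨾ d) (inj₂ q) rewrite splitAt-↑ʳ (size c) (size d) (enc d q) = cong inj₂ (dec-enc d q)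
dec-enc (ife _ c d) nothing = refl
dec-enc (ife _ c d) (just (inj₁ q)) rewrite splitAt-↑ˡ (size c) (enc c q) (size d) = cong (just ∘ inj₁) (dec-enc c q)
dec-enc (ife _ c d) (just (inj₂ q)) rewrite splitAt-↑ʳ (size c) (size d) (enc d q) = cong (just ∘ inj₂) (dec-enc d q)
dec-enc (loop _ c) nothing = refl
dec-enc (loop _ c) (just q) = cong just (dec-enc c q)

-- State `zero` is the only halting state. Control falls into it on leaving the program; every other
-- state has a transition on every symbol.
machine : Prog → TM
machine c = record
  { Q = suc (size c)
  ; start = suc (enc c (entry c))
  ; δ = λ { zero _ → nothing
          ; (suc i) s → just (maybe′ (suc ∘ enc c) zero (next c (dec c i) s) , act c (dec c i) s) }
  ; accepting = λ _ → false
  }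

run-step : ∀ M {q s m} t (k : Config (TM.Q M)) → TM.δ M (state k) (head k) ≡ just (q , s , m) →
           run M (suc t) k ≡ run M t (writeMove q s m k)
run-step M t k eq with TM.δ M (state k) (head k) | eq
... | .(just _) | refl = refl

run-halted : ∀ M t (k : Config (TM.Q M)) → Halted M k → run M t k ≡ k
run-halted M zero    k h = refl
run-halted M (suc t) k h with TM.δ M (state k) (head k) | h
... | .nothing | refl = refl

run-+ : ∀ M t u (k : Config (TM.Q M)) → run M (t + u) k ≡ run M u (run M t k)
run-+ M zero    u k = refl
run-+ M (suc t) u k with TM.δ M (state k) (head k) in eq
... | nothing          = sym (run-halted M u k eq)
... | just (q , s , m) = run-+ M t u (writeMove q s m k)

halted-unique : ∀ M t u (k : Config (TM.Q M)) → Halted M (run M t k) → Halted M (run M u k) → run M t k ≡ run M u k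
halted-unique M t u k ht hu with ≤-total t u
... | inj₁ t≤u = sym (trans (trans (cong (λ v → run M v k) (sym (m+[n∸m]≡n t≤u))) (run-+ M t (u ∸ t) k)) (run-halted M (u ∸ t) _ ht))
... | inj₂ u≤t = trans (trans (cong (λ v → run M v k) (sym (m+[n∸m]≡n u≤t))) (run-+ M u (t ∸ u) k)) (run-halted M (t ∸ u) _ hu)

halted-≤ : ∀ M {t u} (k : Config (TM.Q M)) → t ≤ u → Halted M (run M t k) → Halted M (run M u k)
halted-≤ M {t} {u} k t≤u h = subst (Halted M) (sym (trans (trans (cong (λ v → run M v k) (sym (m+[n∸m]≡n t≤u)))
  (run-+ M t (u ∸ t) k)) (run-halted M (u ∸ t) _ h))) h

-- `nth` reads blank past the end of a list, so the finite lists of a configuration stand for a tape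
-- that is blank elsewhere. The left cell of index `i` has address `p - 1 - i`, stated as an
-- equation to avoid truncated subtraction.
record Rep {Q} (k : Config Q) (g : Tape) (p : ℕ) : Set where
  constructor rep
  field
    hd : head k ≡ g p
    rt : ∀ i → nth (right k) i ≡ g (p + suc i)
    lf : ∀ i j → i + suc j ≡ p → nth (left k) i ≡ g j

writeMove-state : ∀ {Q} (q : Fin Q) s m k → state (writeMove q s m k) ≡ q
writeMove-state q s moveL (conf _ [] _ _)      = refl
writeMove-state q s moveL (conf _ (_ ∷ _) _ _) = refl
writeMove-state q s moveR (conf _ _ _ [])      = refl
writeMove-state q s moveR (conf _ _ _ (_ ∷ _)) = refl
writeMove-state q s stay  (conf _ _ _ _)       = refl

private
  i+1+j≢j : ∀ i j {p} → i + suc j ≡ p → j ≢ p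
  i+1+j≢j i j refl e = m≢1+n+m j (trans e (+-suc i j))

rep-move : ∀ {Q} {k : Config Q} {g g' p p' s m} (q : Fin Q) → Rep k g p → Moves m p p' →
           g' p ≡ s → (∀ {j} → j ≢ p → g' j ≡ g j) → Rep (writeMove q s m k) g' p'
rep-move {k = conf q₀ ls h rs} {g} {g'} {s = s} q (rep hd rt lf) (mL {p}) same other = go ls lf
  where
  rt' : ∀ i → nth (s ∷ rs) i ≡ g' (p + suc i)
  rt' zero = trans (sym same) (cong g' (sym (+-comm p 1)))
  rt' (suc i) = trans (rt i) (trans (sym (other (m+1+n≢m (suc p)))) (cong g' (sym (+-suc p (suc i)))))
  go : ∀ ls → (∀ i j → i + suc j ≡ suc p → nth ls i ≡ g j) → Rep (writeMove q s moveL (conf q₀ ls h rs)) g' p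
  go [] lf = rep (trans (lf 0 p refl) (sym (other (i+1+j≢j 0 p refl)))) rt'
    λ i j e → trans (lf (suc i) j (cong suc e)) (sym (other (i+1+j≢j (suc i) j (cong suc e))))
  go (l ∷ ls) lf = rep (trans (lf 0 p refl) (sym (other (i+1+j≢j 0 p refl)))) rt'
    λ i j e → trans (lf (suc i) j (cong suc e)) (sym (other (i+1+j≢j (suc i) j (cong suc e))))
rep-move {k = conf q₀ ls h rs} {g} {g'} {s = s} q (rep hd rt lf) (mR {p}) same other = go rs rt
  where
  lf' : ∀ i j → i + suc j ≡ suc p → nth (s ∷ ls) i ≡ g' j
  lf' zero j refl = sym same
  lf' (suc i) j e = trans (lf i j (suc-injective e)) (sym (other (i+1+j≢j i j (suc-injective e))))
  go : ∀ rs → (∀ i → nth rs i ≡ g (p + suc i)) → Rep (writeMove q s moveR (conf q₀ ls h rs)) g' (suc p)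
  go [] rt = rep (trans (rt 0) (trans (sym (other (m+1+n≢m p))) (cong g' (+-comm p 1))))
    (λ i → trans (rt (suc i)) (trans (sym (other (m+1+n≢m p))) (cong g' (+-suc p (suc i))))) lf'
  go (r ∷ rs) rt = rep (trans (rt 0) (trans (sym (other (m+1+n≢m p))) (cong g' (+-comm p 1))))
    (λ i → trans (rt (suc i)) (trans (sym (other (m+1+n≢m p))) (cong g' (+-suc p (suc i))))) lf'
rep-move {k = conf _ ls h rs} q (rep hd rt lf) (mS {p}) same other =
  rep (sym same) (λ i → trans (rt i) (sym (other (m+1+n≢m p)))) (λ i j e → trans (lf i j e) (sym (other (i+1+j≢j i j e))))

-- The parts of a compound program are not machines of their own. The induction therefore speaks of
-- a program placed inside a machine by `ι`, with `e` as the state in which control continues.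
Emb : (M : TM) (c : Prog) → (St c → Fin (TM.Q M)) → Fin (TM.Q M) → Set
Emb M c ι e = ∀ q s → TM.δ M (ι q) s ≡ just (maybe′ ι e (next c q s) , act c q s)

record Reaches (M : TM) (t : ℕ) (k : Config (TM.Q M)) (e : Fin (TM.Q M)) (g : Tape) (p : ℕ) : Set where
  constructor _,_
  field
    at   : state (run M t k) ≡ e
    repr : Rep (run M t k) g p

private
  reaches-by : ∀ {M t k k' e g p} → run M t k ≡ k' → state k' ≡ e → Rep k' g p → Reaches M t k e g p
  reaches-by refl s r = s , r

  one : ∀ M {q s m e g g' p p'} (k : Config (TM.Q M)) → state k ≡ q → Rep k g p →
        TM.δ M q (g p) ≡ just (e , s , m) → Moves m p p' → g' p ≡ s → (∀ {j} → j ≢ p → g' j ≡ g j) → Reaches M 1 k e g' p'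
  one M {s = s} {m} {e} k refl r eq mm same other =
    reaches-by (run-step M 0 k (trans (cong (TM.δ M (state k)) (Rep.hd r)) eq)) (writeMove-state e s m k) (rep-move e r mm same other)

  chain : ∀ M {t u k e e' g g' p p'} → Reaches M t k e g p →
          (∀ k → state k ≡ e → Rep k g p → Reaches M u k e' g' p') → Reaches M (t + u) k e' g' p'
  chain M {t} {u} {k} (s , r) f with f (run M t k) s r
  ... | s' , r' = reaches-by (run-+ M t u k) s' r'

exec-run : ∀ M c {ι e g p t g' p'} → Emb M c ι e → Exec c g p t g' p' →
           ∀ k → state k ≡ ι (entry c) → Rep k g p → Reaches M t k e g' p'
exec-run M (mv m) {g = g} {p} em (xmv mm) k s r = one M k s r (em tt (g p)) mm refl (λ _ → refl)
exec-run M (wr a) {g = g} {p} em xwr k s r = one M k s r (em tt (g p)) mS (upd-same g p a) (upd-other g p a)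
exec-run M (c ⨾ d) {ι} {e} em (xseq x y) k s r =
  chain M (exec-run M c em₁ x k s r) (exec-run M d em₂ y)
  where
  em₁ : Emb M c (ι ∘ inj₁) (ι (inj₂ (entry d)))
  em₁ q a with next c q a | em (inj₁ q) a
  ... | just _  | h = h
  ... | nothing | h = h
  em₂ : Emb M d (ι ∘ inj₂) e
  em₂ q a with next d q a | em (inj₂ q) a
  ... | just _  | h = h
  ... | nothing | h = h
exec-run M (ife b c d) {ι} {e} {g} {p} em (xif₁ bt x) k s r =
  chain M (one M k s r (trans (em nothing (g p)) (cong (λ v → just (ι (just (if v then _ else _)) , _)) bt)) mS refl (λ _ → refl)) (exec-run M c em₁ x)
  where
  em₁ : Emb M c (ι ∘ just ∘ inj₁) e
  em₁ q a with next c q a | em (just (inj₁ q)) a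
  ... | just _  | h = h
  ... | nothing | h = h
exec-run M (ife b c d) {ι} {e} {g} {p} em (xif₂ bf x) k s r =
  chain M (one M k s r (trans (em nothing (g p)) (cong (λ v → just (ι (just (if v then _ else _)) , _)) bf)) mS refl (λ _ → refl)) (exec-run M d em₂ x)
  where
  em₂ : Emb M d (ι ∘ just ∘ inj₂) e
  em₂ q a with next d q a | em (just (inj₂ q)) a
  ... | just _  | h = h
  ... | nothing | h = h
exec-run M (loop b c) {ι} {e} {g} {p} em (xstop bf) k s r =
  one M k s r (trans (em nothing (g p)) (cong (λ v → just (maybe′ ι e (if v then _ else _) , _)) bf)) mS refl (λ _ → refl)
exec-run M (loop b c) {ι} {e} {g} {p} em (xloop bt x y) k s r =
  chain M (one M k s r (trans (em nothing (g p)) (cong (λ v → just (maybe′ ι e (if v then _ else _) , _)) bt)) mS refl (λ _ → refl))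
    λ k' s' r' → chain M (exec-run M c em₁ x k' s' r') (exec-run M (loop b c) em y)
  where
  em₁ : Emb M c (ι ∘ just) (ι nothing)
  em₁ q a with next c q a | em (just q) a
  ... | just _  | h = h
  ... | nothing | h = h

-- Input at an offset, output, and polynomial-time computability

initTape : ℕ → List Bool → Tape
initTape o x = nth (replicate o blank ++ map bitSym x)

-- The index `length bs` is included on purpose: the blank after the last bit is where `readBits`
-- stops.
Reads : Tape → ℕ → List Bool → Set
Reads g p bs = ∀ i → i ≤ length bs → g (p + i) ≡ nth (map bitSym bs) i

readBits-nth : ∀ ss bs → (∀ i → i ≤ length bs → nth ss i ≡ nth (map bitSym bs) i) → readBits ss ≡ bs
readBits-nth [] [] h = refl
readBits-nth (s ∷ ss) [] h with h 0 z≤n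
... | refl = refl
readBits-nth [] (false ∷ bs) h with h 0 z≤n
... | ()
readBits-nth [] (true ∷ bs) h with h 0 z≤n
... | ()
readBits-nth (s ∷ ss) (false ∷ bs) h with h 0 z≤n
... | refl = cong (false ∷_) (readBits-nth ss bs (λ i i≤ → h (suc i) (s≤s i≤)))
readBits-nth (s ∷ ss) (true ∷ bs) h with h 0 z≤n
... | refl = cong (true ∷_) (readBits-nth ss bs (λ i i≤ → h (suc i) (s≤s i≤)))

nth-pad : ∀ o ss i → nth (replicate o blank ++ ss) (o + i) ≡ nth ss i
nth-pad zero    ss i = refl
nth-pad (suc o) ss i = nth-pad o ss i

nth-blank : ∀ o ss j → j < o → nth (replicate o blank ++ ss) j ≡ blank
nth-blank (suc o) ss zero    _         = refl
nth-blank (suc o) ss (suc j) (s≤s j<o) = nth-blank o ss j j<o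

init-rep : ∀ M o x → Rep (initConf M x) (initTape o x) o
init-rep M o x = rep (go₁ x) (go₂ x) (go₃ x)
  where
  go₁ : ∀ x → head (initConf M x) ≡ initTape o x o
  go₁ []      = trans (sym (nth-pad o [] 0)) (cong (initTape o []) (+-identityʳ o))
  go₁ (b ∷ x) = trans (sym (nth-pad o (map bitSym (b ∷ x)) 0)) (cong (initTape o (b ∷ x)) (+-identityʳ o))
  go₂ : ∀ x i → nth (right (initConf M x)) i ≡ initTape o x (o + suc i)
  go₂ []      i = sym (nth-pad o [] (suc i))
  go₂ (b ∷ x) i = sym (nth-pad o (map bitSym (b ∷ x)) (suc i))
  go₃ : ∀ x i j → i + suc j ≡ o → nth (left (initConf M x)) i ≡ initTape o x j
  go₃ []      i j e = sym (nth-blank o [] j (subst (j <_) e (m≤n+m (suc j) i)))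
  go₃ (b ∷ x) i j e = sym (nth-blank o (map bitSym (b ∷ x)) j (subst (j <_) e (m≤n+m (suc j) i)))

initConf-state : ∀ M x → state (initConf M x) ≡ TM.start M
initConf-state M []      = refl
initConf-state M (_ ∷ _) = refl

-- The machine does not see the offset `o`, which may therefore depend on `x`. One execution settles
-- the output at every halting time, because all halted configurations of a run coincide.
computable : (c : Prog) (f : List Bool → List Bool) (b : ℕ) →
  (∀ x → ∃ λ o → ∃ λ g → ∃ λ p → ∃ λ t → Exec c (initTape o x) o t g p × t ≤ polyBound b (length x) × Reads g p (f x)) →
  PolyComputable f
computable c f b h = M , (b , halts) , outp
  where
  M = machine c
  em : Emb M c (suc ∘ enc c) zero
  em q s rewrite dec-enc c q = refl
  reach : ∀ x → let o , g , p , t , _ = h x in Reaches M t (initConf M x) zero g p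
  reach x = let o , g , p , t , ex , _ = h x in
    exec-run M c em ex (initConf M x) (initConf-state M x) (init-rep M o x)
  halted : ∀ x → let o , g , p , t , _ = h x in Halted M (runOn M t x)
  halted x rewrite Reaches.at (reach x) = refl
  halts : ∀ x → Halted M (runOn M (polyBound b (length x)) x)
  halts x = let o , g , p , t , ex , t≤ , _ = h x in halted-≤ M (initConf M x) t≤ (halted x)
  outp : ∀ x t → Halted M (runOn M t x) → output (runOn M t x) ≡ f x
  outp x t ht = let o , g , p , u , ex , _ , rd = h x
                    r = Reaches.repr (reach x) in
    trans (cong output (halted-unique M t u (initConf M x) ht (halted x)))
      (readBits-nth _ (f x) λ { zero _ → trans (Rep.hd r) (trans (cong g (sym (+-identityʳ p))) (rd 0 z≤n))
                              ; (suc i) i≤ → trans (Rep.rt r i) (rd (suc i) i≤) })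

-- Walking on a tape with unary tracks

isb1 nonblank notb0 : Sym → Bool
isb1 b1 = true
isb1 _  = false
nonblank blank = false
nonblank _     = true
notb0 b0 = false
notb0 _  = true

cell : Bool → Sym
cell true  = b1
cell false = blank

isb1-cell : ∀ b → isb1 (cell b) ≡ b
isb1-cell true  = refl
isb1-cell false = refl

notb0-cell : ∀ b → notb0 (cell b) ≡ true
notb0-cell true  = refl
notb0-cell false = refl

nonblank-bit : ∀ b → nonblank (bitSym b) ≡ true
nonblank-bit true  = refl
nonblank-bit false = refl

Run : Prog → ℕ → Tape → ℕ → Tape → ℕ → Set
Run c n g p g' p' = ∃ λ t → t ≤ n × Exec c g p t g' p'

infixr 5 _⊙_
_⊙_ : ∀ {c d m n g p g' p' g'' p''} → Run c m g p g' p' → Run d n g' p' g'' p'' → Run (c ⨾ d) (m + n) g p g'' p''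
(t , t≤ , x) ⊙ (u , u≤ , y) = t + u , +-mono-≤ t≤ u≤ , xseq x y

relax : ∀ {c m n g p g' p'} → m ≤ n → Run c m g p g' p' → Run c n g p g' p'
relax m≤n (t , t≤ , x) = t , ≤-trans t≤ m≤n , x

run-to : ∀ {c n g p g' p' p''} → p' ≡ p'' → Run c n g p g' p' → Run c n g p g' p''
run-to refl r = r

run-from : ∀ {c n g p q g' p'} → p ≡ q → Run c n g p g' p' → Run c n g q g' p'
run-from refl r = r

exec-to : ∀ {c t g p g' p' p''} → p' ≡ p'' → Exec c g p t g' p' → Exec c g p t g' p''
exec-to refl x = x

exec-from : ∀ {c t g p q g' p'} → p ≡ q → Exec c g p t g' p' → Exec c g q t g' p'
exec-from refl x = x

run-mv : ∀ {m g p p'} → Moves m p p' → Run (mv m) 1 g p g p'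
run-mv mm = 1 , ≤-refl , xmv mm

run-wr : ∀ {s g p} → Run (wr s) 1 g p (upd g p s) p
run-wr = 1 , ≤-refl , xwr

walkL : ∀ b g q d → (∀ j → q < j → j ≤ d + q → b (g j) ≡ true) → b (g q) ≡ false →
        Exec (loop b (mv moveL)) g (d + q) (d * 2 + 1) g q
walkL b g q zero    h e = xstop e
walkL b g q (suc d) h e = xloop (h _ (s≤s (m≤n+m q d)) ≤-refl) (xmv mL)
  (walkL b g q d (λ j q<j j≤ → h j q<j (m≤n⇒m≤1+n j≤)) e)

walkR : ∀ b g q d → (∀ j → q ≤ j → j < d + q → b (g j) ≡ true) → b (g (d + q)) ≡ false →
        Exec (loop b (mv moveR)) g q (d * 2 + 1) g (d + q)
walkR b g q zero    h e = xstop e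
walkR b g q (suc d) h e = xloop (h q ≤-refl (s≤s (m≤n+m q d))) (xmv mR)
  (exec-to (+-suc d q)
    (walkR b g (suc q) d (λ j q<j j< → h j (<⇒≤ q<j) (subst (j <_) (+-suc d q) j<)) (trans (cong (b ∘ g) (+-suc d q)) e)))

goL goR : Prog
goL = mv moveL ⨾ loop nonblank (mv moveL)
goR = mv moveR ⨾ loop nonblank (mv moveR)

walk-cost : ∀ {d z} → d ≤ z → d * 2 + 1 ≤ z * 2 + 1
walk-cost d≤z = +-monoˡ-≤ 1 (*-monoˡ-≤ 2 d≤z)

go-left : ∀ {g p q z} → p ≤ z → q < p → g q ≡ blank → (∀ j → q < j → j < p → nonblank (g j) ≡ true) →
          Run goL (1 + (z * 2 + 1)) g p g q
go-left {g} {suc p} {q} {z} p≤z (s≤s q≤p) e h =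
  run-mv mL ⊙ (_ , walk-cost (≤-trans (m∸n≤m p q) (≤-trans (n≤1+n p) p≤z)) ,
    exec-from (m∸n+n≡m q≤p)
      (walkL nonblank g q (p ∸ q) (λ j q<j j≤ → h j q<j (s≤s (subst (j ≤_) (m∸n+n≡m q≤p) j≤))) (cong nonblank e)))

go-right : ∀ {g p q z} → q ≤ z → p < q → g q ≡ blank → (∀ j → p < j → j < q → nonblank (g j) ≡ true) →
           Run goR (1 + (z * 2 + 1)) g p g q
go-right {g} {p} {q} {z} q≤z p<q e h =
  run-mv mR ⊙ (_ , walk-cost (≤-trans (m∸n≤m q (suc p)) q≤z) ,
    exec-to (m∸n+n≡m p<q)
      (walkR nonblank g (suc p) (q ∸ suc p) (λ j p<j j< → h j p<j (subst (j <_) (m∸n+n≡m p<q) j<))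
        (cong nonblank (trans (cong g (m∸n+n≡m p<q)) e))))

mvs : Move → ℕ → Prog
mvs m zero    = mv stay
mvs m (suc n) = mv m ⨾ mvs m n

mvs-R : ∀ n {g p z} → n ≤ z → Run (mvs moveR n) (suc z) g p g (n + p)
mvs-R zero n≤z = relax (s≤s z≤n) (run-mv mS)
mvs-R (suc n) {p = p} {suc z} (s≤s n≤z) = run-mv mR ⊙ run-to (+-suc n p) (mvs-R n n≤z)

mvs-L : ∀ n {g p z} → n ≤ z → Run (mvs moveL n) (suc z) g (n + p) g p
mvs-L zero n≤z = relax (s≤s z≤n) (run-mv mS)
mvs-L (suc n) {z = suc z} (s≤s n≤z) = run-mv mL ⊙ mvs-L n n≤z

nthB : List Bool → ℕ → Bool
nthB []       _       = false
nthB (b ∷ bs) zero    = b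
nthB (b ∷ bs) (suc i) = nthB bs i

slot-injective : ∀ {κ} l l' (i i' : Fin κ) → l * κ + toℕ i ≡ l' * κ + toℕ i' → l ≡ l' × i ≡ i'
slot-injective zero zero i i' e = refl , toℕ-injective e
slot-injective {κ} zero (suc l') i i' e = ⊥-elim (<-irrefl e (<-≤-trans (toℕ<n i)
  (≤-trans (m≤m+n κ (l' * κ)) (m≤m+n (κ + l' * κ) (toℕ i')))))
slot-injective {κ} (suc l) zero i i' e = ⊥-elim (<-irrefl (sym e) (<-≤-trans (toℕ<n i')
  (≤-trans (m≤m+n κ (l * κ)) (m≤m+n (κ + l * κ) (toℕ i)))))
slot-injective {κ} (suc l) (suc l') i i' e with slot-injective l l' i i'
  (+-cancelˡ-≡ κ _ _ (trans (sym (+-assoc κ _ _)) (trans e (+-assoc κ _ _))))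
... | refl , eq = refl , eq

<ᵇ-true : ∀ {m n} → m < n → (m <ᵇ n) ≡ true
<ᵇ-true {m} {n} m<n with m <ᵇ n | <⇒<ᵇ m<n
... | true | _ = refl

<ᵇ-false : ∀ {m n} → n ≤ m → (m <ᵇ n) ≡ false
<ᵇ-false {m} {n} n≤m with m <ᵇ n | <ᵇ⇒< m n
... | false | _ = refl
... | true  | f = ⊥-elim (<⇒≱ (f tt) n≤m)

<ᵇ-suc : ∀ l v → l ≢ v → (l <ᵇ suc v) ≡ (l <ᵇ v)
<ᵇ-suc l v l≢v with <-cmp l v
... | tri< l<v _ _ = trans (<ᵇ-true (m<n⇒m<1+n l<v)) (sym (<ᵇ-true l<v))
... | tri≈ _ l≡v _ = ⊥-elim (l≢v l≡v)
... | tri> _ _ v<l = trans (<ᵇ-false v<l) (sym (<ᵇ-false (<⇒≤ v<l)))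

-- Strides of length `κ` stay on one track, so the walk ends at its lowest unset level. For a
-- counter this level is the value.
walkT : ∀ {κ} → Fin κ → Prog
walkT {κ} i = mvs moveR (2 + toℕ i) ⨾ loop isb1 (mvs moveR κ)

-- Right of home the tape holds only `b1` and blanks, so the first `b0` met is the home cell.
ret : Prog
ret = loop notb0 (mv moveL)

-- In unary, the cell of track `j` at the level where track `i` ends is set exactly when counter `i`
-- is less than counter `j`; on track 0 it is the bit with that index. One walk thus serves both
-- kinds of test, and `setP i i` is the increment.
shift testP setP : ∀ {κ} → Fin κ → Fin κ → Prog
shift i j = mvs moveL (toℕ i) ⨾ mvs moveR (toℕ j)
testP i j = walkT i ⨾ shift i j
setP i j = testP i j ⨾ wr b1 ⨾ ret

eraseP : ∀ {κ} → Fin κ → Prog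
eraseP {κ} i = mvs moveR (2 + toℕ i) ⨾ loop isb1 (wr blank ⨾ mvs moveR κ) ⨾ ret

-- Running times; κ is the number of tracks, h the home cell, and B bounds the levels in use.
walkN testN : ℕ → ℕ → ℕ
retN opN eraseN : ℕ → ℕ → ℕ → ℕ
shiftN : ℕ → ℕ
walkN κ B = suc (2 + κ) + (B * (2 + κ) + 1)
retN κ h B = (2 + h + (B * κ + κ)) * 2 + 1
shiftN κ = suc κ + suc κ
testN κ B = walkN κ B + shiftN κ
opN κ h B = testN κ B + (1 + retN κ h B)
eraseN κ h B = suc (2 + κ) + (B * (3 + κ) + 1 + retN κ h B)

-- Tape layout, with home cell h : output, blank, input, b0 (home), blank, tracks.
-- Level l of track i is the cell h + 2 + (l κ + i); a counter is the unary track that is set exactly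
-- below its value, and track 0 holds a bit string.
module Tracks (K : ℕ) (h : ℕ) where

  κ : ℕ
  κ = suc K

  Track : Set
  Track = Fin κ → ℕ → Bool

  slot : ℕ → Fin κ → ℕ
  slot l i = 2 + h + (l * κ + toℕ i)

  record LayT (τ : Track) (g : Tape) : Set where
    field
      home  : g h ≡ b0
      gap   : g (suc h) ≡ blank
      cells : ∀ l i → g (slot l i) ≡ cell (τ i l)

  Same : Tape → Tape → Set
  Same g g' = ∀ j → j ≤ h → g' j ≡ g j

  slot>h : ∀ l i → h < slot l i
  slot>h l i = s≤s (≤-trans (n≤1+n h) (s≤s (m≤m+n h _)))

  slot-cover : ∀ j → suc h < j → ∃ λ l → ∃ λ i → j ≡ slot l i
  slot-cover j h<j with (j ∸ (2 + h)) divMod κ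
  ... | result q r eq = q , r , trans (sym (m+[n∸m]≡n h<j)) (cong (2 + h +_) (trans eq (+-comm (toℕ r) (q * κ))))

  above-home : ∀ {τ g} → LayT τ g → ∀ j → h < j → notb0 (g j) ≡ true
  above-home {τ} lay j h<j with j ≟ suc h
  ... | yes refl = cong notb0 (LayT.gap lay)
  ... | no j≢ with slot-cover j (≤∧≢⇒< h<j (j≢ ∘ sym))
  ...   | l , i , refl = trans (cong notb0 (LayT.cells lay l i)) (notb0-cell (τ i l))

  set : Track → Fin κ → ℕ → Bool → Track
  set τ i l b i' l' with i' Fin.≟ i | l' ≟ l
  ... | yes _ | yes _ = b
  ... | _     | _     = τ i' l'

  set-same : ∀ τ i l b → set τ i l b i l ≡ b
  set-same τ i l b with i Fin.≟ i | l ≟ l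
  ... | yes _ | yes _ = refl
  ... | yes _ | no ne = ⊥-elim (ne refl)
  ... | no ne | _     = ⊥-elim (ne refl)

  set-track : ∀ τ i l b {i' l'} → i' ≢ i → set τ i l b i' l' ≡ τ i' l'
  set-track τ i l b {i'} {l'} ne with i' Fin.≟ i | l' ≟ l
  ... | yes e | _ = ⊥-elim (ne e)
  ... | no _  | _ = refl

  set-level : ∀ τ i l b {i' l'} → l' ≢ l → set τ i l b i' l' ≡ τ i' l'
  set-level τ i l b {i'} {l'} ne with i' Fin.≟ i | l' ≟ l
  ... | _     | yes e = ⊥-elim (ne e)
  ... | yes _ | no _  = refl
  ... | no _  | no _  = refl

  lay-write : ∀ {τ g} l i b → LayT τ g → LayT (set τ i l b) (upd g (slot l i) (cell b))
  lay-write {τ} {g} l i b lay = record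
    { home = trans (upd-other g _ _ (<⇒≢ (slot>h l i))) home
    ; gap = trans (upd-other g _ _ (<⇒≢ (s≤s (s≤s (m≤m+n h _))))) gap
    ; cells = go }
    where
    open LayT lay
    go : ∀ l' i' → upd g (slot l i) (cell b) (slot l' i') ≡ cell (set τ i l b i' l')
    go l' i' with slot l' i' ≟ slot l i
    ... | yes e with slot-injective l' l i' i (+-cancelˡ-≡ (2 + h) _ _ e)
    ...   | refl , refl = cong cell (sym (set-same τ i l b))
    go l' i' | no ne with i' Fin.≟ i | l' ≟ l
    ...   | yes refl | yes refl = ⊥-elim (ne refl)
    ...   | yes _    | no _     = cells l' i'
    ...   | no _     | _        = cells l' i'

  same-write : ∀ g l i s → Same g (upd g (slot l i) s)
  same-write g l i s j j≤h = upd-other g _ s (<⇒≢ (≤-<-trans j≤h (slot>h l i)))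

  lay-cong : ∀ {τ τ' g} → (∀ i l → τ i l ≡ τ' i l) → LayT τ g → LayT τ' g
  lay-cong eq lay = record { home = home ; gap = gap ; cells = λ l i → trans (cells l i) (cong cell (eq i l)) }
    where open LayT lay

  lay-left : ∀ {τ g p s} → p < h → LayT τ g → LayT τ (upd g p s)
  lay-left {g = g} p<h lay = record
    { home = trans (upd-other g _ _ (<⇒≢ p<h ∘ sym)) home
    ; gap = trans (upd-other g _ _ (<⇒≢ (m<n⇒m<1+n p<h) ∘ sym)) gap
    ; cells = λ l i → trans (upd-other g _ _ (<⇒≢ (<-trans p<h (slot>h l i)) ∘ sym)) (cells l i) }
    where open LayT lay

  slot-step : ∀ l i → κ + slot l i ≡ slot (suc l) i
  slot-step l i = lem κ h (l * κ) (toℕ i)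
    where
    lem : ∀ k h a b → k + (2 + h + (a + b)) ≡ 2 + h + ((k + a) + b)
    lem = solve-∀

  loop-walk : ∀ {τ g} i d a → LayT τ g → (∀ l → a ≤ l → l < d + a → τ i l ≡ true) → τ i (d + a) ≡ false →
              Run (loop isb1 (mvs moveR κ)) (d * (2 + κ) + 1) g (slot a i) g (slot (d + a) i)
  loop-walk {τ} {g} i zero a lay t f = 1 , ≤-refl , xstop (trans (cong isb1 (LayT.cells lay a i)) (trans (isb1-cell _) f))
  loop-walk {τ} {g} i (suc d) a lay t f
    with mvs-R κ {g} {slot a i} ≤-refl | loop-walk i d (suc a) lay
           (λ l a<l l< → t l (<⇒≤ a<l) (subst (l <_) (+-suc d a) l<)) (trans (cong (τ i) (+-suc d a)) f)
  ... | u , u≤ , x | v , v≤ , y = suc (u + v) , ≤-trans (s≤s (+-mono-≤ u≤ v≤)) (≤-reflexive (lem κ (d * (2 + κ)))) ,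
    xloop (trans (cong isb1 (LayT.cells lay a i)) (trans (isb1-cell _) (t a ≤-refl (s≤s (m≤n+m a d)))))
      (exec-to (slot-step a i) x)
      (exec-to (cong (λ w → slot w i) (+-suc d a)) y)
    where
    lem : ∀ k c → suc (suc k + (c + 1)) ≡ 2 + k + c + 1
    lem = solve-∀

  run-walkT : ∀ {τ g B} i l → LayT τ g → l ≤ B → (∀ l' → l' < l → τ i l' ≡ true) → τ i l ≡ false →
              Run (walkT i) (walkN κ B) g h g (slot l i)
  run-walkT {τ} {g} {B} i l lay l≤B t f =
    run-to (lem h (toℕ i)) (mvs-R (2 + toℕ i) (s≤s (s≤s (<⇒≤ (toℕ<n i))))) ⊙
    run-to (cong (λ w → slot w i) (+-identityʳ l)) (relax (+-monoˡ-≤ 1 (*-monoˡ-≤ (2 + κ) l≤B))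
      (loop-walk i l 0 lay (λ l' _ l'< → t l' (subst (l' <_) (+-identityʳ l) l'<)) (trans (cong (τ i) (+-identityʳ l)) f)))
    where
    lem : ∀ h i → 2 + i + h ≡ 2 + h + (0 + i)
    lem = solve-∀

  run-ret : ∀ {τ g B} l i → LayT τ g → l ≤ B → Run ret (retN κ h B) g (slot l i) g h
  run-ret {τ} {g} {B} l i lay l≤B = _ , walk-cost (≤-trans (m∸n≤m (slot l i) h)
      (+-monoʳ-≤ (2 + h) (+-mono-≤ (*-monoˡ-≤ κ l≤B) (<⇒≤ (toℕ<n i))))) ,
    exec-from (m∸n+n≡m (<⇒≤ (slot>h l i)))
      (walkL notb0 g h (slot l i ∸ h) (λ j h<j _ → above-home lay j h<j) (cong notb0 (LayT.home lay)))

  record After (c : Prog) (n : ℕ) (g : Tape) (τ : Track) : Set where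
    constructor after
    field
      {tape} : Tape
      run!   : Run c n g h tape h
      lay    : LayT τ tape
      same   : Same g tape

  run-shift : ∀ {g} l i j → Run (shift i j) (shiftN κ) g (slot l i) g (slot l j)
  run-shift {g} l i j = run-from (lem (toℕ i) h (l * κ)) (mvs-L (toℕ i) {g} {2 + h + l * κ} (<⇒≤ (toℕ<n i))) ⊙
    run-to (lem (toℕ j) h (l * κ)) (mvs-R (toℕ j) (<⇒≤ (toℕ<n j)))
    where
    lem : ∀ i h a → i + (2 + h + a) ≡ 2 + h + (a + i)
    lem = solve-∀

  run-test : ∀ {τ g B} i j l → LayT τ g → l ≤ B → (∀ l' → l' < l → τ i l' ≡ true) → τ i l ≡ false →
             Run (testP i j) (testN κ B) g h g (slot l j)
  run-test i j l lay l≤B t f = run-walkT i l lay l≤B t f ⊙ run-shift l i j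

  run-set : ∀ {τ g B} i j l → LayT τ g → l ≤ B → (∀ l' → l' < l → τ i l' ≡ true) → τ i l ≡ false →
            After (setP i j) (opN κ h B) g (set τ j l true)
  run-set {τ} {g} i j l lay l≤B t f =
    after (run-test i j l lay l≤B t f ⊙ run-wr ⊙ run-ret l j (lay-write l j true lay) l≤B)
      (lay-write l j true lay) (same-write g l j b1)

  erase : Track → Fin κ → ℕ → ℕ → Track
  erase τ i a zero    = τ
  erase τ i a (suc d) = erase (set τ i a false) i (suc a) d

  erase-track : ∀ d τ i a {i' l} → i' ≢ i → erase τ i a d i' l ≡ τ i' l
  erase-track zero    τ i a ne = refl
  erase-track (suc d) τ i a ne = trans (erase-track d (set τ i a false) i (suc a) ne) (set-track τ i a false ne)

  erase-level : ∀ d τ i a {l} → (l < a → τ i l ≡ false) → (d + a ≤ l → τ i l ≡ false) → erase τ i a d i l ≡ false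
  erase-level zero τ i a {l} below above with l <? a
  ... | yes l<a = below l<a
  ... | no l≮a  = above (≮⇒≥ l≮a)
  erase-level (suc d) τ i a {l} below above = erase-level d (set τ i a false) i (suc a) below' above'
    where
    below' : l < suc a → set τ i a false i l ≡ false
    below' l<a with m≤n⇒m<n∨m≡n (≤-pred l<a)
    ... | inj₂ refl = set-same τ i l false
    ... | inj₁ l<a' = trans (set-level τ i a false (<⇒≢ l<a')) (below l<a')
    above' : d + suc a ≤ l → set τ i a false i l ≡ false
    above' le = trans (set-level τ i a false (<⇒≢ (<-≤-trans (m≤n+m (suc a) d) le) ∘ sym)) (above (subst (_≤ l) (+-suc d a) le))

  loop-erase : ∀ {τ g} i d a → LayT τ g → (∀ l → a ≤ l → l < d + a → τ i l ≡ true) → τ i (d + a) ≡ false →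
    ∃ λ g' → Run (loop isb1 (wr blank ⨾ mvs moveR κ)) (d * (3 + κ) + 1) g (slot a i) g' (slot (d + a) i) ×
      LayT (erase τ i a d) g' × Same g g'
  loop-erase {τ} {g} i zero a lay t f = g ,
    (1 , ≤-refl , xstop (trans (cong isb1 (LayT.cells lay a i)) (trans (isb1-cell _) f))) , lay , (λ _ _ → refl)
  loop-erase {τ} {g} i (suc d) a lay t f
    with loop-erase i d (suc a) (lay-write a i false lay)
           (λ l a<l l< → trans (set-level τ i a false (<⇒≢ a<l ∘ sym)) (t l (<⇒≤ a<l) (subst (l <_) (+-suc d a) l<)))
           (trans (set-level τ i a false (<⇒≢ (m≤n+m (suc a) d) ∘ sym)) (trans (cong (τ i) (+-suc d a)) f))
       | run-wr {blank} {g} {slot a i} ⊙ mvs-R κ {upd g (slot a i) blank} {slot a i} ≤-refl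
  ... | g' , (v , v≤ , y) , lay' , same' | u , u≤ , x = g' ,
    (suc (u + v) , ≤-trans (s≤s (+-mono-≤ u≤ v≤)) (≤-reflexive (lem κ (d * (3 + κ)))) ,
      xloop (trans (cong isb1 (LayT.cells lay a i)) (trans (isb1-cell _) (t a ≤-refl (s≤s (m≤n+m a d)))))
        (exec-to (slot-step a i) x)
        (exec-to (cong (λ w → slot w i) (+-suc d a)) y)) ,
    lay' , (λ j j≤h → trans (same' j j≤h) (same-write g a i blank j j≤h))
    where
    lem : ∀ k c → suc (1 + suc k + (c + 1)) ≡ 3 + k + c + 1
    lem = solve-∀

  run-erase : ∀ {τ g B} i l → LayT τ g → l ≤ B → (∀ l' → l' < l → τ i l' ≡ true) → τ i l ≡ false →
              After (eraseP i) (eraseN κ h B) g (erase τ i 0 l)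
  run-erase {τ} {g} {B} i l lay l≤B t f
    with loop-erase i l 0 lay (λ l' _ l'< → t l' (subst (l' <_) (+-identityʳ l) l'<)) (trans (cong (τ i) (+-identityʳ l)) f)
  ... | g' , r , lay' , same' =
    after (run-to (lem h (toℕ i)) (mvs-R (2 + toℕ i) (s≤s (s≤s (<⇒≤ (toℕ<n i))))) ⊙
           run-to (cong (λ w → slot w i) (+-identityʳ l)) (relax (+-monoˡ-≤ 1 (*-monoˡ-≤ (3 + κ) l≤B)) r) ⊙
           run-ret l i lay' l≤B) lay' same'
    where
    lem : ∀ h i → 2 + i + h ≡ 2 + h + (0 + i)
    lem = solve-∀

  counters : List Bool → Vec ℕ K → Track
  counters X ρ zero    l = nthB X l
  counters X ρ (suc i) l = l <ᵇ ρ ! i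

  counters-inc : ∀ X ρ i i' l → set (counters X ρ) (suc i) (ρ ! i) true i' l ≡ counters X (ρ [ i ]≔ suc (ρ ! i)) i' l
  counters-inc X ρ i zero l = set-track (counters X ρ) (suc i) (ρ ! i) true {zero} {l} λ ()
  counters-inc X ρ i (suc i') l with i' Fin.≟ i
  ... | no ne rewrite lookup∘update′ ne ρ (suc (ρ ! i)) = refl
  ... | yes refl with l ≟ ρ ! i
  ...   | yes refl rewrite lookup∘update i ρ (suc (ρ ! i)) = sym (<ᵇ-true {ρ ! i} ≤-refl)
  ...   | no ne    rewrite lookup∘update i ρ (suc (ρ ! i)) = sym (<ᵇ-suc l _ ne)

  counters-clr : ∀ X ρ i i' l → erase (counters X ρ) (suc i) 0 (ρ ! i) i' l ≡ counters X (ρ [ i ]≔ 0) i' l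
  counters-clr X ρ i zero l = erase-track (ρ ! i) (counters X ρ) (suc i) 0 {zero} {l} λ ()
  counters-clr X ρ i (suc i') l with i' Fin.≟ i
  ... | no ne rewrite lookup∘update′ ne ρ 0 = erase-track (ρ ! i) (counters X ρ) (suc i) 0 (λ { refl → ne refl })
  ... | yes refl rewrite lookup∘update i ρ 0 = trans
    (erase-level (ρ ! i) (counters X ρ) (suc i) 0 (λ ()) (λ le → <ᵇ-false (subst (_≤ l) (+-identityʳ _) le)))
    (sym (<ᵇ-false {l} z≤n))

  run-inc : ∀ {X ρ g B} i → LayT (counters X ρ) g → ρ ! i ≤ B →
            After (setP (suc i) (suc i)) (opN κ h B) g (counters X (ρ [ i ]≔ suc (ρ ! i)))
  run-inc {X} {ρ} i lay le with run-set (suc i) (suc i) (ρ ! i) lay le (λ l' → <ᵇ-true) (<ᵇ-false {ρ ! i} ≤-refl)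
  ... | after r lay' same' = after r (lay-cong (counters-inc X ρ i) lay') same'

  run-clr : ∀ {X ρ g B} i → LayT (counters X ρ) g → ρ ! i ≤ B →
            After (eraseP (suc i)) (eraseN κ h B) g (counters X (ρ [ i ]≔ 0))
  run-clr {X} {ρ} i lay le with run-erase (suc i) (ρ ! i) lay le (λ l' → <ᵇ-true) (<ᵇ-false {ρ ! i} ≤-refl)
  ... | after r lay' same' = after r (lay-cong (counters-clr X ρ i) lay') same'

-- Counter programs

data Cmd (K : ℕ) : Set where
  skip    : Cmd K
  inc clr : Fin K → Cmd K
  emit    : Bool → Cmd K
  _▹_     : Cmd K → Cmd K → Cmd K
  while   : Fin K → Fin K → Cmd K → Cmd K
  ifX     : Fin K → Cmd K → Cmd K → Cmd K

infixr 5 _▹_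

-- The first `goL` stops at the blank between output and input, the second at the blank before the
-- output, which takes the new bit; so the output grows to the left and is never shifted. On the way
-- back the blank right of home stops the second `goR`.
emitP : Bool → Prog
emitP b = goL ⨾ goL ⨾ wr (bitSym b) ⨾ goR ⨾ goR ⨾ mv moveL

comp : ∀ {K} → Cmd K → Prog
comp skip          = mv stay
comp (inc i)       = setP (suc i) (suc i)
comp (clr i)       = eraseP (suc i)
comp (emit b)      = emitP b
comp (c ▹ d)       = comp c ⨾ comp d
comp (while i j c) = testP (suc i) (suc j) ⨾ loop isb1 (ret ⨾ comp c ⨾ testP (suc i) (suc j)) ⨾ ret
comp (ifX i c d)   = testP (suc i) zero ⨾ ife isb1 (ret ⨾ comp c) (ret ⨾ comp d)

State : ℕ → Set
State K = Vec ℕ K × List Bool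

-- Output is produced from its last bit to its first.
data Big {K} (X : List Bool) : Cmd K → State K → ℕ → State K → Set where
  ⇓skip   : ∀ {σ} → Big X skip σ 1 σ
  ⇓inc    : ∀ {ρ o i} → Big X (inc i) (ρ , o) 1 (ρ [ i ]≔ suc (ρ ! i) , o)
  ⇓clr    : ∀ {ρ o i} → Big X (clr i) (ρ , o) 1 (ρ [ i ]≔ 0 , o)
  ⇓emit   : ∀ {ρ o b} → Big X (emit b) (ρ , o) 1 (ρ , b ∷ o)
  ⇓seq    : ∀ {c d σ m σ' m' σ''} → Big X c σ m σ' → Big X d σ' m' σ'' → Big X (c ▹ d) σ (m + m') σ''
  ⇓stop   : ∀ {i j c ρ o} → ρ ! j ≤ ρ ! i → Big X (while i j c) (ρ , o) 1 (ρ , o)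
  ⇓again  : ∀ {i j c ρ o m σ' m' σ''} → ρ ! i < ρ ! j → Big X c (ρ , o) m σ' → Big X (while i j c) σ' m' σ'' →
            Big X (while i j c) (ρ , o) (suc (m + m')) σ''
  ⇓true   : ∀ {i c d ρ o m σ'} → nthB X (ρ ! i) ≡ true → Big X c (ρ , o) m σ' → Big X (ifX i c d) (ρ , o) (suc m) σ'
  ⇓false  : ∀ {i c d ρ o m σ'} → nthB X (ρ ! i) ≡ false → Big X d (ρ , o) m σ' → Big X (ifX i c d) (ρ , o) (suc m) σ'

-- One elementary command raises each counter and the output length by at most one, so `B + m` is a
-- bound after `m` commands.
record Bd {K} (B : ℕ) (σ : State K) : Set where
  constructor bnd
  field
    cnt : ∀ i → proj₁ σ ! i ≤ B
    len : length (proj₂ σ) ≤ B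

Bd-weaken : ∀ {K B B'} {σ : State K} → B ≤ B' → Bd B σ → Bd B' σ
Bd-weaken le (bnd bρ bo) = bnd (λ i → ≤-trans (bρ i) le) (≤-trans bo le)

Bd-set : ∀ {K B v} {ρ : Vec ℕ K} {o} i → v ≤ suc B → Bd B (ρ , o) → Bd (B + 1) (ρ [ i ]≔ v , o)
Bd-set {K} {B} {v} {ρ} i v≤ (bnd bρ bo) = bnd go (≤-trans bo (m≤m+n B 1))
  where
  go : ∀ i' → (ρ [ i ]≔ v) ! i' ≤ B + 1
  go i' with i' Fin.≟ i
  ... | yes refl rewrite lookup∘update i ρ v = subst (v ≤_) (+-comm 1 B) v≤
  ... | no ne rewrite lookup∘update′ ne ρ v = ≤-trans (bρ i') (m≤m+n B 1)

nonblank-nth : ∀ bs i → i < length bs → nonblank (nth (map bitSym bs) i) ≡ true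
nonblank-nth (b ∷ bs) zero    _         = nonblank-bit b
nonblank-nth (b ∷ bs) (suc i) (s≤s i<) = nonblank-nth bs i i<

nth-end : ∀ bs → nth (map bitSym bs) (length bs) ≡ blank
nth-end []       = refl
nth-end (b ∷ bs) = nth-end bs

record Left (h e : ℕ) (o : List Bool) (g : Tape) : Set where
  field
    from   : ℕ
    from-e : from + length o ≡ e
    mid    : ∀ j → e < j → j < h → nonblank (g j) ≡ true
    bits   : Reads g from o
    void   : ∀ j → j < from → g j ≡ blank

goN emitN : ℕ → ℕ
-- A uniform price for one elementary command: a sum rather than a maximum, so that it visibly
-- dominates each summand.
unit : ℕ → ℕ → ℕ → ℕ
goN h = 1 + (suc h * 2 + 1)
emitN h = goN h + (goN h + (1 + (goN h + (goN h + 1))))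
unit κ h B = opN κ h B + (eraseN κ h B + (emitN h + (testN κ B + retN κ h B + 3)))

-- `N` bounds the counters and the output length throughout the run. By `N < e` a free blank always
-- remains to the left of the output.
module Sim (K h e N : ℕ) (X : List Bool) (e<h : e < h) (N<e : N < e) where
  open Tracks K h public

  left-same : ∀ {o g g'} → Same g g' → Left h e o g → Left h e o g'
  left-same {o} {g} {g'} s l = record
    { from = from ; from-e = from-e
    ; mid = λ j e<j j<h → trans (cong nonblank (s j (<⇒≤ j<h))) (mid j e<j j<h)
    ; bits = λ i i≤ → trans (s (from + i) (≤-trans (subst (from + i ≤_) from-e (+-monoʳ-≤ from i≤)) (<⇒≤ e<h))) (bits i i≤)
    ; void = λ j j< → trans (s j (≤-trans (<⇒≤ j<) (≤-trans (subst (from ≤_) from-e (m≤m+n from _)) (<⇒≤ e<h)))) (void j j<) }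
    where open Left l

  left-sep : ∀ {o g} → Left h e o g → g e ≡ blank
  left-sep {o} {g} l = trans (cong g (sym from-e)) (trans (bits (length o) ≤-refl) (nth-end o))
    where open Left l

  left-out : ∀ {o g} (l : Left h e o g) → ∀ j → Left.from l ≤ j → j < e → nonblank (g j) ≡ true
  left-out {o} {g} l j f≤j j<e = trans (cong (nonblank ∘ g) (sym eq))
    (trans (cong nonblank (bits _ (<⇒≤ i<))) (nonblank-nth o _ i<))
    where
    open Left l
    eq : from + (j ∸ from) ≡ j
    eq = m+[n∸m]≡n f≤j
    i< : j ∸ from < length o
    i< = +-cancelˡ-< from _ _ (subst (_< from + length o) (sym eq) (subst (j <_) (sym from-e) j<e))

  home-right : ∀ {g p} → p < h → (∀ j → p < j → j < h → nonblank (g j) ≡ true) → g h ≡ b0 → g (suc h) ≡ blank →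
               Run (goR ⨾ mv moveL) ((goN h) + 1) g p g h
  home-right {g} {p} p<h mid hb gp =
    go-right ≤-refl (m<n⇒m<1+n p<h) gp (λ j p<j j≤h → go j p<j (m≤n⇒m<n∨m≡n (≤-pred j≤h))) ⊙ run-mv mL
    where
    go : ∀ j → p < j → j < h ⊎ j ≡ h → nonblank (g j) ≡ true
    go j e<j (inj₁ j<h)  = mid j e<j j<h
    go j e<j (inj₂ refl) = cong nonblank hb

  run-emit : ∀ {τ o g} b → length o < e → LayT τ g → Left h e o g →
             ∃ λ g' → Run (emitP b) (emitN h) g h g' h × LayT τ g' × Left h e (b ∷ o) g'
  run-emit {τ} {o} {g} b o<e lay l with Left.from l in eqf
  ... | zero = ⊥-elim (<-irrefl (trans (cong (_+ length o) (sym eqf)) (Left.from-e l)) o<e)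
  ... | suc a = g' ,
    (go-left (n≤1+n h) e<h (left-sep l) mid ⊙
     go-left (≤-trans (<⇒≤ e<h) (n≤1+n h)) a<e (void a (≤-reflexive (sym eqf)))
       (λ j a<j j<e → left-out l j (subst (_≤ j) (sym eqf) a<j) j<e) ⊙
     run-wr ⊙
     go-right (≤-trans (<⇒≤ e<h) (n≤1+n h)) a<e (trans (oth (<⇒≢ a<e ∘ sym)) (left-sep l))
       (λ j a<j j<e → trans (cong nonblank (oth (<⇒≢ a<j ∘ sym))) (left-out l j (subst (_≤ j) (sym eqf) a<j) j<e)) ⊙
     home-right e<h mid' (LayT.home lay') (LayT.gap lay')) ,
    lay' , record
      { from = a ; from-e = trans (+-suc a (length o)) (trans (cong (_+ length o) (sym eqf)) from-e)
      ; mid = mid'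
      ; bits = bits'
      ; void = λ j j<a → trans (oth (<⇒≢ j<a)) (void j (subst (j <_) (sym eqf) (m<n⇒m<1+n j<a))) }
    where
    open Left l
    g' = upd g a (bitSym b)
    oth : ∀ {j} → j ≢ a → g' j ≡ g j
    oth = upd-other g a (bitSym b)
    a<e : a < e
    a<e = subst (suc a ≤_) (trans (cong (_+ length o) (sym eqf)) from-e) (m≤m+n (suc a) (length o))
    lay' : LayT τ g'
    lay' = lay-left (<-trans a<e e<h) lay
    mid' : ∀ j → e < j → j < h → nonblank (g' j) ≡ true
    mid' j e<j j<h = trans (cong nonblank (oth (<⇒≢ (<-trans a<e e<j) ∘ sym))) (mid j e<j j<h)
    bits' : Reads g' a (b ∷ o)
    bits' zero i≤ = trans (cong g' (+-identityʳ a)) (upd-same g a _)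
    bits' (suc i) (s≤s i≤) = trans (oth (m+1+n≢m a)) (trans (cong g (trans (+-suc a i) (cong (_+ i) (sym eqf)))) (bits i i≤))

  op≤ : opN κ h N ≤ (unit κ h N)
  op≤ = m≤m+n (opN κ h N) _
  erase≤ : eraseN κ h N ≤ (unit κ h N)
  erase≤ = ≤-trans (m≤m+n (eraseN κ h N) _) (m≤n+m _ (opN κ h N))
  emit≤ : (emitN h) ≤ (unit κ h N)
  emit≤ = ≤-trans (m≤m+n (emitN h) _) (≤-trans (m≤n+m _ (eraseN κ h N)) (m≤n+m _ (opN κ h N)))
  test≤ : testN κ N + retN κ h N + 3 ≤ (unit κ h N)
  test≤ = ≤-trans (m≤n+m _ (emitN h)) (≤-trans (m≤n+m _ (eraseN κ h N)) (m≤n+m _ (opN κ h N)))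

  test1≤ : testN κ N + retN κ h N + 1 ≤ (unit κ h N)
  test1≤ = ≤-trans (+-monoʳ-≤ (testN κ N + retN κ h N) (s≤s z≤n)) test≤

  record Good (c : Cmd K) (g : Tape) (m B : ℕ) (σ : State K) : Set where
    constructor good
    field
      {tape} : Tape
      run!   : Run (comp c) (m * (unit κ h N)) g h tape h
      lay    : LayT (counters X (proj₁ σ)) tape
      lft    : Left h e (proj₂ σ) tape
      bd     : Bd (B + m) σ

  private
    1* : ∀ {n} → n ≤ (unit κ h N) → n ≤ 1 * (unit κ h N)
    1* le = ≤-trans le (≤-reflexive (sym (+-identityʳ (unit κ h N))))

  branch-cost : ∀ m → testN κ N + suc (retN κ h N + m * (unit κ h N)) ≤ suc m * (unit κ h N)
  branch-cost m = ≤-trans (≤-reflexive (lem (testN κ N) (retN κ h N) (m * (unit κ h N))))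
    (+-monoˡ-≤ (m * (unit κ h N)) test1≤)
    where
    lem : ∀ a b c → a + suc (b + c) ≡ a + b + 1 + c
    lem = solve-∀

  test-at : ∀ {ρ g B} i → LayT (counters X ρ) g → ρ ! i ≤ B → ∀ j → Run (testP (suc i) j) (testN κ B) g h g (slot (ρ ! i) j)
  test-at {ρ} i lay le j = run-test (suc i) j (ρ ! i) lay le (λ l' → <ᵇ-true) (<ᵇ-false {ρ ! i} ≤-refl)

  test-val : ∀ {ρ g} → LayT (counters X ρ) g → ∀ l j → isb1 (g (slot l j)) ≡ counters X ρ j l
  test-val lay l j = trans (cong isb1 (LayT.cells lay l j)) (isb1-cell _)

  -- Walks become longer as counters grow, so the price of a command is fixed in advance from the
  -- bound `N` for the whole run. The premise `B + m ≤ N` says that the budget is never exceeded.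
  sim : ∀ {c σ m σ'} → Big X c σ m σ' → ∀ {B g} → Bd B σ → B + m ≤ N →
        LayT (counters X (proj₁ σ)) g → Left h e (proj₂ σ) g → Good c g m B σ'
  sim ⇓skip {B} bd le lay l = good (relax (1* (≤-trans (m≤n+m 1 (testN κ N + retN κ h N)) test1≤)) (run-mv mS)) lay l (Bd-weaken (m≤m+n B 1) bd)
  sim (⇓inc {ρ} {i = i}) {B} bd le lay l
    with run-inc i lay (≤-trans (Bd.cnt bd i) (≤-trans (m≤m+n B 1) le))
  ... | after r lay' same = good (relax (1* op≤) r) lay' (left-same same l) (Bd-set i (s≤s (Bd.cnt bd i)) bd)
  sim (⇓clr {i = i}) {B} bd le lay l
    with run-clr i lay (≤-trans (Bd.cnt bd i) (≤-trans (m≤m+n B 1) le))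
  ... | after r lay' same = good (relax (1* erase≤) r) lay' (left-same same l) (Bd-set i z≤n bd)
  sim (⇓emit {b = b}) {B} bd le lay l
    with run-emit b (≤-<-trans (Bd.len bd) (<-trans (subst (_≤ N) (+-comm B 1) le) N<e)) lay l
  ... | g' , r , lay' , l' = good (relax (1* emit≤) r) lay' l'
    (bnd (λ i → ≤-trans (Bd.cnt bd i) (m≤m+n B 1)) (≤-trans (s≤s (Bd.len bd)) (≤-reflexive (+-comm 1 B))))
  sim (⇓seq {m = m} {m' = m'} x y) {B} bd le lay l
    with sim x bd (≤-trans (+-monoʳ-≤ B (m≤m+n m m')) le) lay l
  ... | good r₁ lay₁ l₁ bd₁ with sim y bd₁ (subst (_≤ N) (sym (+-assoc B m m')) le) lay₁ l₁
  ... | good r₂ lay₂ l₂ bd₂ = good (relax (≤-reflexive (sym (*-distribʳ-+ (unit κ h N) m m'))) (r₁ ⊙ r₂)) lay₂ l₂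
    (Bd-weaken (≤-reflexive (+-assoc B m m')) bd₂)
  sim (⇓stop {i} {j} {ρ = ρ} stop) {B} bd le lay l = good (relax (1* bound)
      (test-at i lay v≤ (suc j) ⊙ (1 , ≤-refl , xstop (trans (test-val lay _ (suc j)) (<ᵇ-false stop))) ⊙ run-ret _ (suc j) lay v≤))
      lay l (Bd-weaken (m≤m+n B 1) bd)
    where
    v≤ : ρ ! i ≤ N
    v≤ = ≤-trans (Bd.cnt bd i) (≤-trans (m≤m+n B 1) le)
    bound : testN κ N + (1 + retN κ h N) ≤ (unit κ h N)
    bound = ≤-trans (≤-reflexive (lem (testN κ N) (retN κ h N))) test1≤
      where
      lem : ∀ a b → a + (1 + b) ≡ a + b + 1
      lem = solve-∀
  sim (⇓again {i} {j} {ρ = ρ} {m = m} {m' = m'} go x y) {B} bd le lay l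
    with sim x bd (≤-trans (+-monoʳ-≤ B (≤-trans (m≤m+n m m') (n≤1+n _))) le) lay l
  ... | good (b , b≤ , xb) lay₁ l₁ bd₁
    with sim y bd₁ (≤-trans (≤-reflexive (+-assoc B m m')) (≤-trans (+-monoʳ-≤ B (n≤1+n _)) le)) lay₁ l₁
  -- The run of the remaining loop begins with its own test. In the compiled loop this test closes
  -- the body of the present round, so the run is taken apart and reassembled.
  ... | good (_ , t≤ , xseq {t = t} xt (xseq {t = u} {u = v} xl xr)) lay₂ l₂ bd₂
    with test-at i lay v≤ (suc j) | run-ret {B = N} (ρ ! i) (suc j) lay v≤
    where
    v≤ : ρ ! i ≤ N
    v≤ = ≤-trans (Bd.cnt bd i) (≤-trans (m≤m+n B _) le)
  ... | a , a≤ , xa | r , r≤ , xx = good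
    (a + (suc (r + (b + t) + u) + v) ,
      (begin
        a + (suc (r + (b + t) + u) + v)          ≡⟨ lem a r b t u v ⟩
        (a + r + 1) + (b + (t + (u + v)))        ≤⟨ +-mono-≤ (+-monoˡ-≤ 1 (+-mono-≤ a≤ r≤)) (+-mono-≤ b≤ t≤) ⟩
        (testN κ N + retN κ h N + 1) + (m * (unit κ h N) + m' * (unit κ h N)) ≤⟨ +-monoˡ-≤ _ test1≤ ⟩
        (unit κ h N) + (m * (unit κ h N) + m' * (unit κ h N))            ≡⟨ cong ((unit κ h N) +_) (sym (*-distribʳ-+ (unit κ h N) m m')) ⟩
        suc (m + m') * (unit κ h N)                      ∎) ,
      xseq xa (xseq (xloop (trans (test-val lay _ (suc j)) (<ᵇ-true go)) (xseq xx (xseq xb xt)) xl) xr))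
    lay₂ l₂ (Bd-weaken (≤-trans (≤-reflexive (+-assoc B m m')) (+-monoʳ-≤ B (n≤1+n _))) bd₂)
    where
    open ≤-Reasoning
    lem : ∀ a r b t u v → a + (suc (r + (b + t) + u) + v) ≡ (a + r + 1) + (b + (t + (u + v)))
    lem = solve-∀
  sim (⇓true {i} {ρ = ρ} {m = m} tr x) {B} bd le lay l
    with sim x bd (≤-trans (+-monoʳ-≤ B (n≤1+n m)) le) lay l
  ... | good r₁ lay₁ l₁ bd₁
    with run-ret {B = N} (ρ ! i) zero lay (≤-trans (Bd.cnt bd i) (≤-trans (m≤m+n B _) le)) ⊙ r₁
  ... | u , u≤ , xu = good (relax (branch-cost m) (test-at i lay (≤-trans (Bd.cnt bd i) (≤-trans (m≤m+n B _) le)) zero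
        ⊙ (suc u , s≤s u≤ , xif₁ (trans (test-val lay (ρ ! i) zero) tr) xu))) lay₁ l₁ (Bd-weaken (+-monoʳ-≤ B (n≤1+n m)) bd₁)
  sim (⇓false {i} {ρ = ρ} {m = m} tr x) {B} bd le lay l
    with sim x bd (≤-trans (+-monoʳ-≤ B (n≤1+n m)) le) lay l
  ... | good r₁ lay₁ l₁ bd₁
    with run-ret {B = N} (ρ ! i) zero lay (≤-trans (Bd.cnt bd i) (≤-trans (m≤m+n B _) le)) ⊙ r₁
  ... | u , u≤ , xu = good (relax (branch-cost m) (test-at i lay (≤-trans (Bd.cnt bd i) (≤-trans (m≤m+n B _) le)) zero
        ⊙ (suc u , s≤s u≤ , xif₂ (trans (test-val lay (ρ ! i) zero) tr) xu))) lay₁ l₁ (Bd-weaken (+-monoʳ-≤ B (n≤1+n m)) bd₁)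

-- Polynomial bounds, and reading the input

-- With a base of at least 2, constants and the doubling in a sum are absorbed by the exponent, so
-- this form is closed under all operations needed.
Poly : (ℕ → ℕ) → Set
Poly f = ∃ λ a → ∀ n → f n ≤ (2 + n) ^ a

n≤2^n : ∀ n → n ≤ 2 ^ n
n≤2^n zero    = z≤n
n≤2^n (suc n) = ≤-trans (+-mono-≤ (m^n>0 2 n) (n≤2^n n)) (≤-reflexive (cong (2 ^ n +_) (sym (+-identityʳ (2 ^ n)))))

poly-const : ∀ k → Poly (λ _ → k)
poly-const k = k , λ n → ≤-trans (n≤2^n k) (^-monoˡ-≤ k (m≤m+n 2 n))

poly-id : Poly (λ n → n)
poly-id = 1 , λ n → ≤-trans (m≤n+m n 2) (≤-reflexive (sym (*-identityʳ (2 + n))))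

poly-+ : ∀ {f g} → Poly f → Poly g → Poly (λ n → f n + g n)
poly-+ (a , hf) (b , hg) = suc (a + b) , λ n → ≤-trans
  (+-mono-≤ (≤-trans (hf n) (^-monoʳ-≤ (2 + n) (m≤m+n a b))) (≤-trans (hg n) (^-monoʳ-≤ (2 + n) (m≤n+m b a))))
  (≤-trans (≤-reflexive (cong ((2 + n) ^ (a + b) +_) (sym (+-identityʳ _)))) (*-monoˡ-≤ ((2 + n) ^ (a + b)) (m≤m+n 2 n)))

poly-* : ∀ {f g} → Poly f → Poly g → Poly (λ n → f n * g n)
poly-* (a , hf) (b , hg) = a + b , λ n → ≤-trans (*-mono-≤ (hf n) (hg n)) (≤-reflexive (sym (^-distribˡ-+-* (2 + n) a b)))

poly-^ : ∀ {f} → Poly f → ∀ c → Poly (λ n → f n ^ c)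
poly-^ p zero    = poly-const 1
poly-^ p (suc c) = poly-* p (poly-^ p c)

^-distrib-* : ∀ a m n → (m * n) ^ a ≡ m ^ a * n ^ a
^-distrib-* zero    m n = refl
^-distrib-* (suc a) m n = trans (cong (m * n *_) (^-distrib-* a m n)) (lem m n (m ^ a) (n ^ a))
  where
  lem : ∀ m n p q → m * n * (p * q) ≡ m * p * (n * q)
  lem = solve-∀

poly-bound : ∀ {f} → Poly f → ∃ λ b → ∀ n → f n ≤ polyBound b n
poly-bound {f} (a , hf) = b , λ n → ≤-trans (hf n) (go n)
  where
  -- For positive `n`, `2 + n ≤ 3 * n`, so `3 ^ a * n ^ a` is a bound; `b` must dominate both that
  -- factor and that exponent. At 0 the additive `b` suffices.
  b = 3 ^ a + a
  go : ∀ n → (2 + n) ^ a ≤ b * n ^ b + b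
  go zero = ≤-trans (^-monoˡ-≤ a (n≤1+n 2)) (≤-trans (m≤m+n (3 ^ a) a) (m≤n+m b (b * 0 ^ b)))
  go (suc k) = ≤-trans (^-monoˡ-≤ a le) (≤-trans (≤-reflexive (^-distrib-* a 3 (suc k)))
    (≤-trans (*-mono-≤ (m≤m+n (3 ^ a) a) (^-monoʳ-≤ (suc k) (m≤n+m a (3 ^ a)))) (m≤m+n (b * suc k ^ b) b)))
    where
    le : 3 + k ≤ 3 * suc k
    le = ≤-trans (m≤m+n (3 + k) (2 * k)) (≤-reflexive (lem k))
      where
      lem : ∀ k → 3 + k + 2 * k ≡ 3 * suc k
      lem = solve-∀

infixl 6 _⊕_
infixl 7 _⊗_
-- Bounds are mirrored as expressions so that their polynomiality follows from their shape.
data Expr : Set where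
  con     : ℕ → Expr
  at      : (f : ℕ → ℕ) → Poly f → Expr
  _⊕_ _⊗_ : Expr → Expr → Expr

⟦_⟧ : Expr → ℕ → ℕ
⟦ con k ⟧  n = k
⟦ at f _ ⟧ n = f n
⟦ a ⊕ b ⟧  n = ⟦ a ⟧ n + ⟦ b ⟧ n
⟦ a ⊗ b ⟧  n = ⟦ a ⟧ n * ⟦ b ⟧ n

poly : ∀ a → Poly ⟦ a ⟧
poly (con k)  = poly-const k
poly (at f p) = p
poly (a ⊕ b)  = poly-+ (poly a) (poly b)
poly (a ⊗ b)  = poly-* (poly a) (poly b)

-- Number of elementary commands, when no loop is repeated more than Y times.
cost : ∀ {K} → Cmd K → ℕ → ℕ
cost (c ▹ d)       Y = cost c Y + cost d Y
cost (while _ _ c) Y = Y * suc (cost c Y) + 1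
cost (ifX _ c d)   Y = suc (cost c Y + cost d Y)
cost _             Y = 1

cost-poly : ∀ {K} (c : Cmd K) {Y} → Poly Y → Poly (λ n → cost c (Y n))
cost-poly skip          pY = poly-const 1
cost-poly (inc _)       pY = poly-const 1
cost-poly (clr _)       pY = poly-const 1
cost-poly (emit _)      pY = poly-const 1
cost-poly (c ▹ d)       pY = poly-+ (cost-poly c pY) (cost-poly d pY)
cost-poly (while _ _ c) pY = poly (at _ pY ⊗ (con 1 ⊕ at _ (cost-poly c pY)) ⊕ con 1)
cost-poly (ifX _ c d)   pY = poly (con 1 ⊕ (at _ (cost-poly c pY) ⊕ at _ (cost-poly d pY)))

-- Copying the input to track 0

storeP : ∀ {K} → Fin K → Bool → Prog
storeP i true  = setP (suc i) zero
storeP i false = mv stay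

-- The cell being copied is blanked as a bookmark: `goL` from home stops there, and the bit is then
-- restored. Counter `i` holds the number of bits copied so far, which is the level for the next
-- one.
grabP : ∀ {K} → Fin K → Bool → Prog
grabP i b = wr blank ⨾ (goR ⨾ mv moveL) ⨾ storeP i b ⨾ setP (suc i) (suc i) ⨾ goL ⨾ wr (bitSym b) ⨾ mv moveL

-- The home mark is written at the right end of the input and copying proceeds to the left, so track
-- 0 receives the input reversed.
loadP : ∀ {K} → Fin K → Prog
loadP i = loop nonblank (mv moveR) ⨾ wr b0 ⨾ mv moveL ⨾
  loop nonblank (ife isb1 (grabP i true) (grabP i false)) ⨾ (goR ⨾ mv moveL)

-- The head of the list is the rightmost cell, in the order in which the bits are copied; cell `e`
-- is the blank that ends the copying.
Cells : Tape → ℕ → List Bool → Set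
Cells g e []       = g e ≡ blank
Cells g e (b ∷ rs) = g (suc (length rs) + e) ≡ bitSym b × Cells g e rs

nthB-snoc-last : ∀ X b → nthB (X ++ [ b ]) (length X) ≡ b
nthB-snoc-last []      b = refl
nthB-snoc-last (_ ∷ X) b = nthB-snoc-last X b

nthB-snoc-other : ∀ X b l → l ≢ length X → nthB (X ++ [ b ]) l ≡ nthB X l
nthB-snoc-other []      b zero    ne = ⊥-elim (ne refl)
nthB-snoc-other []      b (suc l) ne = refl
nthB-snoc-other (_ ∷ X) b zero    ne = refl
nthB-snoc-other (_ ∷ X) b (suc l) ne = nthB-snoc-other X b l (ne ∘ cong suc)

nthB-false : ∀ X l → nthB X l ≡ nthB (X ++ [ false ]) l
nthB-false []      zero    = refl
nthB-false []      (suc l) = refl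
nthB-false (_ ∷ X) zero    = refl
nthB-false (_ ∷ X) (suc l) = nthB-false X l

grabN : ℕ → ℕ → ℕ → ℕ
grabN κ h B = 1 + ((goN h + 1) + (opN κ h B + (opN κ h B + (goN h + (1 + 1)))))

module Load (K h e N : ℕ) (e<h : e < h) (N<e : N < e) (i : Fin K) (g₀ : Tape)
            (mid : ∀ j → e < j → j < h → nonblank (g₀ j) ≡ true) where
  open Sim K h e N [] e<h N<e

  store-true : ∀ X ρ → ρ ! i ≡ length X → ∀ i' l →
               set (counters X ρ) zero (ρ ! i) true i' l ≡ counters (X ++ [ true ]) ρ i' l
  store-true X ρ eq (suc i') l = set-track (counters X ρ) zero (ρ ! i) true {suc i'} {l} λ ()
  store-true X ρ eq zero l with l ≟ ρ ! i
  ... | yes refl rewrite eq = sym (nthB-snoc-last X true)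
  ... | no ne = sym (nthB-snoc-other X true l (λ e' → ne (trans e' (sym eq))))

  store-false : ∀ X (ρ : Vec ℕ K) i' l → counters X ρ i' l ≡ counters (X ++ [ false ]) ρ i' l
  store-false X ρ (suc i') l = refl
  store-false X ρ zero     l = nthB-false X l

  ρ[_] : ℕ → Vec ℕ K
  ρ[ k ] = vreplicate K 0 [ i ]≔ k

  ρ-self : ∀ k → ρ[ k ] ! i ≡ k
  ρ-self k = lookup∘update i (vreplicate K 0) k

  run-store : ∀ {g} X b → length X ≤ N → LayT (counters X ρ[ length X ]) g →
              After (storeP i b) (opN κ h N) g (counters (X ++ [ b ]) ρ[ length X ])
  run-store X false le lay = after (relax (≤-trans (m≤m+n 1 (retN κ h N)) (m≤n+m _ (testN κ N))) (run-mv mS))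
    (lay-cong (store-false X ρ[ length X ]) lay) (λ _ _ → refl)
  run-store {g} X true le lay
    with run-set {B = N} (suc i) zero (ρ[ length X ] ! i) lay (≤-trans (≤-reflexive (ρ-self _)) le) (λ l' → <ᵇ-true) (<ᵇ-false {ρ[ length X ] ! i} ≤-refl)
  ... | after r lay' same = after r (lay-cong (store-true X ρ[ length X ] (ρ-self _)) lay') same

  run-count : ∀ {g} Y k → k ≤ N → LayT (counters Y ρ[ k ]) g → After (setP (suc i) (suc i)) (opN κ h N) g (counters Y ρ[ suc k ])
  run-count Y k le lay with run-inc i lay (≤-trans (≤-reflexive (ρ-self k)) le)
  ... | after r lay' same = after r (subst (λ ρ → LayT (counters Y ρ) _)
    (trans ([]≔-idempotent (vreplicate K 0) i) (cong (λ k' → ρ[ suc k' ]) (ρ-self k))) lay') same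

  Intact : Tape → Set
  Intact g = ∀ j → j < h → g j ≡ g₀ j

  run-grab : ∀ {g} X b p → length X ≤ N → suc p < h → e ≤ p → LayT (counters X ρ[ length X ]) g → Intact g → g₀ (suc p) ≡ bitSym b →
    ∃ λ g' → Run (grabP i b) (grabN κ h N) g (suc p) g' p × LayT (counters (X ++ [ b ]) ρ[ suc (length X) ]) g' × Intact g'
  run-grab {g} X b p le p<h e≤p lay int eq with run-store X b le (lay-left {s = blank} p<h lay)
  ... | after {g₂} r₂ lay₂ same₂ with run-count (X ++ [ b ]) (length X) le lay₂
  ... | after {g₃} r₃ lay₃ same₃ = upd g₃ (suc p) (bitSym b) ,
    (run-wr ⊙ home-right p<h
       (λ j p<j j<h → trans (cong nonblank (upd-other g (suc p) blank (<⇒≢ p<j ∘ sym))) (nb j p<j j<h))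
       (LayT.home lay₁) (LayT.gap lay₁) ⊙ r₂ ⊙ r₃ ⊙
     go-left (n≤1+n h) p<h (trans (eq₃ (suc p) (<⇒≤ p<h)) (upd-same g (suc p) blank))
       (λ j p<j j<h → trans (cong nonblank (trans (eq₃ j (<⇒≤ j<h)) (upd-other g (suc p) blank (<⇒≢ p<j ∘ sym)))) (nb j p<j j<h)) ⊙
     run-wr ⊙ run-mv mL) ,
    lay-left p<h lay₃ , int'
    where
    lay₁ = lay-left {s = blank} p<h lay
    nb : ∀ j → suc p < j → j < h → nonblank (g j) ≡ true
    nb j p<j j<h = trans (cong nonblank (int j j<h)) (mid j (≤-<-trans e≤p (<-trans (n<1+n p) p<j)) j<h)
    eq₃ : ∀ j → j ≤ h → g₃ j ≡ upd g (suc p) blank j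
    eq₃ j j≤h = trans (same₃ j j≤h) (same₂ j j≤h)
    int' : Intact (upd g₃ (suc p) (bitSym b))
    int' j j<h with j ≟ suc p
    ... | yes refl = sym eq
    ... | no ne = trans (eq₃ j (<⇒≤ j<h)) (trans (upd-other g (suc p) blank ne) (int j j<h))

  load-loop : ∀ {g} rs X → length X + length rs ≤ N → length rs + e < h →
    LayT (counters X ρ[ length X ]) g → Intact g → Cells g₀ e rs →
    ∃ λ g' → Run (loop nonblank (ife isb1 (grabP i true) (grabP i false))) (length rs * (2 + (grabN κ h N)) + 1) g (length rs + e) g' e ×
      LayT (counters (X ++ rs) ρ[ length (X ++ rs) ]) g' × Intact g'
  load-loop {g} [] X le p<h lay int cs = g , (1 , ≤-refl , xstop (cong nonblank (trans (int e p<h) cs))) ,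
    subst (λ Y → LayT (counters Y ρ[ length Y ]) g) (sym (++-identityʳ X)) lay , int
  load-loop {g} (b ∷ rs) X le p<h lay int (c , cs)
    with run-grab X b (length rs + e) (≤-trans (m≤m+n _ _) le) p<h (m≤n+m e _) lay int c
  ... | g₁ , (t , t≤ , x) , lay₁ , int₁
    with load-loop rs (X ++ [ b ]) (≤-trans (≤-reflexive (trans (cong (_+ length rs) len) (sym (+-suc (length X) (length rs))))) le)
           (<-trans (n<1+n _) p<h) (subst (λ k → LayT (counters (X ++ [ b ]) ρ[ k ]) g₁) (sym len) lay₁) int₁ cs
    where
    len : length (X ++ [ b ]) ≡ suc (length X)
    len = trans (length-++ X) (+-comm (length X) 1)
  ... | g₂ , (u , u≤ , y) , lay₂ , int₂ = g₂ ,
    (suc (suc t + u) , ≤-trans (s≤s (+-mono-≤ (s≤s t≤) u≤)) (≤-reflexive (lem (grabN κ h N) (length rs * (2 + (grabN κ h N))))) ,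
      xloop (trans (cong nonblank here-bit) (nonblank-bit b)) (branch b x here-bit) y) ,
    subst (λ Y → LayT (counters Y ρ[ length Y ]) g₂) (++-assoc X [ b ] rs) lay₂ , int₂
    where
    here-bit : g (suc (length rs + e)) ≡ bitSym b
    here-bit = trans (int _ p<h) c
    branch : ∀ b {t g g' p p'} → Exec (grabP i b) g p t g' p' → g p ≡ bitSym b →
             Exec (ife isb1 (grabP i true) (grabP i false)) g p (suc t) g' p'
    branch true  x eq = xif₁ (cong isb1 eq) x
    branch false x eq = xif₂ (cong isb1 eq) x
    lem : ∀ a c → suc (suc a + (c + 1)) ≡ 2 + a + c + 1
    lem = solve-∀

cells-init : ∀ e rs zs → Cells (initTape (suc e) (reverse rs ++ zs)) e rs
cells-init e [] zs = nth-blank (suc e) (map bitSym zs) e ≤-refl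
cells-init e (b ∷ rs) zs rewrite unfold-reverse b rs | ++-assoc (reverse rs) [ b ] zs =
  (trans (cong (initTape (suc e) (reverse rs ++ b ∷ zs)) (cong suc (+-comm (length rs) e)))
    (trans (nth-pad (suc e) (map bitSym (reverse rs ++ b ∷ zs)) (length rs))
      (subst (λ k → nth (map bitSym (reverse rs ++ b ∷ zs)) k ≡ bitSym b) (length-reverse rs) (go (reverse rs))))) ,
  cells-init e rs (b ∷ zs)
  where
  go : ∀ ys → nth (map bitSym (ys ++ b ∷ zs)) (length ys) ≡ bitSym b
  go []       = refl
  go (_ ∷ ys) = go ys

-- From counter programs to polynomial-time computable functions

module Whole {K} (i : Fin K) (c : Cmd K) (f : List Bool → List Bool) (Y : ℕ → ℕ) (pY : Poly Y)
  (prog : ∀ x → ∃ λ ρ → ∃ λ m → m ≤ cost c (Y (length x)) ×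
          Big (reverse x) c (vreplicate K 0 [ i ]≔ length x , []) m (ρ , f x)) where

  -- Counters start at most at `n` and rise by at most one per command, which gives `N`. The input
  -- starts at cell `suc (E n)`, leaving more cells on its left than there can be output bits; home
  -- `H n` is the cell just after the input.
  N E H : ℕ → ℕ
  N n = n + cost c (Y n)
  E n = suc (N n)
  H n = suc (E n) + n

  E<H : ∀ n → E n < H n
  E<H n = m≤m+n (suc (E n)) n

  -- After the run, the two `goL` cross the input and the output, and the last move puts the head on
  -- the first output bit.
  wholeP : Prog
  wholeP = loadP i ⨾ comp c ⨾ goL ⨾ goL ⨾ mv moveR

  loadT wholeT : ℕ → ℕ
  loadT n = (n * 2 + 1) + (1 + (1 + ((n * (2 + grabN (suc K) (H n) (N n)) + 1) + (goN (H n) + 1))))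
  wholeT n = loadT n + (cost c (Y n) * unit (suc K) (H n) (N n) + (goN (H n) + (goN (H n) + 1)))

  poly-whole : Poly wholeT
  poly-whole = poly (at _ pload ⊕ (at _ pC ⊗ at _ punit ⊕ (at _ pgo ⊕ (at _ pgo ⊕ con 1))))
    where
    κ : ℕ
    κ = suc K
    pC : Poly (λ n → cost c (Y n))
    pC = cost-poly c pY
    pN : Poly N
    pN = poly-+ poly-id pC
    pH : Poly H
    pH = poly (con 2 ⊕ at N pN ⊕ at _ poly-id)
    pgo : Poly (λ n → goN (H n))
    pgo = poly (con 1 ⊕ ((con 1 ⊕ at H pH) ⊗ con 2 ⊕ con 1))
    pret : Poly (λ n → retN κ (H n) (N n))
    pret = poly ((con 2 ⊕ at H pH ⊕ (at N pN ⊗ con κ ⊕ con κ)) ⊗ con 2 ⊕ con 1)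
    ptest : Poly (λ n → testN κ (N n))
    ptest = poly (con (3 + κ) ⊕ (at N pN ⊗ con (2 + κ) ⊕ con 1) ⊕ con (suc κ + suc κ))
    pop : Poly (λ n → opN κ (H n) (N n))
    pop = poly (at _ ptest ⊕ (con 1 ⊕ at _ pret))
    perase : Poly (λ n → eraseN κ (H n) (N n))
    perase = poly (con (3 + κ) ⊕ (at N pN ⊗ con (3 + κ) ⊕ con 1 ⊕ at _ pret))
    pemit : Poly (λ n → emitN (H n))
    pemit = poly (at _ pgo ⊕ (at _ pgo ⊕ (con 1 ⊕ (at _ pgo ⊕ (at _ pgo ⊕ con 1)))))
    punit : Poly (λ n → unit κ (H n) (N n))
    punit = poly (at _ pop ⊕ (at _ perase ⊕ (at _ pemit ⊕ (at _ ptest ⊕ at _ pret ⊕ con 3))))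
    pgrab : Poly (λ n → grabN κ (H n) (N n))
    pgrab = poly (con 1 ⊕ ((at _ pgo ⊕ con 1) ⊕ (at _ pop ⊕ (at _ pop ⊕ (at _ pgo ⊕ con 2)))))
    pload : Poly loadT
    pload = poly ((at _ poly-id ⊗ con 2 ⊕ con 1) ⊕ (con 1 ⊕ (con 1 ⊕ ((at _ poly-id ⊗ (con 2 ⊕ at _ pgrab) ⊕ con 1) ⊕ (at _ pgo ⊕ con 1)))))

  module _ (x : List Bool) where
    private
      n = length x
      open Sim K (H n) (E n) (N n) (reverse x) (E<H n) ≤-refl
      e = E n
      h = H n
      g₀ = initTape (suc e) x

      x-cell : ∀ k → g₀ (suc e + k) ≡ nth (map bitSym x) k
      x-cell k = nth-pad (suc e) (map bitSym x) k

      split : ∀ j → e < j → j ≡ suc e + (j ∸ suc e)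
      split j e<j = sym (m+[n∸m]≡n e<j)

      mid₀ : ∀ j → e < j → j < h → nonblank (g₀ j) ≡ true
      mid₀ j e<j j<h = trans (cong (nonblank ∘ g₀) (split j e<j)) (trans (cong nonblank (x-cell (j ∸ suc e)))
        (nonblank-nth x _ (+-cancelˡ-< (suc e) _ _ (subst (_< h) (split j e<j) j<h))))

      beyond : ∀ k → n ≤ k → nth (map bitSym x) k ≡ blank
      beyond k = go x k
        where
        go : ∀ x k → length x ≤ k → nth (map bitSym x) k ≡ blank
        go []      k       le       = refl
        go (_ ∷ x) (suc k) (s≤s le) = go x k le

      far : ∀ j → h ≤ j → g₀ j ≡ blank
      far j h≤j = trans (cong g₀ (split j (≤-trans (m≤m+n (suc e) n) h≤j))) (trans (x-cell _)
        (beyond _ (+-cancelˡ-≤ (suc e) _ _ (subst (h ≤_) (split j (≤-trans (m≤m+n (suc e) n) h≤j)) h≤j))))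

      module L = Load K h e (N n) (E<H n) ≤-refl i g₀ mid₀

      g₁ = upd g₀ h b0

      zeros : ∀ {K} (j : Fin K) → vreplicate K 0 ! j ≡ 0
      zeros zero    = refl
      zeros (suc j) = zeros j

      empty : ∀ j l → counters [] L.ρ[ 0 ] j l ≡ false
      empty zero    l = refl
      empty (suc j) l with j Fin.≟ i
      ... | yes refl rewrite lookup∘update i (vreplicate K 0) 0 = <ᵇ-false {l} z≤n
      ... | no ne rewrite lookup∘update′ ne (vreplicate K 0) 0 | zeros j = <ᵇ-false {l} z≤n

      lay₁ : LayT (counters [] L.ρ[ 0 ]) g₁
      lay₁ = record
        { home = upd-same g₀ h b0
        ; gap = trans (upd-other g₀ h b0 (<⇒≢ (n<1+n h) ∘ sym)) (far (suc h) (n≤1+n h))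
        ; cells = λ l j → trans (upd-other g₀ h b0 (<⇒≢ (slot>h l j) ∘ sym))
            (trans (far _ (<⇒≤ (slot>h l j))) (cong cell (sym (empty j l)))) }

      loaded = L.load-loop (reverse x) [] (≤-trans (≤-reflexive (length-reverse x)) (m≤m+n n _))
        (s≤s (≤-reflexive (trans (cong (_+ e) (length-reverse x)) (+-comm n e)))) lay₁
        (λ j j<h → upd-other g₀ h b0 (<⇒≢ j<h))
        (subst (λ y → Cells (initTape (suc e) y) e (reverse x)) (trans (++-identityʳ _) (reverse-involutive x)) (cells-init e (reverse x) []))

      g₂ = proj₁ loaded
      lay₂ = proj₁ (proj₂ (proj₂ loaded))
      int₂ = proj₂ (proj₂ (proj₂ loaded))

      lay₂' : LayT (counters (reverse x) (vreplicate K 0 [ i ]≔ n)) g₂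
      lay₂' = subst (λ k → LayT (counters (reverse x) L.ρ[ k ]) g₂) (length-reverse x) lay₂

      left₂ : Left h e [] g₂
      left₂ = record
        { from = e ; from-e = +-identityʳ e
        ; mid = λ j e<j j<h → trans (cong nonblank (int₂ j j<h)) (mid₀ j e<j j<h)
        ; bits = λ { zero z≤n → trans (cong g₂ (+-identityʳ e)) (trans (int₂ e (E<H n)) (nth-blank (suc e) (map bitSym x) e ≤-refl)) }
        ; void = λ j j<e → trans (int₂ j (<-trans j<e (E<H n))) (nth-blank (suc e) (map bitSym x) j (m<n⇒m<1+n j<e)) }

      e+n : n + suc e ≡ h
      e+n = +-comm n (suc e)

      walk-end : Run (loop nonblank (mv moveR)) (n * 2 + 1) g₀ (suc e) g₀ h
      walk-end = n * 2 + 1 , ≤-refl , exec-to e+n (walkR nonblank g₀ (suc e) n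
        (λ j e<j j< → mid₀ j e<j (subst (j <_) e+n j<))
        (cong nonblank (trans (cong g₀ e+n) (far h ≤-refl))))

      grab-all : Run (loop nonblank (ife isb1 (grabP i true) (grabP i false))) (n * (2 + grabN (suc K) h (N n)) + 1) g₁ (e + n) g₂ e
      grab-all = run-from (trans (cong (_+ e) (length-reverse x)) (+-comm n e))
        (relax (≤-reflexive (cong (λ k → k * (2 + grabN (suc K) h (N n)) + 1) (length-reverse x))) (proj₁ (proj₂ loaded)))

      back : Run (goR ⨾ mv moveL) (goN h + 1) g₂ e g₂ h
      back = home-right (E<H n) (Left.mid left₂) (LayT.home lay₂) (LayT.gap lay₂)

      load-run : Run (loadP i) (loadT n) g₀ (suc e) g₂ h
      load-run = _⊙_ {m = n * 2 + 1} walk-end (_⊙_ {m = 1} run-wr (_⊙_ {m = 1} (run-mv mL)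
        (_⊙_ {m = n * (2 + grabN (suc K) h (N n)) + 1} grab-all back)))

      ρ₀ : Vec ℕ K
      ρ₀ = vreplicate K 0 [ i ]≔ n

      bound : ∀ j → ρ₀ ! j ≤ n
      bound j with j Fin.≟ i
      ... | yes refl rewrite lookup∘update i (vreplicate K 0) n = ≤-refl
      ... | no ne rewrite lookup∘update′ ne (vreplicate K 0) n | zeros j = z≤n

    WholeRun : ℕ → Set
    WholeRun T = ∃ λ o → ∃ λ g → ∃ λ p → ∃ λ t → Exec wholeP (initTape o x) o t g p × t ≤ T × Reads g p (f x)

    finish : ∀ {g₃} → Run (comp c) (cost c (Y n) * unit (suc K) h (N n)) g₂ h g₃ h → (l : Left h e (f x) g₃) →
             ∀ a → Left.from l ≡ suc a → WholeRun (wholeT n)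
    finish {g₃} main l a eqf = let t , t≤ , ex = all in suc e , g₃ , suc a , t , ex , t≤ , subst (λ w → Reads g₃ w (f x)) eqf (Left.bits l)
      where
      a<e : a < e
      a<e = subst (suc a ≤_) (trans (cong (_+ length (f x)) (sym eqf)) (Left.from-e l)) (m≤m+n (suc a) (length (f x)))
      out₁ : Run goL (goN h) g₃ h g₃ e
      out₁ = go-left (n≤1+n h) (E<H n) (left-sep l) (Left.mid l)
      out₂ : Run goL (goN h) g₃ e g₃ a
      out₂ = go-left (≤-trans (<⇒≤ (E<H n)) (n≤1+n h)) a<e (Left.void l a (≤-reflexive (sym eqf)))
               (λ j a<j j<e → left-out l j (subst (_≤ j) (sym eqf) a<j) j<e)
      all : Run wholeP (wholeT n) g₀ (suc e) g₃ (suc a)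
      all = _⊙_ {m = loadT n} load-run (_⊙_ {m = cost c (Y n) * unit (suc K) h (N n)} main
        (_⊙_ {m = goN h} out₁ (_⊙_ {m = goN h} out₂ (run-mv mR))))

    simulated : ∀ {ρ m} → m ≤ cost c (Y n) → Big (reverse x) c (ρ₀ , []) m (ρ , f x) → Good c g₂ m n (ρ , f x)
    simulated m≤ big = sim big (bnd bound z≤n) (+-monoʳ-≤ n m≤) lay₂' left₂

    nonzero : ∀ k → k + length (f x) ≡ e → length (f x) < e → ∃ λ a → k ≡ suc a
    nonzero zero    eq lt = ⊥-elim (<-irrefl eq lt)
    nonzero (suc a) eq lt = a , refl

    whole-run : WholeRun (wholeT n)
    whole-run =
      let ρ , m , m≤ , big = prog x
          good r lay l bd = simulated m≤ big
          a , eqf = nonzero (Left.from l) (Left.from-e l) (≤-<-trans (Bd.len bd) (s≤s (+-monoʳ-≤ n m≤)))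
      in finish (relax (*-monoˡ-≤ (unit (suc K) h (N n)) m≤) r) l a eqf

  private
    computes : (∃ λ b → ∀ n → wholeT n ≤ polyBound b n) → PolyComputable f
    computes (b , le) = computable wholeP f b λ x → let o , g , p , t , ex , t≤ , rd = whole-run x in
      o , g , p , t , ex , ≤-trans t≤ (le (length x)) , rd

  whole-computable : PolyComputable f
  whole-computable = computes (poly-bound poly-whole)

-- Spanning trees

S : ∀ {n} → (Fin n → ℕ) → ℕ
S {zero}  f = 0
S {suc n} f = f zero + S (f ∘ suc)

S-cong : ∀ {n} {f g : Fin n → ℕ} → (∀ j → f j ≡ g j) → S f ≡ S g
S-cong {zero}  h = refl
S-cong {suc n} h = cong₂ _+_ (h zero) (S-cong (h ∘ suc))

S-zero : ∀ {n} {f : Fin n → ℕ} → (∀ j → f j ≡ 0) → S f ≡ 0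
S-zero {zero}  h = refl
S-zero {suc n} h = cong₂ _+_ (h zero) (S-zero (h ∘ suc))

S-mono : ∀ {n} {f g : Fin n → ℕ} → (∀ j → f j ≤ g j) → S f ≤ S g
S-mono {zero}  h = z≤n
S-mono {suc n} h = +-mono-≤ (h zero) (S-mono (h ∘ suc))

S-+ : ∀ {n} (f g : Fin n → ℕ) → S (λ j → f j + g j) ≡ S f + S g
S-+ {zero}  f g = refl
S-+ {suc n} f g = trans (cong (f zero + g zero +_) (S-+ (f ∘ suc) (g ∘ suc))) (lem (f zero) (g zero) _ _)
  where
  lem : ∀ a b c d → a + b + (c + d) ≡ (a + c) + (b + d)
  lem = solve-∀

sum-map-tabulate : ∀ {A B : Set} {n} (f : B → ℕ) (g : A → B) (t : Fin n → A) → sum (map f (map g (tabulate t))) ≡ S (f ∘ g ∘ t)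
sum-map-tabulate {n = zero}  f g t = refl
sum-map-tabulate {n = suc n} f g t = cong (f (g (t zero)) +_) (sum-map-tabulate f g (t ∘ suc))

private
  sum-map-++ : ∀ {A : Set} (f : A → ℕ) xs ys → sum (map f (xs ++ ys)) ≡ sum (map f xs) + sum (map f ys)
  sum-map-++ f xs ys = trans (cong sum (map-++ f xs ys)) (sum-++ (map f xs) (map f ys))

sum-allV : ∀ k (f : V k → ℕ) → sum (map f (allV k)) ≡
  S (λ j → f (zero , j)) + (S (λ j → f (suc zero , j)) + (S (λ j → f (suc (suc zero) , j)) + 0))
sum-allV k f = trans (sum-map-++ f (map (zero ,_) (allFin (suc k))) _) (cong₂ _+_ (sum-map-tabulate f (zero ,_) id)
  (trans (sum-map-++ f (map (suc zero ,_) (allFin (suc k))) _) (cong₂ _+_ (sum-map-tabulate f (suc zero ,_) id)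
    (trans (sum-map-++ f (map (suc (suc zero) ,_) (allFin (suc k))) _) (cong (_+ 0) (sum-map-tabulate f (suc (suc zero) ,_) id))))))

sum-allE : ∀ k (f : Edge k → ℕ) → sum (map f (allE k)) ≡
  (S (f ∘ hor zero) + (S (f ∘ hor (suc zero)) + (S (f ∘ hor (suc (suc zero))) + 0))) + (S (f ∘ ver zero) + (S (f ∘ ver (suc zero)) + 0))
sum-allE k f = trans (sum-map-++ f (concatMap (λ i → map (hor i) (allFin k)) (allFin 3)) _) (cong₂ _+_
  (trans (sum-map-++ f (map (hor zero) (allFin k)) _) (cong₂ _+_ (sum-map-tabulate f (hor zero) id)
    (trans (sum-map-++ f (map (hor (suc zero)) (allFin k)) _) (cong₂ _+_ (sum-map-tabulate f (hor (suc zero)) id)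
      (trans (sum-map-++ f (map (hor (suc (suc zero))) (allFin k)) _) (cong (_+ 0) (sum-map-tabulate f (hor (suc (suc zero))) id)))))))
  (trans (sum-map-++ f (map (ver zero) (allFin (suc k))) _) (cong₂ _+_ (sum-map-tabulate f (ver zero) id)
    (trans (sum-map-++ f (map (ver (suc zero)) (allFin (suc k))) _) (cong (_+ 0) (sum-map-tabulate f (ver (suc zero)) id))))))

_≟ᵛ_ : ∀ {k} (u v : V k) → Dec (u ≡ v)
_≟ᵛ_ = ≡-dec Fin._≟_ Fin._≟_

_≟ᵉ_ : ∀ {k} (e f : Edge k) → Dec (e ≡ f)
hor i j ≟ᵉ hor i' j' with i Fin.≟ i' | j Fin.≟ j'
... | yes refl | yes refl = yes refl
... | no ne    | _        = no λ { refl → ne refl }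
... | yes _    | no ne    = no λ { refl → ne refl }
ver i j ≟ᵉ ver i' j' with i Fin.≟ i' | j Fin.≟ j'
... | yes refl | yes refl = yes refl
... | no ne    | _        = no λ { refl → ne refl }
... | yes _    | no ne    = no λ { refl → ne refl }
hor _ _ ≟ᵉ ver _ _ = no λ ()
ver _ _ ≟ᵉ hor _ _ = no λ ()

joins-sym : ∀ {k} {e : Edge k} {u v} → Joins e u v → Joins e v u
joins-sym (inj₁ x) = inj₂ x
joins-sym (inj₂ x) = inj₁ x

reach-trans : ∀ {k} {P : Edge k → Set} {u v w} → Reach P u v → Reach P v w → Reach P u w
reach-trans r here            = r
reach-trans r (there e s p j) = there e (reach-trans r s) p j

reach-sym : ∀ {k} {P : Edge k → Set} {u v} → Reach P u v → Reach P v u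
reach-sym here            = here
reach-sym (there e s p j) = reach-trans (there e here p (joins-sym j)) (reach-sym s)

reach-map : ∀ {k} {P P' : Edge k → Set} {u v} → (∀ {e} → P e → P' e) → Reach P u v → Reach P' u v
reach-map f here            = here
reach-map f (there e s p j) = there e (reach-map f s) (f p) j

joins-at : ∀ {k} {e : Edge k} {u v y z} → Joins e u v → Joins e y z → y ≡ u ⊎ y ≡ v
joins-at (inj₁ a) (inj₁ b) = inj₁ (cong proj₁ (trans (sym b) a))
joins-at (inj₁ a) (inj₂ b) = inj₂ (cong proj₂ (trans (sym b) a))
joins-at (inj₂ a) (inj₁ b) = inj₂ (cong proj₁ (trans (sym b) a))
joins-at (inj₂ a) (inj₂ b) = inj₁ (cong proj₂ (trans (sym b) a))

-- A connected edge set is a tree once every edge e in it separates the vertices into two classes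
-- (D e) that no other edge joins; D e is then also the set of vertices behind e.
module Cuts {k} (F : Edge k → Bool) (D : Edge k → V k → Bool) (r : V k)
  (conn  : ∀ v → Reach (InF F) r v)
  (inv   : ∀ e e' → F e' ≡ true → e' ≢ e → D e (proj₁ (ends e')) ≡ D e (proj₂ (ends e')))
  (sep   : ∀ e → F e ≡ true → D e (proj₁ (ends e)) ≡ not (D e (proj₂ (ends e))))
  (rootD : ∀ e → D e r ≡ false) where

  inv-joins : ∀ e {e' u v} → F e' ≡ true → e' ≢ e → Joins e' u v → D e u ≡ D e v
  inv-joins e {e'} f ne (inj₁ refl) = inv e e' f ne
  inv-joins e {e'} f ne (inj₂ refl) = sym (inv e e' f ne)

  sep-joins : ∀ {e u v} → F e ≡ true → Joins e u v → D e u ≡ not (D e v)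
  sep-joins {e} f (inj₁ refl) = sep e f
  sep-joins {e} f (inj₂ refl) = trans (sym (not-involutive _)) (cong not (sym (sep e f)))

  behind : ∀ e {v} → Reach (Minus F e) r v → D e v ≡ false
  behind e here = rootD e
  behind e (there e' s (f , ne) j) = trans (sym (inv-joins e f ne j)) (behind e s)

  private
    front : ∀ e → F e ≡ true → ∃ λ u → ∃ λ v → Joins e u v × D e u ≡ false × D e v ≡ true
    front e f with D e (proj₁ (ends e)) in eq₁ | D e (proj₂ (ends e)) in eq₂ | sep e f
    ... | false | true  | _ = _ , _ , inj₁ refl , eq₁ , eq₂
    ... | true  | false | _ = _ , _ , inj₂ refl , eq₂ , eq₁

    -- The second claim is kept while the walk is behind `e`: its near end `u` has been reached
    -- without `e`. If the walk crosses back, that earlier approach replaces the excursion.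
    avoid : ∀ e {u v} → Joins e u v → D e u ≡ false → D e v ≡ true → ∀ {w} → Reach (InF F) r w →
            (D e w ≡ false → Reach (Minus F e) r w) × (D e w ≡ true → Reach (Minus F e) r u)
    avoid e j du dv here = (λ _ → here) , λ t → case trans (sym t) (rootD e) of λ ()
    avoid e {u} {v} j du dv {w} (there {w'} e' s f j') with e' ≟ᵉ e | avoid e j du dv s
    ... | no ne | ih₁ , ih₂ = (λ dw → there e' (ih₁ (trans same dw)) (f , ne) j') , λ dw → ih₂ (trans same dw)
      where
      same : D e w' ≡ D e w
      same = inv-joins e f ne j'
    ... | yes refl | ih₁ , ih₂ with joins-at j (joins-sym j') | joins-at j j'
    ...   | inj₁ refl | inj₁ refl = ih₁ , ih₂
    ...   | inj₁ refl | inj₂ refl = (λ _ → ih₂ dv) , λ dw → case trans (sym dw) du of λ ()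
    ...   | inj₂ refl | inj₁ refl = (λ dw → case trans (sym dw) dv of λ ()) , λ _ → ih₁ du
    ...   | inj₂ refl | inj₂ refl = (λ dw → case trans (sym dw) dv of λ ()) , ih₂

  clear : ∀ e {v} → D e v ≡ false → Reach (Minus F e) r v
  clear e {v} dv with F e in eqF
  ... | false = reach-map (λ {e'} f → f , λ { refl → case trans (sym f) eqF of λ () }) (conn v)
  ... | true  = let u , w , j , du , dw = front e eqF in proj₁ (avoid e j du dw (conn v)) dv

  isDown : IsDown r F D
  isDown e v = (λ t s → case trans (sym t) (behind e s) of λ ()) , back
    where
    back : ¬ Reach (Minus F e) r v → D e v ≡ true
    back ns with D e v in eq
    ... | true  = refl
    ... | false = ⊥-elim (ns (clear e eq))

  -- Let `e` be the first edge of the cycle. Every other edge of the cycle has an end different from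
  -- both ends of `e`, so it is not `e` and keeps `D e` constant. Going round the cycle would give
  -- both ends of `e` the same value, against `sep`.
  acyclic : ¬ HasCycle (InF F)
  acyclic (v₀ , x₁ ∷ x₂ ∷ xs , _ , ((v≢₁ ∷ v≢₂ ∷ v≢) ∷ (x≢₂ ∷ x≢) ∷ _) , ((e , f , j) , (e' , f' , j') , ch)) =
    contra (D e x₁) (sym (trans (inv-joins e f' (off {x₂} (joins-sym j') (v≢₂ ∘ sym) (x≢₂ ∘ sym)) j')
      (go x₂ xs (v≢₂ ∘ sym) (x≢₂ ∘ sym) v≢ x≢ ch))) (sep-joins f j)
    where
    off : ∀ {y e' z} → Joins e' y z → y ≢ v₀ → y ≢ x₁ → e' ≢ e
    off j' n₁ n₂ refl with joins-at j j'
    ... | inj₁ q = n₁ q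
    ... | inj₂ q = n₂ q
    go : ∀ y ys → y ≢ v₀ → y ≢ x₁ → All (v₀ ≢_) ys → All (x₁ ≢_) ys → AdjChain (InF F) y ys v₀ → D e y ≡ D e v₀
    go y [] n₁ n₂ _ _ (e' , f' , j') = inv-joins e f' (off j' n₁ n₂) j'
    go y (z ∷ ys) n₁ n₂ (a ∷ as) (b ∷ bs) ((e' , f' , j') , ch) =
      trans (inv-joins e f' (off j' n₁ n₂) j') (go z ys (a ∘ sym) (b ∘ sym) as bs ch)
    contra : ∀ b {c} → c ≡ b → c ≡ not b → ⊥
    contra true  refl ()
    contra false refl ()
  acyclic (_ , _ ∷ [] , s≤s () , _)

data Path {k} (P : Edge k → Set) (u : V k) : V k → List (V k) → Set where
  nil  : Path P u u (u ∷ [])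
  cons : ∀ {v w ws} → AdjIn P v w → Path P u w ws → v ∉ ws → Path P u v (v ∷ ws)

path-suffix : ∀ {k} {P : Edge k → Set} {u w ws v} → Path P u w ws → v ∈ ws → ∃ (Path P u v)
path-suffix nil            (Any.here refl) = _ , nil
path-suffix (cons a p n)   (Any.here refl) = _ , cons a p n
path-suffix (cons a p n)   (Any.there m)   = path-suffix p m

reach-path : ∀ {k} {P : Edge k → Set} {u v} → Reach P u v → ∃ (Path P u v)
reach-path here = _ , nil
reach-path {k} {v = v} (there e s p j) with reach-path s
... | ws , path with Any.any? (v ≟ᵛ_) ws
...   | yes m = path-suffix path m
...   | no n  = _ , cons (e , p , joins-sym j) path n

-- A simple path round `e`, closed by `e`, is a cycle. The hypothesis on parallel edges excludes the
-- path of length one, which would give a cycle of only two vertices.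
bridge : ∀ {k} {F : Edge k → Bool} {e u v} → ¬ HasCycle (InF F) → F e ≡ true → Joins e u v → u ≢ v →
         (∀ e' → Joins e' v u → e' ≡ e) → ¬ Reach (Minus F e) u v
bridge {F = F} {e} {u} {v} ac f j u≢v simple s with reach-path s
... | _ , nil = u≢v refl
... | _ , cons (e' , (_ , ne) , j') nil _ = ne (simple e' j')
... | ws , p@(cons a (cons b q n) m) = ac (v , _ , s≤s (len q) , uniq p , close p)
  where
  close : ∀ {w ws} → Path (Minus F e) u w (w ∷ ws) → AdjChain (InF F) w ws v
  close nil = e , f , j
  close (cons (e , (f , _) , j) p@nil _) = (e , f , j) , close p
  close (cons (e , (f , _) , j) p@(cons _ _ _) _) = (e , f , j) , close p
  uniq : ∀ {w ws} → Path (Minus F e) u w ws → Unique ws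
  uniq nil          = [] ∷ []
  uniq (cons _ p n) = ¬Any⇒All¬ _ n ∷ uniq p
  len : ∀ {w ws} → Path (Minus F e) u w ws → 1 ≤ length ws
  len nil          = s≤s z≤n
  len (cons _ _ _) = s≤s z≤n

-- Apart from `e₁` only `e₂` leaves the root, so a walk avoiding `e₁` leaves it for the last time
-- through `e₂`, and from then on uses neither edge.
last-exit : ∀ {k} {F : Edge k → Bool} {e₁ e₂ : Edge k} {r b v} →
  (∀ {e w} → Joins e r w → e ≢ e₁ → e ≡ e₂ × w ≡ b) → (∀ {w z} → Joins e₂ w z → w ≡ r ⊎ z ≡ r) →
  Reach (Minus F e₁) r v → v ≢ r → F e₂ ≡ true × Reach (λ e → F e ≡ true × e ≢ e₁ × e ≢ e₂) b v
last-exit only at-r here n = ⊥-elim (n refl)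
last-exit {r = r} only at-r (there {w} e s (f , ne) j) n with w ≟ᵛ r
... | yes refl with only j ne
...   | refl , refl = f , here
last-exit only at-r (there {w} e s (f , ne) j) n | no w≢r with last-exit only at-r s w≢r
...   | f₂ , t = f₂ , there e t (f , ne , λ { refl → [ w≢r , n ]′ (at-r j) }) j

-- The identity `(A + B)² + (B - A)² = 2 (A² + B²)` leaves no room for a difference `d` between `A`
-- and `B`; once they are equal, each hypothesis bounds them from one side.
balanced-≤ : ∀ {A B H} → A ≤ B → H + H ≤ A + B → A * A + B * B ≤ H * H + H * H → A ≡ H × B ≡ H
balanced-≤ {A} {H = H} A≤B le sq with m≤n⇒∃[o]m+o≡n A≤B
... | d , refl = fin d (m*n≡0⇒m≡0∨n≡0 d (n≤0⇒n≡0 d²≤0)) le sq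
  where
  lem₁ : ∀ A d → (A + (A + d)) * (A + (A + d)) + d * d ≡ 2 * (A * A + (A + d) * (A + d))
  lem₁ = solve-∀
  lem₂ : ∀ H → 2 * (H * H + H * H) ≡ (H + H) * (H + H) + 0
  lem₂ = solve-∀
  d²≤0 : d * d ≤ 0
  d²≤0 = +-cancelˡ-≤ ((A + (A + d)) * (A + (A + d))) (d * d) 0 (≤-trans (≤-reflexive (lem₁ A d)) (≤-trans (*-monoʳ-≤ 2 sq)
    (≤-trans (≤-reflexive (lem₂ H)) (+-monoˡ-≤ 0 (*-mono-≤ le le)))))
  same : ∀ {A} → H + H ≤ A + A → A * A + A * A ≤ H * H + H * H → A ≡ H
  same {A} le sq with <-cmp A H
  ... | tri< A<H _ _ = ⊥-elim (<⇒≱ (+-mono-< A<H A<H) le)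
  ... | tri≈ _ e _   = e
  ... | tri> _ _ H<A = ⊥-elim (<⇒≱ (+-mono-< (*-mono-< H<A H<A) (*-mono-< H<A H<A)) sq)
  fin : ∀ d → d ≡ 0 ⊎ d ≡ 0 → H + H ≤ A + (A + d) → A * A + (A + d) * (A + d) ≤ H * H + H * H → A ≡ H × A + d ≡ H
  fin zero z le sq rewrite +-identityʳ A = same le sq , same le sq
  fin (suc d) (inj₁ ())
  fin (suc d) (inj₂ ())

balanced : ∀ {A B H} → H + H ≤ A + B → A * A + B * B ≤ H * H + H * H → A ≡ H × B ≡ H
balanced {A₀} {B₀} {H} le₀ sq₀ with ≤-total A₀ B₀
... | inj₁ A≤B = balanced-≤ A≤B le₀ sq₀
... | inj₂ B≤A = let b , a = balanced-≤ B≤A (≤-trans le₀ (≤-reflexive (+-comm A₀ B₀))) (≤-trans (≤-reflexive (+-comm (B₀ * B₀) (A₀ * A₀))) sq₀) in a , b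

-- The grid

ind-0 : ∀ b → ind b 0 ≡ 0
ind-0 true  = refl
ind-0 false = refl

module Grid {k : ℕ} (p q : ℕ) (item : Fin (suc k) → ℕ) where

  r a b : V (suc k)
  r = zero , zero
  a = zero , suc zero
  b = suc zero , zero

  e₁ e₂ : Edge (suc k)
  e₁ = hor zero zero
  e₂ = ver zero zero

  dem : V (suc k) → ℕ
  dem (zero , zero)        = 0
  dem (zero , suc zero)    = p
  dem (zero , suc (suc _)) = 0
  dem (suc zero , zero)    = q
  dem (suc zero , suc j)   = item j
  dem (suc (suc zero) , _) = 0

  res : Edge (suc k) → ℕ
  res (hor zero zero)    = 1
  res (hor zero (suc _)) = 0
  res (hor (suc _) _)    = 0
  res (ver zero zero)    = 1
  res (ver zero (suc _)) = 0
  res (ver (suc _) _)    = 0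

  weight : (V (suc k) → Bool) → ℕ
  weight χ = sum (map (λ v → ind (χ v) (dem v)) (allV (suc k)))

  weight-eq : ∀ χ → weight χ ≡ ind (χ a) p + (ind (χ b) q + S (λ j → ind (χ (suc zero , suc j)) (item j)))
  weight-eq χ = trans (sum-allV (suc k) f) (trans
    (cong₂ _+_ (cong₂ _+_ (ind-0 (χ r)) (cong (f a +_) (S-zero (λ j → ind-0 (χ (zero , suc (suc j)))))))
      (cong (S (λ j → f (suc zero , j)) +_) (cong (_+ 0) (S-zero (λ j → ind-0 (χ (suc (suc zero) , j)))))))
    (lem (f a) (S (λ j → f (suc zero , j)))))
    where
    f : V (suc k) → ℕ
    f v = ind (χ v) (dem v)
    lem : ∀ x y → 0 + (x + 0) + (y + (0 + 0)) ≡ x + y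
    lem = solve-∀

  loss-eq : ∀ F D → loss res dem F D ≡ ind (F e₁) (weight (D e₁) * weight (D e₁)) + ind (F e₂) (weight (D e₂) * weight (D e₂))
  loss-eq F D = trans (sum-allE (suc k) f) (trans
    (cong₂ _+_
      (cong₂ _+_ (cong₂ _+_ (unit-edge e₁ refl) (S-zero (λ j → ind-0 (F (hor zero (suc j))))))
        (cong₂ _+_ (S-zero (λ j → ind-0 (F (hor (suc zero) j)))) (cong (_+ 0) (S-zero (λ j → ind-0 (F (hor (suc (suc zero)) j)))))))
      (cong₂ _+_ (cong₂ _+_ (unit-edge e₂ refl) (S-zero (λ j → ind-0 (F (ver zero (suc j))))))
        (cong (_+ 0) (S-zero (λ j → ind-0 (F (ver (suc zero) j)))))))
    (lem (ind (F e₁) _) (ind (F e₂) _)))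
    where
    f : Edge (suc k) → ℕ
    f e = ind (F e) (res e * weight (D e) ^ 2)
    sq : ∀ x → 1 * (x * (x * 1)) ≡ x * x
    sq = solve-∀
    unit-edge : ∀ e → res e ≡ 1 → f e ≡ ind (F e) (weight (D e) * weight (D e))
    unit-edge e eq = cong (ind (F e)) (trans (cong (_* weight (D e) ^ 2) eq) (sq (weight (D e))))
    lem : ∀ x y → x + 0 + (0 + (0 + 0)) + (y + 0 + (0 + 0)) ≡ x + y
    lem = solve-∀

  module Comb (sel : Fin (suc k) → Bool) where

    F : Edge (suc k) → Bool
    F (hor zero _)             = true
    F (hor (suc zero) _)       = false
    F (hor (suc (suc zero)) _) = true
    F (ver zero zero)          = true
    F (ver zero (suc j))       = sel j
    F (ver (suc zero) zero)    = true
    F (ver (suc zero) (suc j)) = not (sel j)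

    inA inB : V (suc k) → Bool
    inA (zero , _)           = true
    inA (suc zero , zero)    = false
    inA (suc zero , suc j)   = sel j
    inA (suc (suc zero) , _) = false
    inB (zero , _)           = false
    inB (suc zero , zero)    = false
    inB (suc zero , suc j)   = not (sel j)
    inB (suc (suc zero) , _) = true

    isMid : Fin (suc k) → V (suc k) → Bool
    isMid j (suc zero , suc j')  = does (j' Fin.≟ j)
    isMid j (suc zero , zero)    = false
    isMid j (zero , _)           = false
    isMid j (suc (suc zero) , _) = false

    -- In a row, the vertices behind an edge are those of the same half, `inA` or `inB`, to its
    -- right; behind a tooth there is one vertex of the middle row. Edges outside the comb get the
    -- empty set, since removing them separates nothing.
    D : Edge (suc k) → V (suc k) → Bool
    D (hor zero j) v             = inA v ∧ (toℕ j <ᵇ toℕ (proj₂ v))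
    D (hor (suc zero) j) v       = false
    D (hor (suc (suc zero)) j) v = inB v ∧ (toℕ j <ᵇ toℕ (proj₂ v))
    D (ver zero zero) v          = not (inA v)
    D (ver (suc zero) zero) v    = inB v
    D (ver zero (suc j)) v       = sel j ∧ isMid j v
    D (ver (suc zero) (suc j)) v = not (sel j) ∧ isMid j v

    private
      cut : ∀ (j j' : Fin (suc k)) → toℕ j ≢ toℕ j' → (toℕ j <ᵇ toℕ (inject₁ j')) ≡ (toℕ j <ᵇ suc (toℕ j'))
      cut j j' ne rewrite toℕ-inject₁ j' = sym (<ᵇ-suc (toℕ j) (toℕ j') ne)

      apart : ∀ (j j' : Fin (suc k)) → j' ≢ j → false ≡ does (j' Fin.≟ j)
      apart j j' ne with j' Fin.≟ j
      ... | yes e = ⊥-elim (ne e)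
      ... | no _  = refl

      self : ∀ (j : Fin (suc k)) → does (j Fin.≟ j) ≡ true
      self j with j Fin.≟ j
      ... | yes _ = refl
      ... | no ne = ⊥-elim (ne refl)

      ∧-≡ : ∀ x {y z} → (x ≡ true → y ≡ z) → (x ∧ y) ≡ (x ∧ z)
      ∧-≡ true  h = h refl
      ∧-≡ false h = refl

      not-true : ∀ {x} → not x ≡ true → x ≡ false
      not-true {false} _ = refl

    inv : ∀ e e' → F e' ≡ true → e' ≢ e → D e (proj₁ (ends e')) ≡ D e (proj₂ (ends e'))
    inv (hor zero j) (hor zero j') f ne = cut j j' λ eq → ne (cong (hor zero) (toℕ-injective (sym eq)))
    inv (hor (suc zero) j) (hor zero j') f ne = refl
    inv (hor (suc (suc zero)) j) (hor zero j') f ne = refl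
    inv (ver zero zero) (hor zero j') f ne = refl
    inv (ver zero (suc j)) (hor zero j') f ne = refl
    inv (ver (suc zero) zero) (hor zero j') f ne = refl
    inv (ver (suc zero) (suc j)) (hor zero j') f ne = refl
    inv (hor zero j) (hor (suc (suc zero)) j') f ne = refl
    inv (hor (suc zero) j) (hor (suc (suc zero)) j') f ne = refl
    inv (hor (suc (suc zero)) j) (hor (suc (suc zero)) j') f ne =
      cut j j' λ eq → ne (cong (hor (suc (suc zero))) (toℕ-injective (sym eq)))
    inv (ver zero zero) (hor (suc (suc zero)) j') f ne = refl
    inv (ver zero (suc j)) (hor (suc (suc zero)) j') f ne = refl
    inv (ver (suc zero) zero) (hor (suc (suc zero)) j') f ne = refl
    inv (ver (suc zero) (suc j)) (hor (suc (suc zero)) j') f ne = refl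
    inv (hor zero j) (ver zero zero) f ne = refl
    inv (hor (suc zero) j) (ver zero zero) f ne = refl
    inv (hor (suc (suc zero)) j) (ver zero zero) f ne = refl
    inv (ver zero zero) (ver zero zero) f ne = ⊥-elim (ne refl)
    inv (ver zero (suc j)) (ver zero zero) f ne = refl
    inv (ver (suc zero) zero) (ver zero zero) f ne = refl
    inv (ver (suc zero) (suc j)) (ver zero zero) f ne = refl
    inv (hor zero j) (ver (suc zero) zero) f ne = refl
    inv (hor (suc zero) j) (ver (suc zero) zero) f ne = refl
    inv (hor (suc (suc zero)) j) (ver (suc zero) zero) f ne = refl
    inv (ver zero zero) (ver (suc zero) zero) f ne = refl
    inv (ver zero (suc j)) (ver (suc zero) zero) f ne = refl
    inv (ver (suc zero) zero) (ver (suc zero) zero) f ne = ⊥-elim (ne refl)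
    inv (ver (suc zero) (suc j)) (ver (suc zero) zero) f ne = refl
    inv (hor zero j) (ver zero (suc j')) f ne rewrite f = refl
    inv (hor (suc zero) j) (ver zero (suc j')) f ne = refl
    inv (hor (suc (suc zero)) j) (ver zero (suc j')) f ne rewrite f = refl
    inv (ver zero zero) (ver zero (suc j')) f ne rewrite f = refl
    inv (ver zero (suc j)) (ver zero (suc j')) f ne =
      ∧-≡ (sel j) λ _ → apart j j' λ eq → ne (cong (ver zero ∘ suc) eq)
    inv (ver (suc zero) zero) (ver zero (suc j')) f ne rewrite f = refl
    inv (ver (suc zero) (suc j)) (ver zero (suc j')) f ne =
      ∧-≡ (not (sel j)) λ n → apart j j' λ { refl → case trans (sym f) (not-true n) of λ () }
    inv (hor zero j) (ver (suc zero) (suc j')) f ne rewrite not-true {sel j'} f = refl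
    inv (hor (suc zero) j) (ver (suc zero) (suc j')) f ne = refl
    inv (hor (suc (suc zero)) j) (ver (suc zero) (suc j')) f ne rewrite not-true {sel j'} f = refl
    inv (ver zero zero) (ver (suc zero) (suc j')) f ne rewrite not-true {sel j'} f = refl
    inv (ver zero (suc j)) (ver (suc zero) (suc j')) f ne =
      ∧-≡ (sel j) λ n → sym (apart j j' λ { refl → case trans (sym n) (not-true f) of λ () })
    inv (ver (suc zero) zero) (ver (suc zero) (suc j')) f ne rewrite not-true {sel j'} f = refl
    inv (ver (suc zero) (suc j)) (ver (suc zero) (suc j')) f ne =
      ∧-≡ (not (sel j)) λ _ → sym (apart j j' λ eq → ne (cong (ver (suc zero) ∘ suc) eq))

    sep : ∀ e → F e ≡ true → D e (proj₁ (ends e)) ≡ not (D e (proj₂ (ends e)))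
    sep (hor zero j) f rewrite toℕ-inject₁ j | <ᵇ-false {toℕ j} ≤-refl | <ᵇ-true (n<1+n (toℕ j)) = refl
    sep (hor (suc (suc zero)) j) f rewrite toℕ-inject₁ j | <ᵇ-false {toℕ j} ≤-refl | <ᵇ-true (n<1+n (toℕ j)) = refl
    sep (ver zero zero) f = refl
    sep (ver zero (suc j)) f rewrite f | self j = refl
    sep (ver (suc zero) zero) f = refl
    sep (ver (suc zero) (suc j)) f rewrite f | self j = refl

    rootD : ∀ e → D e r ≡ false
    rootD (hor zero j)             = refl
    rootD (hor (suc zero) j)       = refl
    rootD (hor (suc (suc zero)) j) = refl
    rootD (ver zero zero)          = refl
    rootD (ver (suc zero) zero)    = refl
    rootD (ver zero (suc j)) with sel j
    ... | true  = refl
    ... | false = refl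
    rootD (ver (suc zero) (suc j)) with sel j
    ... | true  = refl
    ... | false = refl

    private
      top : ∀ j → Reach (InF F) r (zero , j)
      top = <-weakInduction (λ j → Reach (InF F) r (zero , j)) here (λ j s → there (hor zero j) s refl (inj₁ refl))

      mid : Reach (InF F) r b
      mid = there (ver zero zero) here refl (inj₁ refl)

      bottom : ∀ j → Reach (InF F) r (suc (suc zero) , j)
      bottom = <-weakInduction (λ j → Reach (InF F) r (suc (suc zero) , j))
        (there (ver (suc zero) zero) mid refl (inj₁ refl)) (λ j s → there (hor (suc (suc zero)) j) s refl (inj₁ refl))

    conn : ∀ v → Reach (InF F) r v
    conn (zero , j)           = top j
    conn (suc zero , zero)    = mid
    conn (suc (suc zero) , j) = bottom j
    conn (suc zero , suc j) with sel j in eq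
    ... | true  = there (ver zero (suc j)) (top (suc j)) eq (inj₁ refl)
    ... | false = there (ver (suc zero) (suc j)) (bottom (suc j)) (cong not eq) (inj₂ refl)

    open Cuts F D r conn inv sep rootD public

    tree : SpanningTree F
    tree = (λ u v → reach-trans (reach-sym (conn u)) (conn v)) , acyclic

  forward : ∀ {H} sel → p + S (λ j → ind (sel j) (item j)) ≡ H → q + S (λ j → ind (not (sel j)) (item j)) ≡ H →
    ∃ λ F → SpanningTree F × ∃ λ D → IsDown r F D × loss res dem F D ≤ H * H + H * H
  forward {H} sel eA eB = F , tree , D , isDown , ≤-reflexive (trans (loss-eq F D) (cong₂ _+_ (cong₂ _*_ wA wA) (cong₂ _*_ wB wB)))
    where
    open Comb sel
    ∧-true : ∀ x → (x ∧ true) ≡ x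
    ∧-true true  = refl
    ∧-true false = refl
    wA : weight (D e₁) ≡ H
    wA = trans (weight-eq (D e₁)) (trans (cong (p +_) (S-cong (λ j → cong (λ w → ind w (item j)) (∧-true (sel j))))) eA)
    wB : weight (D e₂) ≡ H
    wB = trans (weight-eq (D e₂)) eB

  private
    incident : ∀ e {w} → Joins e r w → (e ≡ e₁ × w ≡ a) ⊎ (e ≡ e₂ × w ≡ b)
    incident (hor zero zero)    (inj₁ refl) = inj₁ (refl , refl)
    incident (hor zero (suc j)) (inj₁ ())
    incident (hor (suc i) j)    (inj₁ ())
    incident (hor i j)          (inj₂ ())
    incident (ver zero zero)    (inj₁ refl) = inj₂ (refl , refl)
    incident (ver zero (suc j)) (inj₁ ())
    incident (ver (suc i) j)    (inj₁ ())
    incident (ver i j)          (inj₂ ())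

  module Conv {H : ℕ} (total : p + (q + S item) ≡ H + H) (H>0 : 0 < H) (F : Edge (suc k) → Bool) (tree : SpanningTree F)
              (D : Edge (suc k) → V (suc k) → Bool) (down : IsDown r F D) (lo : loss res dem F D ≤ H * H + H * H) where

    private
      no-detour₁ : F e₁ ≡ true → ¬ Reach (Minus F e₁) r a
      no-detour₁ f = bridge (proj₂ tree) f (inj₁ refl) (λ ()) λ e' j → [ proj₁ , (λ ()) ∘ proj₂ ]′ (incident e' (joins-sym j))

      -- After their last exits from the root, the two walks lead from `b` and from `a` to `v`
      -- without either edge. Joined at `v` and preceded by `e₂`, they bypass `e₁`, which a tree
      -- forbids. So every vertex but the root is behind `e₁` or `e₂`.
      cover : ∀ {v} → v ≢ r → Reach (Minus F e₁) r v → Reach (Minus F e₂) r v → ⊥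
      cover n s₁ s₂ with last-exit {e₂ = e₂} (λ j ne → [ (λ x → ⊥-elim (ne (proj₁ x))) , id ]′ (incident _ j))
                           (λ { (inj₁ refl) → inj₁ refl ; (inj₂ refl) → inj₂ refl }) s₁ n
                       | last-exit {e₂ = e₁} (λ j ne → [ id , (λ x → ⊥-elim (ne (proj₁ x))) ]′ (incident _ j))
                           (λ { (inj₁ refl) → inj₁ refl ; (inj₂ refl) → inj₂ refl }) s₂ n
      ... | f₂ , t₁ | f₁ , t₂ = no-detour₁ f₁ (reach-trans (there e₂ here (f₂ , λ ()) (inj₁ refl))
        (reach-trans (reach-map (λ x → proj₁ x , proj₁ (proj₂ x)) t₁)
          (reach-sym (reach-map (λ x → proj₁ x , proj₂ (proj₂ x)) t₂))))

      -- `IsDown` speaks only of non-reachability, so a walk is available only under a double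
      -- negation; this suffices because `cover` concludes with a contradiction.
      in-D : ∀ {e v} → D e v ≡ false → ¬ ¬ Reach (Minus F e) r v
      in-D {e} {v} d n = case trans (sym d) (proj₂ (down e v) n) of λ ()

      share : ∀ {v} n → v ≢ r → n ≤ ind (D e₁ v) n + ind (D e₂ v) n
      share {v} n v≢r with D e₁ v in eq₁ | D e₂ v in eq₂
      ... | true  | _     = m≤m+n n _
      ... | false | true  = ≤-refl
      ... | false | false = ⊥-elim (in-D eq₁ λ s₁ → in-D eq₂ λ s₂ → cover v≢r s₁ s₂)

      A B : ℕ
      A = weight (D e₁)
      B = weight (D e₂)

      A+B : H + H ≤ A + B
      A+B = ≤-trans (≤-reflexive (sym total)) (≤-trans
        (+-mono-≤ (share {a} p λ ()) (+-mono-≤ (share {b} q λ ()) (S-mono (λ j → share {suc zero , suc j} (item j) λ ()))))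
        (≤-reflexive (trans (cong (λ s → x₁ + x₂ + (y₁ + y₂ + s)) (S-+ (z e₁) (z e₂))) (trans (lem x₁ x₂ y₁ y₂ (S (z e₁)) (S (z e₂)))
          (sym (cong₂ _+_ (weight-eq (D e₁)) (weight-eq (D e₂))))))))
        where
        x₁ = ind (D e₁ a) p
        x₂ = ind (D e₂ a) p
        y₁ = ind (D e₁ b) q
        y₂ = ind (D e₂ b) q
        z : Edge (suc k) → Fin (suc k) → ℕ
        z e j = ind (D e (suc zero , suc j)) (item j)
        lem : ∀ x x' y y' z z' → x + x' + (y + y' + (z + z')) ≡ x + (y + z) + (x' + (y' + z'))
        lem = solve-∀

      -- The tree reaches everything without an edge that it does not contain, so nothing is behind
      -- such an edge. The loss, which ranges over tree edges only, is therefore `A² + B²` in every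
      -- case.
      unused : ∀ e → F e ≡ false → weight (D e) ≡ 0
      unused e f = trans (weight-eq (D e)) (cong₂ _+_ (none a p) (cong₂ _+_ (none b q) (S-zero λ j → none (suc zero , suc j) (item j))))
        where
        none : ∀ v n → ind (D e v) n ≡ 0
        none v n with D e v in eq
        ... | false = refl
        ... | true  = ⊥-elim (proj₁ (down e v) eq (reach-map (λ f' → f' , λ { refl → case trans (sym f') f of λ () }) (proj₁ tree r v)))

      square : ∀ e → weight (D e) * weight (D e) ≡ ind (F e) (weight (D e) * weight (D e))
      square e with F e in eq
      ... | true  = refl
      ... | false = cong (λ w → w * w) (unused e eq)

      halves : A ≡ H × B ≡ H
      halves = balanced A+B (≤-trans (≤-reflexive (trans (cong₂ _+_ (square e₁) (square e₂)) (sym (loss-eq F D)))) lo)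

      used : ∀ e → weight (D e) ≡ H → F e ≡ true
      used e w with F e in eq
      ... | true  = refl
      ... | false = ⊥-elim (<-irrefl (trans (sym (unused e eq)) w) H>0)

      Da : D e₁ a ≡ true
      Da = proj₂ (down e₁ a) (no-detour₁ (used e₁ (proj₁ halves)))

      Db : D e₁ b ≡ false
      Db with D e₁ b in eq
      ... | false = refl
      ... | true  = ⊥-elim (proj₁ (down e₁ b) eq (there e₂ here (used e₂ (proj₂ halves) , λ ()) (inj₁ refl)))

    backward : ∃ λ sel → p + S (λ j → ind (sel j) (item j)) ≡ H
    backward = (λ j → D e₁ (suc zero , suc j)) , trans (sym (trans (weight-eq (D e₁))
      (cong₂ (λ x y → ind x p + (ind y q + S (λ j → ind (D e₁ (suc zero , suc j)) (item j)))) Da Db))) (proj₁ halves)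

-- Encoding of instances

dbl : List Bool → List Bool
dbl = concatMap (λ b → b ∷ b ∷ [])

-- Bijective binary digits, least significant first: true is the digit 2, false the digit 1.
E : List Bool → List Bool
E bs = dbl bs ++ (false ∷ true ∷ [])

bval : List Bool → ℕ
bval []           = 0
bval (true ∷ bs)  = 2 * suc (bval bs)
bval (false ∷ bs) = suc (2 * bval bs)

private
  digits : List Bool → ℕᵇ
  digits []           = zeroᵇ
  digits (true ∷ bs)  = 2[1+ digits bs ]
  digits (false ∷ bs) = 1+[2 digits bs ]

  digits-bval : ∀ bs → ofℕᵇ (digits bs) ≡ bval bs
  digits-bval []           = refl
  digits-bval (true ∷ bs)  = cong (λ v → 2 * suc v) (digits-bval bs)
  digits-bval (false ∷ bs) = cong (λ v → suc (2 * v)) (digits-bval bs)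

  bits-digits : ∀ bs → bitsᵇ (digits bs) ≡ bs
  bits-digits []           = refl
  bits-digits (true ∷ bs)  = cong (true ∷_) (bits-digits bs)
  bits-digits (false ∷ bs) = cong (false ∷_) (bits-digits bs)

encℕ-bval : ∀ bs → encℕ (bval bs) ≡ E bs
encℕ-bval bs = cong E (trans (cong bitsᵇ (trans (cong toℕᵇ (sym (digits-bval bs))) (fromℕ-toℕᵇ (digits bs)))) (bits-digits bs))

private
  bitsᵇ-injective : ∀ a b → bitsᵇ a ≡ bitsᵇ b → a ≡ b
  bitsᵇ-injective zeroᵇ zeroᵇ e = refl
  bitsᵇ-injective 2[1+ a ] 2[1+ b ] e = cong 2[1+_] (bitsᵇ-injective a b (proj₂ (∷-injective e)))
  bitsᵇ-injective 1+[2 a ] 1+[2 b ] e = cong 1+[2_] (bitsᵇ-injective a b (proj₂ (∷-injective e)))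
  bitsᵇ-injective 2[1+ a ] 1+[2 b ] ()
  bitsᵇ-injective 1+[2 a ] 2[1+ b ] ()

  -- Read in pairs, `false true` is never a doubled bit, so the doubled parts of the two words must
  -- end together.
  dbl-prefix : ∀ xs ys {r s} → dbl xs ++ (false ∷ true ∷ r) ≡ dbl ys ++ (false ∷ true ∷ s) → xs ≡ ys × r ≡ s
  dbl-prefix [] [] refl = refl , refl
  dbl-prefix [] (true ∷ ys) ()
  dbl-prefix [] (false ∷ ys) ()
  dbl-prefix (true ∷ xs) [] ()
  dbl-prefix (false ∷ xs) [] ()
  dbl-prefix (x ∷ xs) (y ∷ ys) e with ∷-injective e
  ... | refl , e' with dbl-prefix xs ys (proj₂ (∷-injective e'))
  ...   | refl , e'' = refl , e''

encℕ-prefix : ∀ a b {r s} → encℕ a ++ r ≡ encℕ b ++ s → a ≡ b × r ≡ s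
encℕ-prefix a b e with dbl-prefix (bitsᵇ (toℕᵇ a)) (bitsᵇ (toℕᵇ b))
  (trans (sym (++-assoc (dbl (bitsᵇ (toℕᵇ a))) _ _)) (trans e (++-assoc (dbl (bitsᵇ (toℕᵇ b))) _ _)))
... | e₁ , e₂ = trans (sym (toℕ-fromℕᵇ a)) (trans (cong ofℕᵇ (bitsᵇ-injective _ _ e₁)) (toℕ-fromℕᵇ b)) , e₂

encs-prefix : ∀ {A : Set} (l : List A) (f g : A → ℕ) {r s} →
  concatMap (encℕ ∘ f) l ++ r ≡ concatMap (encℕ ∘ g) l ++ s → (∀ {v} → v ∈ l → f v ≡ g v) × r ≡ s
encs-prefix [] f g e = (λ ()) , e
encs-prefix (v ∷ l) f g e
  with encℕ-prefix (f v) (g v) (trans (sym (++-assoc (encℕ (f v)) _ _)) (trans e (++-assoc (encℕ (g v)) _ _)))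
... | e₁ , e₂ with encs-prefix l f g e₂
...   | h , e₃ = (λ { (Any.here refl) → e₁ ; (Any.there m) → h m }) , e₃

∈-allV : ∀ {k} (v : V k) → v ∈ allV k
∈-allV {k} (i , j) = ∈-concatMap⁺ (λ i → map (i ,_) (allFin (suc k))) {xs = allFin 3} (lose (∈-allFin i) (∈-map⁺ (i ,_) (∈-allFin j)))

∈-allE : ∀ {k} (e : Edge k) → e ∈ allE k
∈-allE {k} (hor i j) = ∈-++⁺ˡ (∈-concatMap⁺ (λ i → map (hor i) (allFin k)) {xs = allFin 3} (lose (∈-allFin i) (∈-map⁺ (hor i) (∈-allFin j))))
∈-allE {k} (ver i j) = ∈-++⁺ʳ _ (∈-concatMap⁺ (λ i → map (ver i) (allFin (suc k))) {xs = allFin 2} (lose (∈-allFin i) (∈-map⁺ (ver i) (∈-allFin j))))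

loss-cong : ∀ {k} {s s' : Edge k → ℕ} {d d' : V k → ℕ} F D → (∀ e → s e ≡ s' e) → (∀ v → d v ≡ d' v) → loss s d F D ≡ loss s' d' F D
loss-cong {k} F D hs hd = cong sum (map-cong (λ e → cong (ind (F e)) (cong₂ (λ x y → x * y ^ 2) (hs e)
  (cong sum (map-cong (λ v → cong (ind (D e v)) (hd v)) (allV k))))) (allE k))

-- Demands and resistances are functions and come out equal only pointwise, so the two instances are
-- not identified; instead the solution is transported.
encode-yes : ∀ I J → encode I ≡ encode J → YesInstance I → YesInstance J
encode-yes I J eq yes-I with encℕ-prefix (Instance.k I) (Instance.k J) eq
... | refl , eq₁ with encℕ-prefix (toℕ (proj₁ (Instance.root I))) _ eq₁
...   | r₁ , eq₂ with encℕ-prefix (toℕ (proj₂ (Instance.root I))) _ eq₂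
...     | r₂ , eq₃ with encs-prefix (allV (Instance.k I)) (Instance.demand I) (Instance.demand J) eq₃
...       | hd , eq₄ with encs-prefix (allE (Instance.k I)) (Instance.resist I) (Instance.resist J) eq₄
...         | hr , eq₅ with encℕ-prefix (Instance.bound I) (Instance.bound J) (cong (_++ []) eq₅)
...           | hb , _ = go yes-I
  where
  root≡ : Instance.root I ≡ Instance.root J
  root≡ = cong₂ _,_ (toℕ-injective r₁) (toℕ-injective r₂)
  go : YesInstance I → YesInstance J
  go (F , tree , D , down , le) = F , tree , D , subst (λ r → IsDown r F D) root≡ down ,
    subst₂ _≤_ (loss-cong F D (λ e → hr (∈-allE e)) (λ v → hd (∈-allV v))) hb le

cat : ∀ {n} → (Fin n → List Bool) → List Bool
cat {zero}  g = []
cat {suc n} g = g zero ++ cat (g ∘ suc)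

times : ℕ → List Bool → List Bool
times zero    c = []
times (suc n) c = c ++ times n c

cat-const : ∀ {n} {g : Fin n → List Bool} {c} → (∀ j → g j ≡ c) → cat g ≡ times n c
cat-const {zero}  h = refl
cat-const {suc n} h = cong₂ _++_ (h zero) (cat-const (h ∘ suc))

cat-lookup : ∀ {A : Set} (f : A → List Bool) xs → cat (λ j → f (lookup xs j)) ≡ concatMap f xs
cat-lookup f []       = refl
cat-lookup f (x ∷ xs) = cong (f x ++_) (cat-lookup f xs)

cat-cong : ∀ {n} {g g' : Fin n → List Bool} → (∀ j → g j ≡ g' j) → cat g ≡ cat g'
cat-cong {zero}  h = refl
cat-cong {suc n} h = cong₂ _++_ (h zero) (cat-cong (h ∘ suc))

concatMap-tabulate : ∀ {A B : Set} {n} (f : B → List Bool) (g : A → B) (t : Fin n → A) → concatMap f (map g (tabulate t)) ≡ cat (f ∘ g ∘ t)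
concatMap-tabulate {n = zero}  f g t = refl
concatMap-tabulate {n = suc n} f g t = cong (f (g (t zero)) ++_) (concatMap-tabulate f g (t ∘ suc))

private
  rows : ∀ {A : Set} (f : A → List Bool) {n m} (g : Fin n → Fin m → A) (t : Fin m → Fin m) (is : List (Fin n)) →
         concatMap f (concatMap (λ i → map (g i) (tabulate t)) is) ≡ concatMap (λ i → cat (f ∘ g i ∘ t)) is
  rows f g t []       = refl
  rows f g t (i ∷ is) = trans (concatMap-++ f (map (g i) (tabulate t)) _) (cong₂ _++_ (concatMap-tabulate f (g i) t) (rows f g t is))

encode-grid : ∀ pb qb kb bb (its : List (List Bool)) {it k} → its ≡ it ∷ k → bval kb ≡ length its →
  let open Grid {length k} (bval pb) (bval qb) (λ j → bval (lookup (it ∷ k) j)) in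
  encode (record { k = suc (length k) ; root = r ; demand = dem ; resist = res ; bound = bval bb }) ≡
  E kb ++ E [] ++ E [] ++
  ((E [] ++ E pb ++ times (length k) (E [])) ++ (E qb ++ concatMap E its) ++ times (suc (suc (length k))) (E []) ++ []) ++
  (((E (false ∷ []) ++ times (length k) (E [])) ++ times (suc (length k)) (E []) ++ times (suc (length k)) (E []) ++ []) ++
   ((E (false ∷ []) ++ times (suc (length k)) (E [])) ++ times (suc (suc (length k))) (E []) ++ [])) ++
  E bb
encode-grid pb qb kb bb its {it} {k} refl eq = cong₂ _++_ (trans (cong encℕ (sym eq)) (encℕ-bval kb)) (cong (λ z → E [] ++ E [] ++ z)
  (cong₂ _++_
    (trans (rows (encℕ ∘ dem) _,_ id (allFin 3)) (cong₂ _++_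
      (cong (E [] ++_) (cong₂ _++_ (encℕ-bval pb) (free n (λ j → encℕ (dem (zero , suc (suc j)))) (λ j → refl))))
      (cong₂ _++_ (cong₂ _++_ (encℕ-bval qb) (trans (cat-cong (λ j → encℕ-bval (lookup (it ∷ k) j))) (cat-lookup E (it ∷ k))))
        (cong (_++ []) (free (suc (suc n)) (λ j → encℕ (dem (suc (suc zero) , j))) (λ j → refl))))))
    (cong₂ _++_
      (trans (concatMap-++ (encℕ ∘ res) (concatMap (λ i → map (hor i) (allFin _)) (allFin 3)) _) (cong₂ _++_
        (trans (rows (encℕ ∘ res) hor id (allFin 3)) (cong₂ _++_ (cong (E (false ∷ []) ++_) (free n (λ j → encℕ (res (hor zero (suc j)))) (λ j → refl)))
          (cong₂ _++_ (free (suc n) (λ j → encℕ (res (hor (suc zero) j))) (λ j → refl)) (cong (_++ []) (free (suc n) (λ j → encℕ (res (hor (suc (suc zero)) j))) (λ j → refl))))))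
        (trans (rows (encℕ ∘ res) ver id (allFin 2)) (cong₂ _++_ (cong (E (false ∷ []) ++_) (free (suc n) (λ j → encℕ (res (ver zero (suc j)))) (λ j → refl)))
          (cong (_++ []) (free (suc (suc n)) (λ j → encℕ (res (ver (suc zero) j))) (λ j → refl)))))))
      (encℕ-bval bb))))
  where
  open Grid {length k} (bval pb) (bval qb) (λ j → bval (lookup (it ∷ k) j))
  n = length k
  free : ∀ n (g : Fin n → List Bool) → (∀ j → g j ≡ E []) → cat g ≡ times n (E [])
  free n g h = cat-const h

-- Binary and bijective binary numerals

num : List Bool → ℕ
num []       = 0
num (b ∷ bs) = ind b 1 + 2 * num bs

-- The bijective digits of a number are the binary digits of its successor below the leading one.
-- This implicit leading one reappears in every demand.
bval-num : ∀ bs → suc (bval bs) ≡ 2 ^ length bs + num bs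
bval-num [] = refl
bval-num (true ∷ bs)  = trans (cong (λ v → suc (2 * v)) (bval-num bs)) (lem (2 ^ length bs) (num bs))
  where
  lem : ∀ a b → suc (2 * (a + b)) ≡ 2 * a + (1 + 2 * b)
  lem = solve-∀
bval-num (false ∷ bs) = trans (lem₁ (bval bs)) (trans (cong (2 *_) (bval-num bs)) (lem₂ (2 ^ length bs) (num bs)))
  where
  lem₁ : ∀ v → suc (suc (2 * v)) ≡ 2 * suc v
  lem₁ = solve-∀
  lem₂ : ∀ a b → 2 * (a + b) ≡ 2 * a + (0 + 2 * b)
  lem₂ = solve-∀

num-++ : ∀ xs ys → num (xs ++ ys) ≡ num xs + 2 ^ length xs * num ys
num-++ []       ys = sym (+-identityʳ _)
num-++ (x ∷ xs) ys = trans (cong (λ v → ind x 1 + 2 * v) (num-++ xs ys)) (lem (ind x 1) (num xs) (2 ^ length xs) (num ys))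
  where
  lem : ∀ a b c d → a + 2 * (b + c * d) ≡ a + 2 * b + 2 * c * d
  lem = solve-∀

num-zeros : ∀ n → num (replicate n false) ≡ 0
num-zeros zero    = refl
num-zeros (suc n) = cong (2 *_) (num-zeros n)

bits : ℕ → ℕ → List Bool
bits zero    n = []
bits (suc w) n = (n % 2 ≡ᵇ 1) ∷ bits w (n / 2)

length-bits : ∀ w n → length (bits w n) ≡ w
length-bits zero    n = refl
length-bits (suc w) n = cong suc (length-bits w (n / 2))

num-bits : ∀ w n → n < 2 ^ w → num (bits w n) ≡ n
num-bits zero    zero    lt = refl
num-bits zero    (suc n) (s≤s ())
num-bits (suc w) n lt = trans (cong₂ (λ a b → a + 2 * b) (low (n % 2) (m%n<n n 2))
    (num-bits w (n / 2) (m<n*o⇒m/o<n (subst (n <_) (*-comm 2 (2 ^ w)) lt))))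
  (trans (cong (n % 2 +_) (*-comm 2 (n / 2))) (sym (m≡m%n+[m/n]*n n 2)))
  where
  low : ∀ m → m < 2 → ind (m ≡ᵇ 1) 1 ≡ m
  low zero          _ = refl
  low (suc zero)    _ = refl
  low (suc (suc m)) (s≤s (s≤s ()))

-- Positional digits and tilings

val : ℕ → List ℕ → ℕ
val β []       = 0
val β (x ∷ xs) = x + β * val β xs

val-++ : ∀ β xs ys → val β (xs ++ ys) ≡ val β xs + β ^ length xs * val β ys
val-++ β []       ys = sym (+-identityʳ _)
val-++ β (x ∷ xs) ys = trans (cong (λ v → x + β * v) (val-++ β xs ys)) (lem x β (val β xs) (β ^ length xs) (val β ys))
  where
  lem : ∀ x β a b c → x + β * (a + b * c) ≡ x + β * a + β * b * c
  lem = solve-∀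

val-zeros : ∀ β n → val β (replicate n 0) ≡ 0
val-zeros β zero    = refl
val-zeros β (suc n) = trans (cong (β *_) (val-zeros β n)) (*-zeroʳ β)

at₀ : List ℕ → ℕ → ℕ
at₀ []       _       = 0
at₀ (x ∷ xs) zero    = x
at₀ (x ∷ xs) (suc j) = at₀ xs j

at-++ʳ : ∀ xs {ys} j → at₀ (xs ++ ys) (length xs + j) ≡ at₀ ys j
at-++ʳ []       j = refl
at-++ʳ (x ∷ xs) j = at-++ʳ xs j

at-≤ : ∀ {M xs} → All (_≤ M) xs → ∀ j → at₀ xs j ≤ M
at-≤ []       j       = z≤n
at-≤ (p ∷ ps) zero    = p
at-≤ (p ∷ ps) (suc j) = at-≤ ps j

at-replicate : ∀ n x {j} → j < n → at₀ (replicate n x) j ≡ x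
at-replicate (suc n) x {zero}  _        = refl
at-replicate (suc n) x {suc j} (s≤s lt) = at-replicate n x lt

at-ext : ∀ xs ys → length xs ≡ length ys → (∀ j → j < length xs → at₀ xs j ≡ at₀ ys j) → xs ≡ ys
at-ext []       []       _ _ = refl
at-ext (x ∷ xs) (y ∷ ys) e h = cong₂ _∷_ (h 0 (s≤s z≤n)) (at-ext xs ys (suc-injective e) (λ j lt → h (suc j) (s≤s lt)))

at-split : ∀ xs ys j → at₀ (xs ++ ys) j ≡ at₀ xs j + at₀ (replicate (length xs) 0 ++ ys) j
at-split []       ys j       = refl
at-split (x ∷ xs) ys zero    = sym (+-identityʳ x)
at-split (x ∷ xs) ys (suc j) = at-split xs ys j

at-complement : ∀ {C} xs → All (_≤ C) xs → ∀ j → at₀ (map (C ∸_) xs) j + at₀ xs j ≡ at₀ (replicate (length xs) C) j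
at-complement []       []       j       = refl
at-complement (x ∷ xs) (p ∷ ps) zero    = m∸n+n≡m p
at-complement (x ∷ xs) (p ∷ ps) (suc j) = at-complement xs ps j

replicate-++ : ∀ {A : Set} m n {x : A} → replicate m x ++ replicate n x ≡ replicate (m + n) x
replicate-++ zero    n = refl
replicate-++ (suc m) n = cong (_ ∷_) (replicate-++ m n)

map-const : ∀ {A B : Set} (y : B) (xs : List A) → map (λ _ → y) xs ≡ replicate (length xs) y
map-const y []       = refl
map-const y (x ∷ xs) = cong (y ∷_) (map-const y xs)

map-replicate : ∀ {A B : Set} (f : A → B) n x → map f (replicate n x) ≡ replicate n (f x)
map-replicate f zero    x = refl
map-replicate f (suc n) x = cong (f x ∷_) (map-replicate f n x)

horner : ℕ → (ℕ → ℕ) → ℕ → ℕ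
horner β f zero    = 0
horner β f (suc J) = f 0 + β * horner β (f ∘ suc) J

horner-cong : ∀ β {f g} J → (∀ j → j < J → f j ≡ g j) → horner β f J ≡ horner β g J
horner-cong β zero    h = refl
horner-cong β (suc J) h = cong₂ (λ a b → a + β * b) (h 0 (s≤s z≤n)) (horner-cong β J (λ j lt → h (suc j) (s≤s lt)))

horner-+ : ∀ β f g J → horner β (λ j → f j + g j) J ≡ horner β f J + horner β g J
horner-+ β f g zero    = refl
horner-+ β f g (suc J) = trans (cong (λ v → f 0 + g 0 + β * v) (horner-+ β (f ∘ suc) (g ∘ suc) J)) (lem (f 0) (g 0) β _ _)
  where
  lem : ∀ a b β c d → a + b + β * (c + d) ≡ a + β * c + (b + β * d)
  lem = solve-∀

horner-0 : ∀ β J → horner β (λ _ → 0) J ≡ 0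
horner-0 β zero    = refl
horner-0 β (suc J) = trans (cong (β *_) (horner-0 β J)) (*-zeroʳ β)

horner-at : ∀ β xs J → length xs ≤ J → horner β (at₀ xs) J ≡ val β xs
horner-at β []       J       le       = horner-0 β J
horner-at β (x ∷ xs) (suc J) (s≤s le) = cong (λ v → x + β * v) (horner-at β xs J le)

private
  leading-digit : ∀ {B a a' x x'} → a < B → x < x' → a + B * x ≢ a' + B * x'
  leading-digit {B} {a} {a'} {x} {x'} a<B x<x' e = <-irrefl e (<-≤-trans (+-monoˡ-< (B * x) a<B)
    (≤-trans (≤-reflexive (sym (*-suc B x))) (≤-trans (*-monoʳ-≤ B x<x') (m≤n+m (B * x') a'))))

digit-unique : ∀ {B a a' x x'} → a < B → a' < B → a + B * x ≡ a' + B * x' → a ≡ a' × x ≡ x'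
digit-unique {B} {a} {a'} {x} {x'} a<B a'<B e with <-cmp x x'
... | tri< x<x' _ _ = ⊥-elim (leading-digit a<B x<x' e)
... | tri≈ _ refl _ = +-cancelʳ-≡ (B * x) a a' e , refl
... | tri> _ _ x'<x = ⊥-elim (leading-digit a'<B x'<x (sym e))

-- Three interleaved base-B expansions form one expansion in base B³.
interleaved-unique : ∀ {B} J {f g h f' g' h' : ℕ → ℕ} →
  (∀ j → f j < B) → (∀ j → g j < B) → (∀ j → h j < B) → (∀ j → f' j < B) → (∀ j → g' j < B) → (∀ j → h' j < B) →
  let β = B * (B * B) in
  horner β f J + B * (horner β g J + B * horner β h J) ≡ horner β f' J + B * (horner β g' J + B * horner β h' J) →
  ∀ j → j < J → f j ≡ f' j × g j ≡ g' j × h j ≡ h' j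
interleaved-unique {B} (suc J) {f} {g} {h} {f'} {g'} {h'} bf bg bh bf' bg' bh' e j lt
  with digit-unique (bf 0) (bf' 0) (trans (sym (lem (f 0) (g 0) (h 0) B _ _ _)) (trans e (lem (f' 0) (g' 0) (h' 0) B _ _ _)))
  where
  lem : ∀ f g h B F G H → f + B * (B * B) * F + B * (g + B * (B * B) * G + B * (h + B * (B * B) * H))
                        ≡ f + B * (g + B * (h + B * (F + B * (G + B * H))))
  lem = solve-∀
... | e₁ , r₁ with digit-unique (bg 0) (bg' 0) r₁
...   | e₂ , r₂ with digit-unique (bh 0) (bh' 0) r₂
...     | e₃ , r₃ with j | lt
...       | zero   | _      = e₁ , e₂ , e₃
...       | suc j' | s≤s l  = interleaved-unique J (bf ∘ suc) (bg ∘ suc) (bh ∘ suc) (bf' ∘ suc) (bg' ∘ suc) (bh' ∘ suc) r₃ j' l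

-- Subset sums

data Sub {A : Set} (f : A → ℕ) : List A → ℕ → Set where
  done : Sub f [] 0
  take : ∀ {x xs n} → Sub f xs n → Sub f (x ∷ xs) (f x + n)
  drop : ∀ {x xs n} → Sub f xs n → Sub f (x ∷ xs) n

sub-++⁻ : ∀ {A : Set} {f : A → ℕ} xs {ys n} → Sub f (xs ++ ys) n → ∃ λ a → ∃ λ b → Sub f xs a × Sub f ys b × n ≡ a + b
sub-++⁻ [] s = 0 , _ , done , s , refl
sub-++⁻ {f = f} (x ∷ xs) (take s) = let a , b , u , v , e = sub-++⁻ xs s in
  f x + a , b , take u , v , trans (cong (f x +_) e) (sym (+-assoc (f x) a b))
sub-++⁻ (x ∷ xs) (drop s) = let a , b , u , v , e = sub-++⁻ xs s in a , b , drop u , v , e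

sub-++⁺ : ∀ {A : Set} {f : A → ℕ} {xs ys a b} → Sub f xs a → Sub f ys b → Sub f (xs ++ ys) (a + b)
sub-++⁺ done v = v
sub-++⁺ {f = f} (take {x} {n = n} u) v = subst (Sub f _) (sym (+-assoc (f x) n _)) (take (sub-++⁺ u v))
sub-++⁺ (drop u) v = drop (sub-++⁺ u v)

sub-none : ∀ {A : Set} {f : A → ℕ} xs → Sub f xs 0
sub-none []       = done
sub-none (x ∷ xs) = drop (sub-none xs)

sub-sel : ∀ {A : Set} (f : A → ℕ) xs (sel : Fin (length xs) → Bool) → Sub f xs (S (λ j → ind (sel j) (f (lookup xs j))))
sub-sel f []       sel = done
sub-sel f (x ∷ xs) sel with sel zero
... | true  = take (sub-sel f xs (sel ∘ suc))
... | false = drop (sub-sel f xs (sel ∘ suc))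

sel-sub : ∀ {A : Set} {f : A → ℕ} {xs n} → Sub f xs n → ∃ λ (sel : Fin (length xs) → Bool) →
  S (λ j → ind (sel j) (f (lookup xs j))) ≡ n × n + S (λ j → ind (not (sel j)) (f (lookup xs j))) ≡ sum (map f xs)
sel-sub done = (λ ()) , refl , refl
sel-sub {f = f} (take {x} {xs} {n} s) with sel-sub s
... | sel , e₁ , e₂ = (λ { zero → true ; (suc j) → sel j }) , cong (f x +_) e₁ , trans (+-assoc (f x) n _) (cong (f x +_) e₂)
sel-sub {f = f} (drop {x} {xs} {n} s) with sel-sub s
... | sel , e₁ , e₂ = (λ { zero → false ; (suc j) → sel j }) , e₁ , trans (lem n (f x) _) (cong (f x +_) e₂)
  where
  lem : ∀ a b c → a + (b + c) ≡ b + (a + c)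
  lem = solve-∀

sum-S : ∀ {A : Set} (f : A → ℕ) xs → S (λ j → f (lookup xs j)) ≡ sum (map f xs)
sum-S f []       = refl
sum-S f (x ∷ xs) = cong (f x +_) (sum-S f xs)

sumBy : ∀ {A : Set} → (A → ℕ) → List A → ℕ
sumBy f xs = sum (map f xs)

sumBy-≤ : ∀ {A : Set} {f : A → ℕ} {M} xs → All (λ x → f x ≤ M) xs → sumBy f xs ≤ length xs * M
sumBy-≤ []       []       = z≤n
sumBy-≤ (x ∷ xs) (p ∷ ps) = +-mono-≤ p (sumBy-≤ xs ps)

-- A tile has a colour on each side, coded by a number at most C; base B leaves room for all N tiles at a place.
module Tiling {Tile : Set} (bot lft top rgt : Tile → ℕ) (tiles : List Tile) (C B : ℕ)
  (bot≤ : ∀ τ → bot τ ≤ C) (lft≤ : ∀ τ → lft τ ≤ C) (top≤ : ∀ τ → top τ ≤ C) (rgt≤ : ∀ τ → rgt τ ≤ C)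
  (room : length tiles * C + length tiles * C < B) (C<B : C < B) (1<B : 1 < B) (N<B : length tiles < B) where

  β N : ℕ
  β = B * (B * B)
  N = length tiles

  cl cb : Tile → ℕ
  cl τ = C ∸ lft τ
  cb τ = C ∸ bot τ

  module Period (P : ℕ) where

    -- A tile at place s has weight β ^ s * K τ: the complements of its left and bottom colours are digits of block s,
    -- its right colour is a digit of block s + 1, its top colour and a unit (counting tiles) are digits of block s + P.
    -- With one tile at each place, adjacent colours match exactly when their two contributions add up to C.
    K : Tile → ℕ
    K τ = cl τ + B * cb τ + β * rgt τ + β ^ P * (B * top τ + B * B)

    ΣK : List Tile → ℕ
    ΣK ts = sumBy cl ts + β * sumBy rgt ts + B * (sumBy cb ts + β ^ P * sumBy top ts) + B * B * (β ^ P * length ts)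

    sumBy-K : ∀ ts → sumBy K ts ≡ ΣK ts
    sumBy-K [] = sym (lem β B (β ^ P))
      where
      lem : ∀ β B p → 0 + β * 0 + B * (0 + p * 0) + B * B * (p * 0) ≡ 0
      lem = solve-∀
    sumBy-K (τ ∷ ts) = trans (cong (K τ +_) (sumBy-K ts))
      (lem β B (β ^ P) (cl τ) (cb τ) (rgt τ) (top τ) (sumBy cl ts) (sumBy cb ts) (sumBy rgt ts) (sumBy top ts) (length ts))
      where
      lem : ∀ β B p l b r t ls bs rs ts n →
        l + B * b + β * r + p * (B * t + B * B) + (ls + β * rs + B * (bs + p * ts) + B * B * (p * n)) ≡
        l + ls + β * (r + rs) + B * (b + bs + p * (t + ts)) + B * B * (p * suc n)
      lem = solve-∀

    -- The sum over a choice of tiles at every place, regrouped by side instead of by place, so that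
    -- each of the interleaved expansions can be examined separately.
    T : List (List Tile) → ℕ
    T tss = val β (map (sumBy cl) tss) + β * val β (map (sumBy rgt) tss) +
            B * (val β (map (sumBy cb) tss) + β ^ P * val β (map (sumBy top) tss)) + B * B * (β ^ P * val β (map length tss))

    T-[] : T [] ≡ 0
    T-[] = lem β B (β ^ P)
      where
      lem : ∀ β B p → 0 + β * 0 + B * (0 + p * 0) + B * B * (p * 0) ≡ 0
      lem = solve-∀

    T-∷ : ∀ ts tss → T (ts ∷ tss) ≡ ΣK ts + β * T tss
    T-∷ ts tss = lem β B (β ^ P) (sumBy cl ts) (sumBy cb ts) (sumBy rgt ts) (sumBy top ts) (length ts) _ _ _ _ _
      where
      lem : ∀ β B p l b r t n ls bs rs ts ns →
        l + β * ls + β * (r + β * rs) + B * (b + β * bs + p * (t + β * ts)) + B * B * (p * (n + β * ns)) ≡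
        l + β * r + B * (b + p * t) + B * B * (p * n) + β * (ls + β * rs + B * (bs + p * ts) + B * B * (p * ns))
      lem = solve-∀

    module Items {A : Set} (weight : A → ℕ) (item : ℕ → Tile → A) (weigh : ∀ s τ → weight (item s τ) ≡ 2 * (β ^ s * K τ)) where

      items : ℕ → ℕ → List A
      items o zero    = []
      items o (suc m) = items (suc o) m ++ map (item o) tiles

      -- `items` splits off the lowest place, as the recursion of `T` does; this listing splits off
      -- the highest, as the output loop does. Both give the same list by `upTo-items`.
      upTo : ℕ → List A
      upTo zero    = []
      upTo (suc s) = map (item s) tiles ++ upTo s

      items-upTo : ∀ m o → items o m ++ upTo o ≡ upTo (m + o)
      items-upTo zero    o = refl
      items-upTo (suc m) o = trans (++-assoc (items (suc o) m) _ _) (trans (items-upTo m (suc o)) (cong upTo (+-suc m o)))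

      upTo-items : ∀ m → upTo m ≡ items 0 m
      upTo-items m = trans (cong upTo (sym (+-identityʳ m))) (trans (sym (items-upTo m 0)) (++-identityʳ _))

      Chosen : List Tile → Set
      Chosen ts = All (_∈ tiles) ts × length ts ≤ N

      private
        choose : ∀ s us {n} → Sub weight (map (item s) us) n →
                 ∃ λ ts → (∀ {τ} → τ ∈ ts → τ ∈ us) × length ts ≤ length us × n ≡ 2 * (β ^ s * sumBy K ts)
        choose s [] done = [] , id , z≤n , sym (cong (2 *_) (*-zeroʳ (β ^ s)))
        choose s (u ∷ us) (drop x) = let ts , sub , le , e = choose s us x in ts , Any.there ∘ sub , m≤n⇒m≤1+n le , e
        choose s (u ∷ us) (take x) = let ts , sub , le , e = choose s us x in
          u ∷ ts , (λ { (Any.here refl) → Any.here refl ; (Any.there m) → Any.there (sub m) }) , s≤s le ,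
          trans (cong₂ _+_ (weigh s u) e) (lem (β ^ s) (K u) (sumBy K ts))
          where
          lem : ∀ a b c → 2 * (a * b) + 2 * (a * c) ≡ 2 * (a * (b + c))
          lem = solve-∀

        shift-pow : ∀ o a b → 2 * (β * β ^ o * a) + 2 * (β ^ o * b) ≡ 2 * (β ^ o * (b + β * a))
        shift-pow o a b = lem β (β ^ o) a b
          where
          lem : ∀ β p a b → 2 * (β * p * a) + 2 * (p * b) ≡ 2 * (p * (b + β * a))
          lem = solve-∀

      collect : ∀ m o {n} → Sub weight (items o m) n →
                ∃ λ tss → length tss ≡ m × All Chosen tss × n ≡ 2 * (β ^ o * T tss)
      collect zero o done = [] , refl , [] , sym (trans (cong (λ v → 2 * (β ^ o * v)) T-[]) (cong (2 *_) (*-zeroʳ (β ^ o))))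
      collect (suc m) o s with sub-++⁻ (items (suc o) m) s
      ... | a , b , u , v , refl with collect m (suc o) u | choose o tiles v
      ...   | tss , len , ok , refl | ts , sub , le , refl = ts ∷ tss , cong suc len , (tabulateAll sub , le) ∷ ok ,
        trans (shift-pow o (T tss) (sumBy K ts)) (cong (λ v → 2 * (β ^ o * v)) (trans (cong (_+ β * T tss) (sumBy-K ts)) (sym (T-∷ ts tss))))

      pick : ∀ s {τ} us → τ ∈ us → Sub weight (map (item s) us) (2 * (β ^ s * K τ))
      pick s (u ∷ us) (Any.here refl) = subst (Sub weight _) (trans (+-identityʳ _) (weigh s u)) (take (sub-none _))
      pick s (u ∷ us) (Any.there m)   = drop (pick s us m)

      place : ∀ o τs → All (_∈ tiles) τs → Sub weight (items o (length τs)) (2 * (β ^ o * T (map [_] τs)))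
      place o [] [] = subst (Sub weight []) (sym (trans (cong (λ v → 2 * (β ^ o * v)) T-[]) (cong (2 *_) (*-zeroʳ (β ^ o))))) done
      place o (τ ∷ τs) (m ∷ ms) = subst (Sub weight _)
        (trans (shift-pow o (T (map [_] τs)) (K τ)) (cong (λ v → 2 * (β ^ o * v))
          (trans (cong (_+ β * T (map [_] τs)) (trans (sym (+-identityʳ (K τ))) (sumBy-K [ τ ]))) (sym (T-∷ [ τ ] (map [_] τs))))))
        (sub-++⁺ (place (suc o) τs ms) (pick o tiles m))

      ones : ℕ → ℕ
      ones n = val β (replicate n 1)

      sum-items : ∀ m o → sumBy weight (items o m) ≡ 2 * (β ^ o * (ΣK tiles * ones m))
      sum-items zero o = sym (lem (β ^ o) (ΣK tiles))
        where
        lem : ∀ a b → 2 * (a * (b * 0)) ≡ 0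
        lem = solve-∀
      sum-items (suc m) o = trans (trans (cong sum (map-++ weight (items (suc o) m) _)) (sum-++ (map weight (items (suc o) m)) _))
        (trans (cong₂ _+_ (sum-items m (suc o)) (block tiles)) (trans (cong (λ v → 2 * (β * β ^ o * (ΣK tiles * ones m)) + 2 * (β ^ o * v)) (sumBy-K tiles))
          (lem β (β ^ o) (ΣK tiles) (ones m))))
        where
        lem : ∀ β p k n → 2 * (β * p * (k * n)) + 2 * (p * k) ≡ 2 * (p * (k * (1 + β * n)))
        lem = solve-∀
        block : ∀ us → sumBy weight (map (item o) us) ≡ 2 * (β ^ o * sumBy K us)
        block []       = sym (cong (2 *_) (*-zeroʳ (β ^ o)))
        block (u ∷ us) = trans (cong₂ _+_ (weigh o u) (block us)) (lem' (β ^ o) (K u) (sumBy K us))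
          where
          lem' : ∀ a b c → 2 * (a * b) + 2 * (a * c) ≡ 2 * (a * (b + c))
          lem' = solve-∀

    -- The chain must end in colour 0, and it is used with starting colour 0 as well. A boundary
    -- colour 0 adds nothing to any digit, so the boundary needs no special blocks.
    HChain : ℕ → List Tile → Set
    HChain r []       = r ≡ 0
    HChain r (τ ∷ τs) = lft τ ≡ r × HChain (rgt τ) τs

    hchain-digits : ∀ τs r → HChain r τs → ∀ j → at₀ (map cl τs) j + at₀ (r ∷ map rgt τs) j ≡ at₀ (replicate (length τs) C) j
    hchain-digits []       r ch        zero    = ch
    hchain-digits []       r ch        (suc j) = refl
    hchain-digits (τ ∷ τs) r (refl , ch) zero    = m∸n+n≡m (lft≤ τ)
    hchain-digits (τ ∷ τs) r (refl , ch) (suc j) = hchain-digits τs (rgt τ) ch j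

    digits-hchain : ∀ τs r → (∀ j → j ≤ length τs → at₀ (map cl τs) j + at₀ (r ∷ map rgt τs) j ≡ at₀ (replicate (length τs) C) j) → HChain r τs
    digits-hchain []       r h = h 0 z≤n
    digits-hchain (τ ∷ τs) r h = +-cancelˡ-≡ (cl τ) _ _ (trans (m∸n+n≡m (lft≤ τ)) (sym (h 0 z≤n))) ,
      digits-hchain τs (rgt τ) (λ j le → h (suc j) (s≤s le))

    module Target (R : ℕ) (fin : ℕ) (fin≤ : fin ≤ C) (init : List ℕ) (len : length init ≡ P) (init≤ : All (_≤ C) init) (P>0 : 0 < P) where

      L J : ℕ
      L = P + R
      J = L + P

      -- Required digits below block P, from P to L - 1, and from L on. At the bottom only
      -- complements of bottom colours arrive, so the vertical digit is the complement of the given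
      -- colour; at the top only top colours arrive, so it is `fin` itself. The right colour of the
      -- last tile stands alone in block L and must be 0. Units sit P blocks above their tile, hence
      -- the zeros below P.
      hD vD cD : List ℕ
      hD = map (λ _ → C) init ++ replicate R C ++ replicate P 0
      vD = map (C ∸_) init ++ replicate R C ++ replicate P fin
      cD = map (λ _ → 0) init ++ replicate R 1 ++ replicate P 1

      target : ℕ
      target = val β hD + B * (val β vD + B * val β cD)

      private
        zs : List ℕ
        zs = replicate P 0

        hF vF cF : List (List Tile) → ℕ → ℕ
        hF tss j = at₀ (map (sumBy cl) tss) j + at₀ (0 ∷ map (sumBy rgt) tss) j
        vF tss j = at₀ (map (sumBy cb) tss) j + at₀ (zs ++ map (sumBy top) tss) j
        cF tss j = at₀ (zs ++ map length tss) j

        L≤J : L ≤ J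
        L≤J = m≤m+n L P

        shifted : ∀ xs → length xs ≡ L → horner β (at₀ (zs ++ xs)) J ≡ β ^ P * val β xs
        shifted xs e = trans (horner-at β (zs ++ xs) J (≤-reflexive (trans (length-++ zs) (trans (cong₂ _+_ (length-replicate P) e) (+-comm P L)))))
          (trans (val-++ β zs xs) (cong₂ (λ a b → a + β ^ b * val β xs) (val-zeros β P) (length-replicate P)))

        T-horner : ∀ tss → length tss ≡ L → T tss ≡ horner β (hF tss) J + B * (horner β (vF tss) J + B * horner β (cF tss) J)
        T-horner tss e = sym (trans (cong₂ (λ a b → a + B * b)
            (trans (horner-+ β _ _ J) (cong₂ _+_ (horner-at β (map (sumBy cl) tss) J (flat (sumBy cl)))
              (horner-at β (0 ∷ map (sumBy rgt) tss) J (≤-trans (s≤s (≤-reflexive (trans (length-map _ tss) e)))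
                (≤-trans (≤-reflexive (+-comm 1 L)) (+-monoʳ-≤ L P>0))))))
            (cong₂ (λ a b → a + B * b) (trans (horner-+ β _ _ J) (cong₂ _+_ (horner-at β (map (sumBy cb) tss) J (flat (sumBy cb))) (shifted _ (trans (length-map _ tss) e))))
              (shifted _ (trans (length-map _ tss) e))))
          (lem β B (β ^ P) (val β (map (sumBy cl) tss)) (val β (map (sumBy rgt) tss)) (val β (map (sumBy cb) tss)) (val β (map (sumBy top) tss)) (val β (map length tss))))
          where
          flat : (f : List Tile → ℕ) → length (map f tss) ≤ J
          flat f = ≤-trans (≤-reflexive (trans (length-map f tss) e)) L≤J
          lem : ∀ β B p l r b t n → l + (0 + β * r) + B * (b + p * t + B * (p * n)) ≡ l + β * r + B * (b + p * t) + B * B * (p * n)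
          lem = solve-∀

        len-D : (f : ℕ → ℕ) (a b : ℕ) → length (map f init ++ replicate R a ++ replicate P b) ≡ J
        len-D f a b = trans (length-++ (map f init)) (trans (cong₂ _+_ (trans (length-map f init) len)
          (trans (length-++ (replicate R a)) (cong₂ _+_ (length-replicate R) (length-replicate P)))) (sym (+-assoc P R P)))

        target-horner : target ≡ horner β (at₀ hD) J + B * (horner β (at₀ vD) J + B * horner β (at₀ cD) J)
        target-horner = sym (cong₂ (λ a b → a + B * b) (horner-at β hD J (≤-reflexive (len-D (λ _ → C) C 0)))
          (cong₂ (λ a b → a + B * b) (horner-at β vD J (≤-reflexive (len-D (C ∸_) C fin))) (horner-at β cD J (≤-reflexive (len-D (λ _ → 0) 1 1)))))

        h-eq : ∀ j → at₀ hD j ≡ at₀ (replicate L C) j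
        h-eq j = trans (cong (λ l → at₀ l j) (trans (sym (++-assoc (map (λ _ → C) init) (replicate R C) zs))
            (cong (_++ zs) (trans (cong (_++ replicate R C) (trans (map-const C init) (cong (λ n → replicate n C) len))) (replicate-++ P R)))))
          (trans (at-split (replicate L C) zs j) (trans (cong (at₀ (replicate L C) j +_)
            (trans (cong (λ n → at₀ (replicate n 0 ++ zs) j) (length-replicate L)) (trans (cong (λ l → at₀ l j) (replicate-++ L P)) (zero-at (L + P) j)))) (+-identityʳ _)))
          where
          zero-at : ∀ n j → at₀ (replicate n 0) j ≡ 0
          zero-at zero    j       = refl
          zero-at (suc n) zero    = refl
          zero-at (suc n) (suc j) = zero-at n j

        c-eq : cD ≡ zs ++ replicate L 1
        c-eq = cong₂ _++_ (trans (map-const 0 init) (cong (λ n → replicate n 0) len)) (trans (replicate-++ R P) (cong (λ n → replicate n 1) (+-comm R P)))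

        -- Adding the colours above and below the two sides of the vertical constraint makes them agree.
        v-eq : ∀ τs → length τs ≡ L → ∀ j →
          (at₀ (map cb τs) j + at₀ (zs ++ map top τs) j) + at₀ (map bot τs ++ replicate P fin) j ≡ at₀ vD j + at₀ (init ++ map top τs) j
        v-eq τs e j = trans (cong (λ v → at₀ (map cb τs) j + at₀ (zs ++ map top τs) j + v) (at-split (map bot τs) _ j))
          (trans (lem₁ (at₀ (map cb τs) j) (at₀ (zs ++ map top τs) j) (at₀ (map bot τs) j) (at₀ (replicate (length (map bot τs)) 0 ++ replicate P fin) j))
          (trans (cong₂ _+_ (trans (cong (λ l → at₀ l j + at₀ (map bot τs) j) (map-∘ τs)) (at-complement (map bot τs) (below τs) j)) refl)
          (trans (cong (λ n → at₀ (replicate n C) j + (at₀ (zs ++ map top τs) j + at₀ (replicate n 0 ++ replicate P fin) j)) (trans (length-map bot τs) e))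
          (sym (trans (cong₂ _+_ (at-split (map (C ∸_) init) (replicate R C ++ replicate P fin) j) (at-split init (map top τs) j))
          (trans (cong₂ (λ m n → (at₀ (map (C ∸_) init) j + at₀ (replicate m 0 ++ replicate R C ++ replicate P fin) j) + (at₀ init j + at₀ (replicate n 0 ++ map top τs) j)) (trans (length-map (C ∸_) init) len) len)
          (trans (lem₂ (at₀ (map (C ∸_) init) j) (at₀ (zs ++ replicate R C ++ replicate P fin) j) (at₀ init j) (at₀ (zs ++ map top τs) j))
          (trans (cong (λ v → v + at₀ (zs ++ replicate R C ++ replicate P fin) j + at₀ (zs ++ map top τs) j) (trans (at-complement init init≤ j) (cong (λ n → at₀ (replicate n C) j) len)))
          (trans (cong (_+ at₀ (zs ++ map top τs) j) (trans full (trans (at-split (replicate L C) (replicate P fin) j)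
            (cong (λ n → at₀ (replicate L C) j + at₀ (replicate n 0 ++ replicate P fin) j) (length-replicate L)))))
          (lem₃ (at₀ (replicate L C) j) (at₀ (replicate L 0 ++ replicate P fin) j) (at₀ (zs ++ map top τs) j)))))))))))
          where
          below : ∀ τs → All (_≤ C) (map bot τs)
          below []       = []
          below (τ ∷ τs) = bot≤ τ ∷ below τs
          full : at₀ (replicate P C) j + at₀ (zs ++ replicate R C ++ replicate P fin) j ≡ at₀ (replicate L C ++ replicate P fin) j
          full = trans (cong (λ n → at₀ (replicate P C) j + at₀ (replicate n 0 ++ replicate R C ++ replicate P fin) j) (sym (length-replicate P)))
            (trans (sym (at-split (replicate P C) (replicate R C ++ replicate P fin) j))
              (cong (λ l → at₀ l j) (trans (sym (++-assoc (replicate P C) (replicate R C) (replicate P fin))) (cong (_++ replicate P fin) (replicate-++ P R)))))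
          lem₁ : ∀ a b c d → a + b + (c + d) ≡ (a + c) + (b + d)
          lem₁ = solve-∀
          lem₂ : ∀ a b c d → (a + b) + (c + d) ≡ (a + c) + b + d
          lem₂ = solve-∀
          lem₃ : ∀ a b c → a + b + c ≡ a + (c + b)
          lem₃ = solve-∀

        map-single : (f : Tile → ℕ) → ∀ τs → map (sumBy f) (map [_] τs) ≡ map f τs
        map-single f []       = refl
        map-single f (τ ∷ τs) = cong₂ _∷_ (+-identityʳ (f τ)) (map-single f τs)

        map-length : ∀ (τs : List Tile) → map length (map [_] τs) ≡ replicate (length τs) 1
        map-length []       = refl
        map-length (τ ∷ τs) = cong (1 ∷_) (map-length τs)

        hF-single : ∀ τs j → hF (map [_] τs) j ≡ at₀ (map cl τs) j + at₀ (0 ∷ map rgt τs) j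
        hF-single τs j = cong₂ (λ a b → at₀ a j + at₀ (0 ∷ b) j) (map-single cl τs) (map-single rgt τs)

        vF-single : ∀ τs j → vF (map [_] τs) j ≡ at₀ (map cb τs) j + at₀ (zs ++ map top τs) j
        vF-single τs j = cong₂ (λ a b → at₀ a j + at₀ (zs ++ b) j) (map-single cb τs) (map-single top τs)

      -- The single equation `vert` says that the first P bottoms are `init`, that tile s + P stands
      -- on tile s, and that the last P tops are `fin`.
      record Solved (τs : List Tile) : Set where
        field
          long  : length τs ≡ L
          known : All (_∈ tiles) τs
          horiz : HChain 0 τs
          vert  : map bot τs ++ replicate P fin ≡ init ++ map top τs

      solved-T : ∀ {τs} → Solved τs → T (map [_] τs) ≡ target
      solved-T {τs} sol = trans (T-horner (map [_] τs) (trans (length-map [_] τs) long)) (trans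
          (cong₂ (λ a b → a + B * b) (horner-cong β J (λ j _ → hh j)) (cong₂ (λ a b → a + B * b) (horner-cong β J (λ j _ → vv j)) (horner-cong β J (λ j _ → cc j))))
          (sym target-horner))
        where
        open Solved sol
        hh : ∀ j → hF (map [_] τs) j ≡ at₀ hD j
        hh j = trans (hF-single τs j) (trans (hchain-digits τs 0 horiz j) (trans (cong (λ n → at₀ (replicate n C) j) long) (sym (h-eq j))))
        vv : ∀ j → vF (map [_] τs) j ≡ at₀ vD j
        vv j = trans (vF-single τs j) (+-cancelʳ-≡ (at₀ (init ++ map top τs) j) _ _
          (trans (cong (λ l → at₀ (map cb τs) j + at₀ (zs ++ map top τs) j + at₀ l j) (sym vert)) (v-eq τs long j)))
        cc : ∀ j → cF (map [_] τs) j ≡ at₀ cD j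
        cc j = cong (λ l → at₀ l j) (trans (cong (zs ++_) (trans (map-length τs) (cong (λ n → replicate n 1) long))) (sym c-eq))

      -- No digit overflows, so equal numbers have equal digits. The unit digits force exactly one
      -- tile at each place, and only then can complements and colours cancel.
      T-solved : ∀ tss → length tss ≡ L → All (λ ts → All (_∈ tiles) ts × length ts ≤ N) tss → T tss ≡ target → ∃ λ τs → Solved τs
      T-solved tss e ok eq = let τs , single = singles tss count in τs , sol τs single
        where
        small : ∀ (f : Tile → ℕ) → (∀ τ → f τ ≤ C) → ∀ {tss} → All (λ ts → All (_∈ tiles) ts × length ts ≤ N) tss → All (_≤ N * C) (map (sumBy f) tss)
        small f f≤ [] = []
        small f f≤ {ts ∷ _} ((_ , le) ∷ ok) = ≤-trans (sumBy-≤ ts (tabulateAll λ {τ} _ → f≤ τ)) (*-monoˡ-≤ C le) ∷ small f f≤ ok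
        counts : ∀ {tss} → All (λ ts → All (_∈ tiles) ts × length ts ≤ N) tss → All (_≤ N) (map length tss)
        counts [] = []
        counts ((_ , le) ∷ ok) = le ∷ counts ok
        zeros++ : ∀ {M xs} n → All (_≤ M) xs → All (_≤ M) (replicate n 0 ++ xs)
        zeros++ zero    a = a
        zeros++ (suc n) a = z≤n ∷ zeros++ n a
        reps : ∀ {M} n {x ys} → x ≤ M → All (_≤ M) ys → All (_≤ M) (replicate n x ++ ys)
        reps zero    p a = a
        reps (suc n) p a = p ∷ reps n p a
        maps : ∀ {M} (f : ℕ → ℕ) xs {ys} → (∀ x → f x ≤ M) → All (_≤ M) ys → All (_≤ M) (map f xs ++ ys)
        maps f []       p a = a
        maps f (x ∷ xs) p a = p x ∷ maps f xs p a
        reps' : ∀ {M} n {x} → x ≤ M → All (_≤ M) (replicate n x)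
        reps' zero    p = []
        reps' (suc n) p = p ∷ reps' n p
        digit-eqs : ∀ j → j < J → hF tss j ≡ at₀ hD j × vF tss j ≡ at₀ vD j × cF tss j ≡ at₀ cD j
        digit-eqs = interleaved-unique J
          (λ j → ≤-<-trans (+-mono-≤ (at-≤ (small cl (λ τ → m∸n≤m C (lft τ)) ok) j) (at-≤ (z≤n ∷ small rgt rgt≤ ok) j)) room)
          (λ j → ≤-<-trans (+-mono-≤ (at-≤ (small cb (λ τ → m∸n≤m C (bot τ)) ok) j) (at-≤ (zeros++ P (small top top≤ ok)) j)) room)
          (λ j → ≤-<-trans (at-≤ (zeros++ P (counts ok)) j) N<B)
          (λ j → ≤-<-trans (at-≤ (maps (λ _ → C) init (λ _ → ≤-refl) (reps R ≤-refl (reps' P z≤n))) j) C<B)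
          (λ j → ≤-<-trans (at-≤ (maps (C ∸_) init (m∸n≤m C) (reps R ≤-refl (reps' P fin≤))) j) C<B)
          (λ j → ≤-<-trans (at-≤ (maps {1} (λ _ → 0) init (λ _ → z≤n) (reps R ≤-refl (reps' P ≤-refl))) j) 1<B)
          (trans (sym (T-horner tss e)) (trans eq target-horner))
        count : ∀ s → s < length tss → at₀ (map length tss) s ≡ 1
        count s lt = trans (sym (at-zs (map length tss) s)) (trans (proj₂ (proj₂ (digit-eqs (P + s) P+s<J))) (trans (cong (λ l → at₀ l (P + s)) c-eq)
          (trans (at-zs (replicate L 1) s) (at-replicate L 1 (subst (s <_) e lt)))))
          where
          at-zs : ∀ xs s → at₀ (zs ++ xs) (P + s) ≡ at₀ xs s
          at-zs xs s = trans (cong (λ n → at₀ (zs ++ xs) (n + s)) (sym (length-replicate P))) (at-++ʳ zs s)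
          P+s<J : P + s < J
          P+s<J = <-≤-trans (+-monoʳ-< P (subst (s <_) e lt)) (≤-reflexive (+-comm P L))
        singles : ∀ tss → (∀ s → s < length tss → at₀ (map length tss) s ≡ 1) → ∃ λ τs → tss ≡ map [_] τs
        singles [] h = [] , refl
        singles ([] ∷ tss) h with h 0 (s≤s z≤n)
        ... | ()
        singles ((τ ∷ []) ∷ tss) h = let τs , eq = singles tss (λ s lt → h (suc s) (s≤s lt)) in τ ∷ τs , cong ([ τ ] ∷_) eq
        singles ((τ ∷ τ' ∷ ts) ∷ tss) h with h 0 (s≤s z≤n)
        ... | ()
        sol : ∀ τs → tss ≡ map [_] τs → Solved τs
        sol τs refl = record { long = long ; known = known τs ok ; horiz = digits-hchain τs 0 hz
          ; vert = at-ext _ _ (trans (length-++ (map bot τs)) (trans (cong₂ _+_ (trans (length-map bot τs) long) (length-replicate P))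
              (trans (+-comm L P) (sym (trans (length-++ init) (cong₂ _+_ len (trans (length-map top τs) long)))))))
              (λ j lt → +-cancelˡ-≡ (at₀ vD j) _ _ (trans (cong (_+ at₀ (map bot τs ++ replicate P fin) j) (sym (trans (sym (vF-single τs j)) (proj₁ (proj₂ (digit-eqs j (subst (j <_) lenJ lt)))))))
                 (v-eq τs long j))) }
          where
          long : length τs ≡ L
          long = trans (sym (length-map [_] τs)) e
          lenJ : length (map bot τs ++ replicate P fin) ≡ J
          lenJ = trans (length-++ (map bot τs)) (cong₂ _+_ (trans (length-map bot τs) long) (length-replicate P))
          known : ∀ τs → All (λ ts → All (_∈ tiles) ts × length ts ≤ N) (map [_] τs) → All (_∈ tiles) τs
          known []       []                    = []
          known (τ ∷ τs) (((m ∷ _) , _) ∷ oks) = m ∷ known τs oks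
          hz : ∀ j → j ≤ length τs → at₀ (map cl τs) j + at₀ (0 ∷ map rgt τs) j ≡ at₀ (replicate (length τs) C) j
          hz j le = trans (sym (hF-single τs j)) (trans (proj₁ (digit-eqs j (≤-<-trans (subst (j ≤_) long le) (<-≤-trans (n<1+n L) (≤-trans (≤-reflexive (+-comm 1 L)) (+-monoʳ-≤ L P>0))))))
            (trans (h-eq j) (cong (λ n → at₀ (replicate n C) j) (sym long))))

-- Computations as transducer histories

rest : List Sym → List Sym
rest []       = []
rest (_ ∷ ss) = ss

sfin : Sym → Fin 3
sfin blank = zero
sfin b0    = suc zero
sfin b1    = suc (suc zero)

-- One step of a machine M is one left-to-right pass of a letter-to-letter transducer over the configuration.
-- The transducer holds the cell read last, so that each pass shifts the configuration by one place and a head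
-- moving left can still be written into the previous cell.  The colours are the cell contents and held values:
-- start puts the head on the next cell, wit is a cell of the unknown witness, bot is a blank that ends the witness,
-- pend q s is a cell s whose right neighbour is to receive the head, and fin replaces an accepted configuration.
module Transducer (M : TM) where
  open TM M using (Q; δ; accepting)

  data Color : Set where
    cel : Sym → Color
    start wit fin bot : Color
    hd pend : Fin Q → Sym → Color

  private
    kind : Color → Fin 7 ⊎ (Fin Q × Fin 6)
    -- Cell contents come first, so that `cel blank` gets code 0, the boundary colour of a chain.
    kind (cel s)    = inj₁ (sfin s ↑ˡ 4)
    kind start      = inj₁ (suc (suc (suc zero)))
    kind wit        = inj₁ (suc (suc (suc (suc zero))))
    kind fin        = inj₁ (suc (suc (suc (suc (suc zero)))))
    kind bot        = inj₁ (suc (suc (suc (suc (suc (suc zero))))))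
    kind (hd q s)   = inj₂ (q , (sfin s ↑ˡ 3))
    kind (pend q s) = inj₂ (q , (3 ↑ʳ sfin s))

    unkind : Fin 7 ⊎ (Fin Q × Fin 6) → Color
    unkind (inj₁ zero)                                     = cel blank
    unkind (inj₁ (suc zero))                               = cel b0
    unkind (inj₁ (suc (suc zero)))                         = cel b1
    unkind (inj₁ (suc (suc (suc zero))))                   = start
    unkind (inj₁ (suc (suc (suc (suc zero)))))             = wit
    unkind (inj₁ (suc (suc (suc (suc (suc zero))))))       = fin
    unkind (inj₁ (suc (suc (suc (suc (suc (suc zero))))))) = bot
    unkind (inj₂ (q , zero))                               = hd q blank
    unkind (inj₂ (q , suc zero))                           = hd q b0
    unkind (inj₂ (q , suc (suc zero)))                     = hd q b1
    unkind (inj₂ (q , suc (suc (suc zero))))               = pend q blank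
    unkind (inj₂ (q , suc (suc (suc (suc zero)))))         = pend q b0
    unkind (inj₂ (q , suc (suc (suc (suc (suc zero))))))   = pend q b1

    unkind-kind : ∀ c → unkind (kind c) ≡ c
    unkind-kind (cel blank)    = refl
    unkind-kind (cel b0)       = refl
    unkind-kind (cel b1)       = refl
    unkind-kind start          = refl
    unkind-kind wit            = refl
    unkind-kind fin            = refl
    unkind-kind bot            = refl
    unkind-kind (hd q blank)   = refl
    unkind-kind (hd q b0)      = refl
    unkind-kind (hd q b1)      = refl
    unkind-kind (pend q blank) = refl
    unkind-kind (pend q b0)    = refl
    unkind-kind (pend q b1)    = refl

    codeK : Fin 7 ⊎ (Fin Q × Fin 6) → ℕ
    codeK (inj₁ i)       = toℕ i
    codeK (inj₂ (q , i)) = 7 + (toℕ q * 6 + toℕ i)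

    codeK-injective : ∀ x y → codeK x ≡ codeK y → x ≡ y
    codeK-injective (inj₁ i) (inj₁ j) e = cong inj₁ (toℕ-injective e)
    codeK-injective (inj₁ i) (inj₂ (q , j)) e = ⊥-elim (<-irrefl e (<-≤-trans (toℕ<n i) (m≤m+n 7 _)))
    codeK-injective (inj₂ (q , j)) (inj₁ i) e = ⊥-elim (<-irrefl (sym e) (<-≤-trans (toℕ<n i) (m≤m+n 7 _)))
    codeK-injective (inj₂ (q , i)) (inj₂ (q' , i')) e with slot-injective (toℕ q) (toℕ q') i i' (+-cancelˡ-≡ 7 _ _ e)
    ... | e₁ , refl with toℕ-injective e₁
    ...   | refl = refl

    codeK-≤ : ∀ x → codeK x ≤ 7 + (Q * 6 + 6)
    codeK-≤ (inj₁ i) = ≤-trans (<⇒≤ (toℕ<n i)) (m≤m+n 7 _)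
    codeK-≤ (inj₂ (q , i)) = +-monoʳ-≤ 7 (+-mono-≤ (*-monoˡ-≤ 6 (<⇒≤ (toℕ<n q))) (<⇒≤ (toℕ<n i)))

  code : Color → ℕ
  code c = codeK (kind c)

  code-injective : ∀ {c d} → code c ≡ code d → c ≡ d
  code-injective {c} {d} e = trans (sym (unkind-kind c)) (trans (cong unkind (codeK-injective (kind c) (kind d) e)) (unkind-kind d))

  maxCode : ℕ
  maxCode = 7 + (Q * 6 + 6)

  code-≤ : ∀ c → code c ≤ maxCode
  code-≤ c = codeK-≤ (kind c)

  release : Color → Color
  release (hd q a) = hd q a
  release (cel a)  = cel a
  release (pend q a) = cel a
  release _        = cel blank

  hold : Color → Sym → Color
  hold (pend q a) s = hd q s
  hold _          s = cel s

  under : Color → Sym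
  under (cel a) = a
  under _       = blank

  -- A halted head is carried along unchanged, just as `run` stays at a halted configuration, so
  -- histories with the same number of rows serve for all halting times.
  headStep : Maybe (Fin Q × Sym × Move) → Fin Q → Sym → Color → Color × Color
  headStep nothing                   q s l = release l , hd q s
  headStep (just (q' , s' , moveL)) q s l = hd q' (under l) , cel s'
  headStep (just (q' , s' , stay))  q s l = release l , hd q' s'
  headStep (just (q' , s' , moveR)) q s l = release l , pend q' s'

  step₁ : Color → Color → Color × Color
  step₁ (cel s)  l = release l , hold l s
  step₁ (hd q s) l = headStep (δ q s) q s l
  step₁ start    l = release l , pend (TM.start M) blank
  step₁ _        l = cel blank , cel blank

  closable : Color → Bool
  closable (cel s)  = true
  closable (hd q s) = maybe′ (λ _ → false) (accepting q) (δ q s)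
  closable _        = false

  readable : Color → Bool
  readable (cel _)  = true
  readable (hd _ _) = true
  readable start    = true
  readable _        = false

  -- No tile reads `fin`, so it can be written only in the last row. There every tile must close,
  -- and the tile with the head can do so only if the machine has halted and accepts.
  close : Color → Color → List (Color × Color)
  close c (cel blank) = if closable c then [ (fin , cel blank) ] else []
  close c _           = []

  -- Once `bot` is held, all later witness cells become blank, so the guessed content is always a
  -- bit string followed by blanks.
  guess : Color → List (Color × Color)
  guess bot = [ (cel blank , bot) ]
  guess l   = (release l , cel b0) ∷ (release l , cel b1) ∷ (release l , bot) ∷ []

  opts : Color → Color → List (Color × Color)
  opts wit l = guess l
  opts c   l = if readable c then step₁ c l ∷ close c l else []

  data Pass : Color → List Color → List Color → Color → Set where
    []  : ∀ {l} → Pass l [] [] l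
    _∷_ : ∀ {b l t l' bs ts r} → (t , l') ∈ opts b l → Pass l' bs ts r → Pass l (b ∷ bs) (t ∷ ts) r

  pass-++ : ∀ {l bs ts l' bs' ts' r} → Pass l bs ts l' → Pass l' bs' ts' r → Pass l (bs ++ bs') (ts ++ ts') r
  pass-++ []       q = q
  pass-++ (o ∷ p) q = o ∷ pass-++ p q

  pass-split : ∀ bs {bs' ts ts' l r} → length bs ≡ length ts → Pass l (bs ++ bs') (ts ++ ts') r →
               ∃ λ l' → Pass l bs ts l' × Pass l' bs' ts' r
  pass-split []       {ts = []}     e p = _ , [] , p
  pass-split (b ∷ bs) {ts = t ∷ ts} e (o ∷ p) = let l' , p₁ , p₂ = pass-split bs (suc-injective e) p in l' , o ∷ p₁ , p₂

  pass-length : ∀ {l bs ts r} → Pass l bs ts r → length ts ≡ length bs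
  pass-length []      = refl
  pass-length (o ∷ p) = cong suc (pass-length p)

  passF : Color → List Color → List Color × Color
  passF l []       = [] , l
  passF l (b ∷ bs) = let ts , r = passF (proj₂ (step₁ b l)) bs in proj₁ (step₁ b l) ∷ ts , r

  NoFin : List Color → Set
  NoFin = All (_≢ fin)

  pass-nofin : ∀ {l bs ts r} → Pass l bs ts r → NoFin bs
  pass-nofin []             = []
  pass-nofin (_∷_ {b} o p) = (λ { refl → case o of λ () }) ∷ pass-nofin p

  private
    Readable : List Color → Set
    Readable = All (λ c → readable c ≡ true)

    close-fin : ∀ c l {t r} → (t , r) ∈ close c l → t ≡ fin
    close-fin c (cel blank) m with closable c
    close-fin c (cel blank) (Any.here refl) | true = refl

    opts-step : ∀ b l → readable b ≡ true → opts b l ≡ step₁ b l ∷ close b l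
    opts-step (cel s)  l e = refl
    opts-step (hd q s) l e = refl
    opts-step start    l e = refl

    step-opts : ∀ b l → readable b ≡ true → step₁ b l ∈ opts b l
    step-opts b l e rewrite opts-step b l e = Any.here refl

    opts-det : ∀ b l {t r} → readable b ≡ true → t ≢ fin → (t , r) ∈ opts b l → (t , r) ≡ step₁ b l
    opts-det b l e n m rewrite opts-step b l e with m
    ... | Any.here eq  = eq
    ... | Any.there m' = ⊥-elim (n (close-fin b l m'))

  pass-det : ∀ {l bs ts r} → Readable bs → NoFin ts → Pass l bs ts r → (ts , r) ≡ passF l bs
  pass-det [] [] [] = refl
  pass-det {l} (e ∷ es) (n ∷ ns) (_∷_ {b} o p) with opts-det b l e n o
  ... | refl = cong (λ v → proj₁ v , proj₂ v) (cong (λ v → _ ∷ proj₁ v , proj₂ v) (pass-det es ns p))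

  passF-pass : ∀ l bs → Readable bs → Pass l bs (proj₁ (passF l bs)) (proj₂ (passF l bs))
  passF-pass l []       []       = []
  passF-pass l (b ∷ bs) (e ∷ es) = step-opts b l e ∷ passF-pass _ bs es

  passF-++ : ∀ l bs bs' → passF l (bs ++ bs') ≡ (proj₁ (passF l bs) ++ proj₁ (passF (proj₂ (passF l bs)) bs') , proj₂ (passF (proj₂ (passF l bs)) bs'))
  passF-++ l []       bs' = refl
  passF-++ l (b ∷ bs) bs' = cong (λ v → _ ∷ proj₁ v , proj₂ v) (passF-++ _ bs bs')

  blanks : ℕ → List Color
  blanks n = replicate n (cel blank)

  str : ℕ → Config Q → ℕ → List Color
  str a k b = blanks a ++ map cel (reverse (left k)) ++ hd (state k) (head k) ∷ map cel (right k) ++ blanks b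

  private
    readable-++ : ∀ {xs ys} → Readable xs → Readable ys → Readable (xs ++ ys)
    readable-++ []       q = q
    readable-++ (e ∷ es) q = e ∷ readable-++ es q

    readable-blanks : ∀ n → Readable (blanks n)
    readable-blanks zero    = []
    readable-blanks (suc n) = refl ∷ readable-blanks n

    readable-syms : ∀ ss → Readable (map cel ss)
    readable-syms []       = []
    readable-syms (s ∷ ss) = refl ∷ readable-syms ss

    readable-str : ∀ a k b → Readable (str a k b)
    readable-str a k b = readable-++ (readable-blanks a) (readable-++ (readable-syms (reverse (left k)))
      (refl ∷ readable-++ (readable-syms (right k)) (readable-blanks b)))

    shift-syms : ∀ y xs z → passF (cel y) (map cel (xs ++ [ z ])) ≡ (map cel (y ∷ xs) , cel z)
    shift-syms y []       z = refl
    shift-syms y (x ∷ xs) z = cong (λ v → cel y ∷ proj₁ v , proj₂ v) (shift-syms x xs z)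

    blank-snoc : ∀ n → replicate (suc n) blank ≡ replicate n blank ++ [ blank ]
    blank-snoc zero    = refl
    blank-snoc (suc n) = cong (blank ∷_) (blank-snoc n)

    pad : ∀ ss n → map cel ss ++ blanks n ≡ map cel (ss ++ replicate n blank)
    pad ss n = sym (trans (map-++ cel ss _) (cong (map cel ss ++_) (map-replicate cel n blank)))

    tail-shift : ∀ y ss b → passF (cel y) (map cel ss ++ blanks (suc b)) ≡ (cel y ∷ map cel ss ++ blanks b , cel blank)
    tail-shift y ss b = trans (cong (passF (cel y)) (trans (pad ss (suc b)) (cong (map cel) (trans (cong (ss ++_) (blank-snoc b)) (sym (++-assoc ss _ _))))))
      (trans (shift-syms y (ss ++ replicate b blank) blank) (cong (λ v → cel y ∷ v , cel blank) (sym (pad ss b))))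

    hd-shift : ∀ q y ss b → passF (hd q y) (map cel ss ++ blanks (suc b)) ≡ (hd q y ∷ map cel ss ++ blanks b , cel blank)
    hd-shift q y []       zero    = refl
    hd-shift q y []       (suc b) = cong (λ v → hd q y ∷ proj₁ v , proj₂ v) (tail-shift blank [] b)
    hd-shift q y (s ∷ ss) b       = cong (λ v → hd q y ∷ proj₁ v , proj₂ v) (tail-shift s ss b)

    pend-shift : ∀ q y ss b → ∃ λ b' → b ≤ b' ×
      passF (pend q y) (map cel ss ++ blanks (2 + b)) ≡ (cel y ∷ hd q (nth ss 0) ∷ map cel (rest ss) ++ blanks b' , cel blank)
    pend-shift q y []       b = b , ≤-refl , cong (λ v → cel y ∷ proj₁ v , proj₂ v) (hd-shift q blank [] b)
    pend-shift q y (s ∷ ss) b = suc b , n≤1+n b , cong (λ v → cel y ∷ proj₁ v , proj₂ v) (hd-shift q s ss (suc b))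

    -- The pass writes the held cell before the one it reads, so at the head the left neighbour is
    -- still in hand. With nothing written on the left, it is a padding blank that is held, hence
    -- the case distinction.
    before : ∀ a ls → passF (cel blank) (blanks a ++ map cel (reverse ls)) ≡
      (blanks (if null ls then a else suc a) ++ map cel (reverse (rest ls)) , cel (nth ls 0))
    before zero [] = refl
    before (suc a) [] = trans (cong (passF (cel blank)) (trans (pad' (suc a)) (cong (map cel) (blank-snoc a))))
      (trans (shift-syms blank (replicate a blank) blank) (cong (_, cel blank) (trans (map-replicate cel (suc a) blank) (sym (++-identityʳ _)))))
      where
      pad' : ∀ n → blanks n ++ [] ≡ map cel (replicate n blank)
      pad' n = trans (++-identityʳ _) (sym (map-replicate cel n blank))
    before a (l ∷ ls) = trans (cong (passF (cel blank)) (trans (cong₂ _++_ (sym (map-replicate cel a blank)) (cong (map cel) (unfold-reverse l ls)))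
        (trans (sym (map-++ cel (replicate a blank) _)) (cong (map cel) (sym (++-assoc (replicate a blank) (reverse ls) [ l ]))))))
      (trans (shift-syms blank (replicate a blank ++ reverse ls) l)
        (cong (λ v → cel blank ∷ v , cel l) (trans (map-++ cel (replicate a blank) _) (cong (_++ map cel (reverse ls)) (map-replicate cel a blank)))))

    assemble : ∀ a ls c → blanks (if null ls then a else suc a) ++ map cel (reverse (rest ls)) ++ (cel (nth ls 0) ∷ c) ≡
      blanks (suc a) ++ map cel (reverse ls) ++ c
    assemble a [] c = trans (sym (++-assoc (blanks a) [ cel blank ] c)) (cong (_++ c) (sym (snoc a)))
      where
      snoc : ∀ n → blanks (suc n) ≡ blanks n ++ [ cel blank ]
      snoc zero    = refl
      snoc (suc n) = cong (cel blank ∷_) (snoc n)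
    assemble a (l ∷ ls) c = cong (blanks (suc a) ++_) (trans (sym (++-assoc (map cel (reverse ls)) [ cel l ] c))
      (cong (_++ c) (sym (trans (cong (map cel) (unfold-reverse l ls)) (map-++ cel (reverse ls) [ l ])))))

    after-head : ∀ q h ls rs b a → ∃ λ a' → ∃ λ b' → b ≤ b' ×
      (let c = passF (cel (nth ls 0)) (hd q h ∷ map cel rs ++ blanks (2 + b)) in
       (blanks (if null ls then a else suc a) ++ map cel (reverse (rest ls))) ++ proj₁ c ≡ str a' (run M 1 (conf q ls h rs)) b' ×
       proj₂ c ≡ cel blank)
    after-head q h ls rs b a with δ q h
    ... | nothing rewrite hd-shift q h rs (suc b) = suc a , suc b , n≤1+n b , trans (++-assoc (blanks (if null ls then a else suc a)) _ _) (assemble a ls _) , refl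
    ... | just (q' , s' , stay) rewrite hd-shift q' s' rs (suc b) = suc a , suc b , n≤1+n b , trans (++-assoc (blanks (if null ls then a else suc a)) _ _) (assemble a ls _) , refl
    after-head q h [] rs b a | just (q' , s' , moveL) rewrite tail-shift s' rs (suc b) =
      a , suc b , n≤1+n b , ++-assoc (blanks a) [] _ , refl
    after-head q h (l ∷ ls) rs b a | just (q' , s' , moveL) rewrite tail-shift s' rs (suc b) =
      suc a , suc b , n≤1+n b , ++-assoc (blanks (suc a)) _ _ , refl
    after-head q h ls rs b a | just (q' , s' , moveR) with pend-shift q' s' rs b
    ... | b' , le , e rewrite e = suc a , b' , le , trans (++-assoc (blanks (if null ls then a else suc a)) _ _) (trans (assemble a ls _)
      (trans (cong (blanks (suc a) ++_) (trans (sym (++-assoc (map cel (reverse ls)) [ cel s' ] _)) (cong (_++ hd q' (nth rs 0) ∷ map cel (rest rs) ++ blanks b')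
        (sym (trans (cong (map cel) (unfold-reverse s' ls)) (map-++ cel (reverse ls) [ s' ])))))) (moved rs))) , refl
      where
      moved : ∀ rs → blanks (suc a) ++ map cel (reverse (s' ∷ ls)) ++ hd q' (nth rs 0) ∷ map cel (rest rs) ++ blanks b' ≡ str (suc a) (writeMove q' s' moveR (conf q ls h rs)) b'
      moved []       = refl
      moved (r ∷ rs) = refl

  -- A pass uses up at most two blanks on the right: one for the shift and one for a head that moves
  -- right beyond the written cells.
  pass-step : ∀ a k b → ∃ λ a' → ∃ λ b' → b ≤ b' × passF (cel blank) (str a k (2 + b)) ≡ (str a' (run M 1 k) b' , cel blank)
  pass-step a k@(conf q ls h rs) b with after-head q h ls rs b a
  ... | a' , b' , le , e₁ , e₂ = a' , b' , le ,
    trans (cong (passF (cel blank)) (sym (++-assoc (blanks a) (map cel (reverse ls)) _)))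
      (trans (passF-++ (cel blank) (blanks a ++ map cel (reverse ls)) _) (trans
        (cong (λ v → proj₁ v ++ proj₁ (passF (proj₂ v) (hd q h ∷ map cel rs ++ blanks (2 + b))) , proj₂ (passF (proj₂ v) (hd q h ∷ map cel rs ++ blanks (2 + b)))) (before a ls))
        (cong₂ _,_ e₁ e₂)))

  fins : ℕ → List Color
  fins n = replicate n fin

  Won : Config Q → Set
  Won k = Halted M k × accepting (state k) ≡ true

  private
    close-won : ∀ q s r → (fin , r) ∈ opts (hd q s) (cel blank) → δ q s ≡ nothing × accepting q ≡ true × r ≡ cel blank
    close-won q s r m with δ q s | accepting q
    close-won q s r (Any.here ()) | nothing | false
    close-won q s r (Any.here ()) | nothing | true
    close-won q s r (Any.there (Any.here refl)) | nothing | true = refl , refl , refl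
    close-won q s r (Any.here ()) | just (_ , _ , moveL) | _
    close-won q s r (Any.here ()) | just (_ , _ , moveR) | _
    close-won q s r (Any.here ()) | just (_ , _ , stay) | _

    close-cel : ∀ s r → (fin , r) ∈ opts (cel s) (cel blank) → r ≡ cel blank
    close-cel s r (Any.there (Any.here refl)) = refl

    closing⁻ : ∀ ss {bs r} → Pass (cel blank) (map cel ss ++ bs) (fins (length (map cel ss ++ bs))) r → Pass (cel blank) bs (fins (length bs)) r
    closing⁻ []       p = p
    closing⁻ (s ∷ ss) (o ∷ p) with close-cel s _ o
    ... | refl = closing⁻ ss p

    closing-won : ∀ a k b {r} → Pass (cel blank) (str a k b) (fins (length (str a k b))) r → Won k
    closing-won a k b {r} p with closing⁻ (reverse (left k)) (closing⁻ (replicate a blank)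
        (subst (λ l → Pass (cel blank) (l ++ _) (fins (length (l ++ _))) r) (sym (map-replicate cel a blank)) p))
    ... | o ∷ _ = let e₁ , e₂ , _ = close-won (state k) (head k) _ o in e₁ , e₂

    closing⁺ : ∀ ss {bs} → Pass (cel blank) bs (fins (length bs)) (cel blank) → Pass (cel blank) (map cel ss ++ bs) (fins (length (map cel ss ++ bs))) (cel blank)
    closing⁺ []       p = p
    closing⁺ (s ∷ ss) p = Any.there (Any.here refl) ∷ closing⁺ ss p

    won-closing : ∀ a k b → Won k → Pass (cel blank) (str a k b) (fins (length (str a k b))) (cel blank)
    won-closing a k b (ht , ac) = subst (λ l → Pass (cel blank) (l ++ _) (fins (length (l ++ _))) (cel blank)) (map-replicate cel a blank)
      (closing⁺ (replicate a blank) (closing⁺ (reverse (left k)) (at-head ∷ subst (λ l → Pass (cel blank) l (fins (length l)) (cel blank))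
        (sym (trans (pad (right k) b) (sym (++-identityʳ _)))) (closing⁺ (right k ++ replicate b blank) []))))
      where
      at-head : (fin , cel blank) ∈ opts (hd (state k) (head k)) (cel blank)
      at-head rewrite ht | ac = Any.there (Any.here refl)

    split-at : ∀ {A : Set} m {n} (xs : List A) → length xs ≡ m + n → ∃ λ ys → ∃ λ zs → xs ≡ ys ++ zs × length ys ≡ m × length zs ≡ n
    split-at zero    xs       e = [] , xs , refl , refl , e
    split-at (suc m) (x ∷ xs) e = let ys , zs , e₁ , e₂ , e₃ = split-at m xs (suc-injective e) in x ∷ ys , zs , cong (x ∷_) e₁ , cong suc e₂ , e₃

    nofin-++ˡ : ∀ xs {ys} → NoFin (xs ++ ys) → NoFin xs
    nofin-++ˡ []       ns       = []
    nofin-++ˡ (x ∷ xs) (n ∷ ns) = n ∷ nofin-++ˡ xs ns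

    nofin-++ʳ : ∀ xs {ys} → NoFin (xs ++ ys) → NoFin ys
    nofin-++ʳ []       ns       = ns
    nofin-++ʳ (x ∷ xs) (n ∷ ns) = nofin-++ʳ xs ns

    run-suc : ∀ m k → run M (suc m) k ≡ run M m (run M 1 k)
    run-suc m k = run-+ M 1 m k

  -- One pass over all rows in sequence writes the same sequence without its first row, followed by
  -- the closing row. Each step leaves `cel blank` in hand at the end of its row, the state in which
  -- the next row has to start.
  history⁻ : ∀ m a k b {P X r} → m * 2 ≤ b → length (str a k b) ≡ P → length X ≡ m * P →
             Pass (cel blank) (str a k b ++ X) (X ++ fins P) r → Won (run M m k)
  history⁻ zero a k b {X = []} le refl lx p = closing-won a k b (subst (λ l → Pass (cel blank) l (fins (length (str a k b))) _) (++-identityʳ (str a k b)) p)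
  history⁻ (suc m) a k (suc (suc b)) {P} {X} (s≤s (s≤s le)) lp lx p with split-at P X lx
  ... | row , X' , refl , lr , lx' with pass-split (str a k (2 + b)) (trans lp (sym lr))
          (subst (λ l → Pass (cel blank) (str a k (2 + b) ++ row ++ X') l _) (++-assoc row X' (fins P)) p)
  -- The row just written is read by the rest of the pass, so it contains no `fin`; and a pass over
  -- a configuration that writes no `fin` is deterministic.
  ...   | l' , p₁ , p₂ with pass-step a k b | pass-det (readable-str a k (2 + b)) (nofin-++ˡ row (pass-nofin p₂)) p₁
  ...     | a' , b' , le' , e | eq with trans eq e
  ...       | refl = subst Won (sym (run-suc m k)) (history⁻ m a' (run M 1 k) b' (≤-trans le le') lr lx' p₂)

  history⁺ : ∀ m a k b {P} → m * 2 ≤ b → length (str a k b) ≡ P → Won (run M m k) →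
             ∃ λ X → length X ≡ m * P × Pass (cel blank) (str a k b ++ X) (X ++ fins P) (cel blank)
  history⁺ zero a k b le refl w = [] , refl , subst (λ l → Pass (cel blank) l (fins (length (str a k b))) (cel blank)) (sym (++-identityʳ (str a k b))) (won-closing a k b w)
  history⁺ (suc m) a k (suc (suc b)) {P} (s≤s (s≤s le)) lp w with pass-step a k b
  ... | a' , b' , le' , e = let
      p₁ : Pass (cel blank) (str a k (2 + b)) (str a' (run M 1 k) b') (cel blank)
      p₁ = subst (λ v → Pass (cel blank) (str a k (2 + b)) (proj₁ v) (proj₂ v)) e (passF-pass (cel blank) _ (readable-str a k (2 + b)))
      lp' = trans (pass-length p₁) lp
      X , lx , p₂ = history⁺ m a' (run M 1 k) b' (≤-trans le le') lp' (subst Won (run-suc m k) w)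
    in str a' (run M 1 k) b' ++ X , trans (length-++ (str a' (run M 1 k) b')) (cong₂ _+_ lp' lx) ,
       subst (λ l → Pass (cel blank) (str a k (2 + b) ++ str a' (run M 1 k) b' ++ X) l (cel blank)) (sym (++-assoc (str a' (run M 1 k) b') X (fins P))) (pass-++ p₁ p₂)

  filled : ∀ (W : ℕ) → List Bool → ℕ → List Sym
  filled W w b = map bitSym w ++ replicate (W ∸ length w) blank ++ replicate (suc b) blank

  wits : ℕ → List Color
  wits n = replicate n wit

  private
    readable-bl : ∀ b → Readable (map cel (replicate b blank))
    readable-bl b = readable-syms (replicate b blank)

    wits-bot⁻ : ∀ W b {ts r} → NoFin ts → Pass bot (wits W ++ map cel (replicate (suc b) blank)) ts r →
                (ts , r) ≡ passF (cel blank) (map cel (replicate W blank ++ replicate (suc b) blank))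
    wits-bot⁻ zero b ns p = pass-det (readable-bl (suc b)) ns p
    wits-bot⁻ (suc W) b (n ∷ ns) (Any.here refl ∷ p) = cong (λ v → cel blank ∷ proj₁ v , proj₂ v) (wits-bot⁻ W b ns p)

    wits⁻ : ∀ W b y {ts r} → NoFin ts → Pass (cel y) (wits W ++ map cel (replicate (suc b) blank)) ts r →
            ∃ λ w → length w ≤ W × (ts , r) ≡ passF (cel y) (map cel (filled W w b))
    wits⁻ zero b y ns p = [] , z≤n , pass-det (readable-bl (suc b)) ns p
    wits⁻ (suc W) b y (n ∷ ns) (Any.here refl ∷ p) = let w , le , e = wits⁻ W b b0 ns p in
      false ∷ w , s≤s le , cong (λ v → cel y ∷ proj₁ v , proj₂ v) e
    wits⁻ (suc W) b y (n ∷ ns) (Any.there (Any.here refl) ∷ p) = let w , le , e = wits⁻ W b b1 ns p in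
      true ∷ w , s≤s le , cong (λ v → cel y ∷ proj₁ v , proj₂ v) e
    wits⁻ (suc W) b y (n ∷ ns) (Any.there (Any.there (Any.here refl)) ∷ p) =
      [] , z≤n , cong (λ v → cel y ∷ proj₁ v , proj₂ v) (wits-bot⁻ W b ns p)

    wits-bot⁺ : ∀ W b → let c = passF (cel blank) (map cel (replicate W blank ++ replicate (suc b) blank)) in
                Pass bot (wits W ++ map cel (replicate (suc b) blank)) (proj₁ c) (proj₂ c)
    wits-bot⁺ zero    b = passF-pass bot _ (readable-bl (suc b))
    wits-bot⁺ (suc W) b = Any.here refl ∷ wits-bot⁺ W b

    wits⁺ : ∀ W b y w → length w ≤ W → let c = passF (cel y) (map cel (filled W w b)) in
            Pass (cel y) (wits W ++ map cel (replicate (suc b) blank)) (proj₁ c) (proj₂ c)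
    wits⁺ zero    b y []          le       = passF-pass (cel y) _ (readable-bl (suc b))
    wits⁺ (suc W) b y []          le       = Any.there (Any.there (Any.here refl)) ∷ wits-bot⁺ W b
    wits⁺ (suc W) b y (false ∷ w) (s≤s le) = Any.here refl ∷ wits⁺ W b b0 w le
    wits⁺ (suc W) b y (true ∷ w)  (s≤s le) = Any.there (Any.here refl) ∷ wits⁺ W b b1 w le

  known : List Bool → List Sym
  known x = map bitSym (concatMap (λ b → b ∷ b ∷ []) x)

  initRow : List Bool → ℕ → ℕ → List Color
  initRow x W b = cel blank ∷ start ∷ map cel (known x) ++ cel b0 ∷ cel b1 ∷ wits W ++ map cel (replicate (suc b) blank)

  private
    prefix : List Bool → List Color
    prefix x = cel blank ∷ start ∷ map cel (known x) ++ cel b0 ∷ cel b1 ∷ []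

    readable-prefix : ∀ x → Readable (prefix x)
    readable-prefix x = refl ∷ refl ∷ readable-++ (readable-syms (known x)) (refl ∷ refl ∷ [])

    initRow-prefix : ∀ x ys → cel blank ∷ start ∷ map cel (known x) ++ cel b0 ∷ cel b1 ∷ ys ≡ prefix x ++ ys
    initRow-prefix x ys = cong (λ l → cel blank ∷ start ∷ l) (sym (++-assoc (map cel (known x)) (cel b0 ∷ cel b1 ∷ []) ys))

    hold-hold : ∀ l {s s'} → hold (hold l s) s' ≡ cel s'
    hold-hold (cel _)    = refl
    hold-hold start      = refl
    hold-hold wit        = refl
    hold-hold fin        = refl
    hold-hold bot        = refl
    hold-hold (hd _ _)   = refl
    hold-hold (pend _ _) = refl

    held-b1 : ∀ l xs → proj₂ (passF l (map cel xs ++ cel b0 ∷ cel b1 ∷ [])) ≡ cel b1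
    held-b1 l []       = hold-hold l
    held-b1 l (x ∷ xs) = held-b1 (hold l x) xs

    prefix-held : ∀ x → proj₂ (passF (cel blank) (prefix x)) ≡ cel b1
    prefix-held x = held-b1 _ (known x)

    whole-row : ∀ x W w b → prefix x ++ map cel (filled W w b) ≡
      cel blank ∷ start ∷ map cel (map bitSym (pairEnc x w)) ++ blanks ((W ∸ length w) + suc b)
    whole-row x W w b = trans (sym (initRow-prefix x _)) (cong (λ l → cel blank ∷ start ∷ l)
      (trans (cong (λ l → map cel (known x) ++ cel b0 ∷ cel b1 ∷ l)
          (trans (map-++ cel (map bitSym w) _) (cong (map cel (map bitSym w) ++_) (trans (cong (map cel) (replicate-++ (W ∸ length w) (suc b))) (map-replicate cel _ blank)))))
        (trans (sym (++-assoc (map cel (known x)) (cel b0 ∷ cel b1 ∷ map cel (map bitSym w)) _)) (cong (_++ blanks _)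
          (sym (trans (cong (map cel) (map-++ bitSym (concatMap (λ b → b ∷ b ∷ []) x) _)) (map-++ cel (known x) _)))))))

    -- The three blanks on the left are the one held initially, the first cell of the row, and the
    -- cell of `start`.
    started : ∀ y b → ∃ λ b' → b ≤ b' × passF (cel blank) (cel blank ∷ start ∷ map cel (map bitSym y) ++ blanks (2 + b)) ≡
              (str 3 (initConf M y) b' , cel blank)
    started []       b = b , ≤-refl , cong (λ v → cel blank ∷ cel blank ∷ cel blank ∷ proj₁ v , proj₂ v) (hd-shift (TM.start M) blank [] b)
    started (s ∷ ys) b = suc b , n≤1+n b , cong (λ v → cel blank ∷ cel blank ∷ cel blank ∷ proj₁ v , proj₂ v) (hd-shift (TM.start M) (bitSym s) (map bitSym ys) (suc b))

    first-row : ∀ x W w b → ∃ λ b' → b ≤ b' × passF (cel blank) (prefix x ++ map cel (filled W w (suc b))) ≡ (str 3 (initConf M (pairEnc x w)) b' , cel blank)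
    first-row x W w b with started (pairEnc x w) ((W ∸ length w) + b)
    ... | b' , le , e = b' , ≤-trans (m≤n+m b _) le , trans (cong (passF (cel blank)) (trans (whole-row x W w (suc b))
      (cong (λ n → cel blank ∷ start ∷ map cel (map bitSym (pairEnc x w)) ++ blanks n) (lem (W ∸ length w) b)))) e
      where
      lem : ∀ a b → a + suc (suc b) ≡ 2 + (a + b)
      lem = solve-∀

  accepted⁻ : ∀ x W T b {P X r} → T * 2 ≤ b → length (initRow x W (suc b)) ≡ P → length X ≡ suc T * P →
    Pass (cel blank) (initRow x W (suc b) ++ X) (X ++ fins P) r →
    ∃ λ w → length w ≤ W × Won (runOn M T (pairEnc x w))
  accepted⁻ x W T b {P} {X} {r} le lp lx p with split-at P X lx
  ... | row , X' , refl , lr , lx' with pass-split (initRow x W (suc b)) {ts = row} {ts' = X' ++ fins P} (trans lp (sym lr))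
          (subst (λ l → Pass (cel blank) (initRow x W (suc b) ++ row ++ X') l r) (++-assoc row X' (fins P)) p)
  ...   | l' , p₁ , p₂ with split-at (length (prefix x)) row (trans (pass-length p₁) (trans (cong length (initRow-prefix x _)) (length-++ (prefix x))))
  ...     | ys , zs , refl , ly , lz with pass-split (prefix x) (sym ly) (subst (λ l → Pass (cel blank) l (ys ++ zs) l') (initRow-prefix x _) p₁)
  ...       | l₁ , p₃ , p₄ with pass-det (readable-prefix x) (nofin-++ˡ ys (nofin-++ˡ (ys ++ zs) (pass-nofin p₂))) p₃
  ...         | refl with wits⁻ W (suc b) b1 (nofin-++ʳ ys (nofin-++ˡ (ys ++ zs) (pass-nofin p₂))) (subst (λ l → Pass l _ zs l') (prefix-held x) p₄)
  ...           | w , lw , e = w , lw , finish (first-row x W w b)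
    where
    row-eq : (ys ++ zs , l') ≡ passF (cel blank) (prefix x ++ map cel (filled W w (suc b)))
    row-eq = trans (cong (λ v → ys ++ proj₁ v , proj₂ v) e) (sym (trans (passF-++ (cel blank) (prefix x) _)
      (cong (λ l → ys ++ proj₁ (passF l (map cel (filled W w (suc b)))) , proj₂ (passF l (map cel (filled W w (suc b))))) (prefix-held x))))
    finish : (∃ λ b' → b ≤ b' × passF (cel blank) (prefix x ++ map cel (filled W w (suc b))) ≡ (str 3 (initConf M (pairEnc x w)) b' , cel blank)) →
             Won (runOn M T (pairEnc x w))
    finish (b' , le' , e') = history⁻ T 3 (initConf M (pairEnc x w)) b' (≤-trans le le') (trans (cong length (sym row≡)) lr) lx'
      (subst₂ (λ u v → Pass v (u ++ X') (X' ++ fins P) r) row≡ held p₂)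
      where
      row≡ : ys ++ zs ≡ str 3 (initConf M (pairEnc x w)) b'
      row≡ = cong proj₁ (trans row-eq e')
      held : l' ≡ cel blank
      held = cong proj₂ (trans row-eq e')

  accepted⁺ : ∀ x W T b {P} w → T * 2 ≤ b → length (initRow x W (suc b)) ≡ P → length w ≤ W → Won (runOn M T (pairEnc x w)) →
    ∃ λ X → length X ≡ suc T * P × Pass (cel blank) (initRow x W (suc b) ++ X) (X ++ fins P) (cel blank)
  accepted⁺ x W T b {P} w le lp lw won with first-row x W w b
  ... | b' , le' , e = let
      row = str 3 (initConf M (pairEnc x w)) b'
      p₁ : Pass (cel blank) (initRow x W (suc b)) row (cel blank)
      p₁ = subst₂ (λ u v → Pass (cel blank) u (proj₁ v) (proj₂ v)) (sym (initRow-prefix x _)) (trans row-eq e)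
             (pass-++ (passF-pass (cel blank) (prefix x) (readable-prefix x))
               (subst (λ l → Pass l _ _ _) (sym (prefix-held x)) (wits⁺ W (suc b) b1 w lw)))
      lp' = trans (pass-length p₁) lp
      X , lx , p₂ = history⁺ T 3 (initConf M (pairEnc x w)) b' (≤-trans le le') lp' won
    in row ++ X , trans (length-++ row) (cong₂ _+_ lp' lx) ,
       subst (λ l → Pass (cel blank) (initRow x W (suc b) ++ row ++ X) l (cel blank)) (sym (++-assoc row X (fins P))) (pass-++ p₁ p₂)
    where
    ys = proj₁ (passF (cel blank) (prefix x))
    row-eq : (ys ++ proj₁ (passF (cel b1) (map cel (filled W w (suc b)))) , proj₂ (passF (cel b1) (map cel (filled W w (suc b))))) ≡
             passF (cel blank) (prefix x ++ map cel (filled W w (suc b)))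
    row-eq = sym (trans (passF-++ (cel blank) (prefix x) _)
      (cong (λ l → ys ++ proj₁ (passF l (map cel (filled W w (suc b)))) , proj₂ (passF l (map cel (filled W w (suc b))))) (prefix-held x)))

-- The demands

private
  variable
    A : Set

blk : ℕ → List ℕ → List Bool
blk w = concatMap (bits w)

length-blk : ∀ w xs → length (blk w xs) ≡ length xs * w
length-blk w []       = refl
length-blk w (x ∷ xs) = trans (length-++ (bits w x)) (cong₂ _+_ (length-bits w x) (length-blk w xs))

num-blk : ∀ w xs → All (_< 2 ^ w) xs → num (blk w xs) ≡ val (2 ^ w) xs
num-blk w []       []       = refl
num-blk w (x ∷ xs) (p ∷ ps) = trans (num-++ (bits w x) (blk w xs))
  (cong₂ (λ a b → a + b) (num-bits w x p) (cong₂ (λ l v → 2 ^ l * v) (length-bits w x) (num-blk w xs ps)))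

bval-true : ∀ bs → bval (true ∷ bs) ≡ 2 * (2 ^ length bs + num bs)
bval-true bs = cong (2 *_) (bval-num bs)

abstract
  -- `l` is the number of rounds of the program loop that doubles 1 until `m` is reached: the third
  -- component is the loop condition in each round, the second the exit condition.
  log : ∀ m → ∃ λ l → m ≤ 2 ^ l × (∀ a → a < l → 2 ^ a < m) × l ≤ m
  log zero = 0 , z≤n , (λ _ ()) , z≤n
  log (suc m) with log m
  ... | l , m≤ , below , l≤m with suc m ≤? 2 ^ l
  ...   | yes le = l , le , (λ a a<l → m<n⇒m<1+n (below a a<l)) , m≤n⇒m≤1+n l≤m
  ...   | no ¬le = suc l , ≤-trans (s≤s m≤) (≤-trans (+-monoˡ-≤ (2 ^ l) (m^n>0 2 l)) (≤-reflexive (cong (2 ^ l +_) (sym (+-identityʳ _))))) , go , s≤s l≤m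
    where
    go : ∀ a → a < suc l → 2 ^ a < suc m
    go a (s≤s a≤l) with m≤n⇒m<n∨m≡n a≤l
    ... | inj₁ a<l  = m<n⇒m<1+n (below a a<l)
    ... | inj₂ refl = ≰⇒> ¬le

∈-concatMap : ∀ {B : Set} (f : A → List B) {xs x y} → x ∈ xs → y ∈ f x → y ∈ concatMap f xs
∈-concatMap f m n = ∈-concatMap⁺ f (lose m n)

sumBy-∈ : ∀ (f : A → ℕ) {xs x} → x ∈ xs → f x ≤ sumBy f xs
sumBy-∈ f {x ∷ xs} (Any.here refl) = m≤m+n (f x) _
sumBy-∈ f {y ∷ xs} (Any.there m)   = ≤-trans (sumBy-∈ f m) (m≤n+m _ (f y))

-- The finite tile set of a machine

record ColoredTile (M : TM) : Set where
  constructor tile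
  open Transducer M
  field below behind above ahead : Color

module TileSet (M : TM) where
  open Transducer M public
  open ColoredTile public

  Tile : Set
  Tile = ColoredTile M

  syms : List Sym
  syms = blank ∷ b0 ∷ b1 ∷ []

  colors : List Color
  colors = start ∷ wit ∷ fin ∷ bot ∷ map cel syms ++
    concatMap (λ q → map (hd q) syms ++ map (pend q) syms) (allFin (TM.Q M))

  private
    ∈-syms : ∀ s → s ∈ syms
    ∈-syms blank = Any.here refl
    ∈-syms b0    = Any.there (Any.here refl)
    ∈-syms b1    = Any.there (Any.there (Any.here refl))

  ∈-colors : ∀ c → c ∈ colors
  ∈-colors start = Any.here refl
  ∈-colors wit   = Any.there (Any.here refl)
  ∈-colors fin   = Any.there (Any.there (Any.here refl))
  ∈-colors bot   = Any.there (Any.there (Any.there (Any.here refl)))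
  ∈-colors (cel s) = Any.there (Any.there (Any.there (Any.there (∈-++⁺ˡ (∈-map⁺ cel (∈-syms s))))))
  ∈-colors (hd q s) = Any.there (Any.there (Any.there (Any.there (∈-++⁺ʳ (map cel syms)
    (∈-concatMap (λ q → map (hd q) syms ++ map (pend q) syms) (∈-allFin q) (∈-++⁺ˡ (∈-map⁺ (hd q) (∈-syms s))))))))
  ∈-colors (pend q s) = Any.there (Any.there (Any.there (Any.there (∈-++⁺ʳ (map cel syms)
    (∈-concatMap (λ q → map (hd q) syms ++ map (pend q) syms) (∈-allFin q) (∈-++⁺ʳ (map (hd q) syms) (∈-map⁺ (pend q) (∈-syms s))))))))

  idle done' : Tile
  idle  = tile (cel blank) (cel blank) (cel blank) (cel blank)
  done' = tile (cel blank) (cel blank) fin (cel blank)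

  tilesAt : Color → Color → List Tile
  tilesAt b l = map (λ o → tile b l (proj₁ o) (proj₂ o)) (opts b l)

  tilesOn : Color → List Tile
  tilesOn b = concatMap (tilesAt b) colors

  Valid : Tile → Set
  Valid τ = (above τ , ahead τ) ∈ opts (below τ) (behind τ)

  abstract
    allTiles : List Tile
    allTiles = concatMap tilesOn colors

    ∈-allTiles⁺ : ∀ {τ} → Valid τ → τ ∈ allTiles
    ∈-allTiles⁺ {τ} v = ∈-concatMap tilesOn (∈-colors (below τ)) (∈-concatMap (tilesAt (below τ)) (∈-colors (behind τ))
      (∈-map⁺ (λ o → tile (below τ) (behind τ) (proj₁ o) (proj₂ o)) v))

    ∈-allTiles⁻ : ∀ {τ} → τ ∈ allTiles → Valid τ
    ∈-allTiles⁻ m with find (∈-concatMap⁻ tilesOn {xs = colors} m)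
    ... | b , _ , m₁ with find (∈-concatMap⁻ (tilesAt b) {xs = colors} m₁)
    ...   | l , _ , m₂ with ∈-map⁻ (λ o → tile b l (proj₁ o) (proj₂ o)) m₂
    ...     | o , m₃ , refl = m₃

  -- idle is listed twice more, and done' once, so that the column totals visibly exceed the targets.
  tiles : List Tile
  tiles = idle ∷ idle ∷ done' ∷ allTiles

  valid-∈ : ∀ {τ} → Valid τ → τ ∈ tiles
  valid-∈ v = Any.there (Any.there (Any.there (∈-allTiles⁺ v)))

  ∈-valid : ∀ {τ} → τ ∈ tiles → Valid τ
  ∈-valid (Any.here refl)                         = Any.here refl
  ∈-valid (Any.there (Any.here refl))             = Any.here refl
  ∈-valid (Any.there (Any.there (Any.here refl))) = Any.there (Any.here refl)
  ∈-valid (Any.there (Any.there (Any.there m)))   = ∈-allTiles⁻ m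

  tbot tlft ttop trgt : Tile → ℕ
  tbot τ = code (below τ)
  tlft τ = code (behind τ)
  ttop τ = code (above τ)
  trgt τ = code (ahead τ)

  map-code-injective : ∀ {xs ys} → map code xs ≡ map code ys → xs ≡ ys
  map-code-injective {[]}     {[]}     e = refl
  map-code-injective {x ∷ xs} {y ∷ ys} e = cong₂ _∷_ (code-injective (proj₁ (∷-injective e))) (map-code-injective (proj₂ (∷-injective e)))

++-overlap : ∀ (us xs : List A) {ys vs} → xs ++ ys ≡ us ++ vs → length us ≤ length xs → ∃ λ zs → xs ≡ us ++ zs × vs ≡ zs ++ ys
++-overlap []       xs       e le = xs , refl , sym e
++-overlap (u ∷ us) (x ∷ xs) e (s≤s le) with ∷-injective e
... | refl , e' = let zs , e₁ , e₂ = ++-overlap us xs e' le in zs , cong (x ∷_) e₁ , e₂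

val-map-+ : ∀ β (f g : A → ℕ) {h : A → ℕ} → (∀ c → f c + g c ≡ h c) → ∀ cs → val β (map f cs) + val β (map g cs) ≡ val β (map h cs)
val-map-+ β f g e [] = refl
val-map-+ β f g e (c ∷ cs) = trans (lem (f c) (g c) β (val β (map f cs)) (val β (map g cs))) (cong₂ (λ a b → a + β * b) (e c) (val-map-+ β f g e cs))
  where
  lem : ∀ a b β c d → (a + β * c) + (b + β * d) ≡ (a + b) + β * (c + d)
  lem = solve-∀

val-replicate : ∀ β n x → val β (replicate n x) ≡ x * val β (replicate n 1)
val-replicate β zero    x = sym (*-zeroʳ x)
val-replicate β (suc n) x = trans (cong (λ v → x + β * v) (val-replicate β n x)) (lem x β (val β (replicate n 1)))
  where
  lem : ∀ x β v → x + β * (x * v) ≡ x * (1 + β * v)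
  lem = solve-∀

val-full : ∀ β n → 0 < β → suc (val β (replicate n (β ∸ 1))) ≡ β ^ n
val-full β zero    _ = refl
val-full (suc β) (suc n) p = trans (lem β (val (suc β) (replicate n β))) (cong (suc β *_) (val-full (suc β) n p))
  where
  lem : ∀ β v → suc (β + suc β * v) ≡ suc β * suc v
  lem = solve-∀

-- Since `e < 2 ^ e`, one inequality gives all that is asked of the base `B = 2 ^ e`: room for the
-- totals, for single colours, for 1 and for the number of tiles.
Wide : TM → ℕ → Set
Wide M e = length tiles * maxCode + length tiles * maxCode + (length tiles + (maxCode + 2)) ≤ e
  where open TileSet M

-- The blocks of the target: over the given initial row (the lowest block is first), over the later rows,
-- and beyond the last row.
data Class (Color : Set) : Set where
  first : Class Color
  pre   : Color → Class Color
  mid lastfirst last : Class Color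

module Numbers (M : TM) (e : ℕ) (wide : Wide M e) where
  open TileSet M public

  C B : ℕ
  C = maxCode
  B = 2 ^ e

  private
    fits : ∀ {m} → m < e → m < B
    fits m<e = <-≤-trans m<e (n≤2^n e)
    NC : ℕ
    NC = length tiles * C + length tiles * C
    room : NC < B
    room = fits (≤-trans (≤-trans (≤-reflexive (+-comm 1 NC)) (+-monoʳ-≤ NC (≤-trans (s≤s z≤n) (m≤m+n (length tiles) (C + 2))))) wide)
    C<B : C < B
    C<B = fits (≤-trans (≤-trans (≤-trans (n≤1+n _) (≤-reflexive (+-comm 2 C))) (m≤n+m (C + 2) (length tiles))) (≤-trans (m≤n+m _ NC) wide))
    1<B : 1 < B
    1<B = fits (≤-trans (≤-trans (m≤n+m 2 C) (m≤n+m (C + 2) (length tiles))) (≤-trans (m≤n+m _ NC) wide))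
    N<B : length tiles < B
    N<B = fits (≤-trans (≤-trans (≤-reflexive (+-comm 1 (length tiles))) (+-monoʳ-≤ (length tiles) (≤-trans (s≤s z≤n) (m≤n+m 2 C)))) (≤-trans (m≤n+m _ NC) wide))

  open Tiling tbot tlft ttop trgt tiles C B (λ τ → code-≤ (below τ)) (λ τ → code-≤ (behind τ)) (λ τ → code-≤ (above τ)) (λ τ → code-≤ (ahead τ)) room C<B 1<B N<B public

  w : ℕ
  w = e + (e + e)

  β-pow : 2 ^ w ≡ β
  β-pow = trans (^-distribˡ-+-* 2 e (e + e)) (cong (B *_) (^-distribˡ-+-* 2 e e))

  dig : ℕ → ℕ → ℕ → ℕ
  dig h v c = h + B * (v + B * c)

  dig-< : ∀ {h v c} → h < B → v < B → c < B → dig h v c < β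
  dig-< {h} {v} {c} h< v< c< = place< h< (place< v< c<)
    where
    place< : ∀ {a x y} → a < B → x < y → a + B * x < B * y
    place< {a} {x} {y} a< x< = <-≤-trans (+-monoˡ-< (B * x) a<) (≤-trans (≤-reflexive (sym (*-suc B x))) (*-monoʳ-≤ B x<))

  dig-≤ : ∀ {h v c h' v' c'} → h ≤ h' → v ≤ v' → c ≤ c' → dig h v c ≤ dig h' v' c'
  dig-≤ a b c = +-mono-≤ a (*-monoʳ-≤ B (+-mono-≤ b (*-monoʳ-≤ B c)))

  private
    ΣL ΣB ΣR ΣT : ℕ
    ΣL = sumBy cl tiles
    ΣB = sumBy cb tiles
    ΣR = sumBy trgt tiles
    ΣT = sumBy ttop tiles

    small : (f : Tile → ℕ) → (∀ τ → f τ ≤ C) → sumBy f tiles ≤ length tiles * C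
    small f f≤ = sumBy-≤ tiles (tabulateAll λ {τ} _ → f≤ τ)
    L≤ : ΣL ≤ N * C
    L≤ = small cl (λ τ → m∸n≤m C (tlft τ))
    B≤ : ΣB ≤ N * C
    B≤ = small cb (λ τ → m∸n≤m C (tbot τ))
    R≤ : ΣR ≤ N * C
    R≤ = small trgt (λ τ → code-≤ (ahead τ))
    T≤ : ΣT ≤ N * C
    T≤ = small ttop (λ τ → code-≤ (above τ))
    half : ∀ {m} → m ≤ N * C → m < B
    half le = ≤-<-trans (≤-trans le (m≤m+n (N * C) (N * C))) room
    both : ∀ {m n} → m ≤ N * C → n ≤ N * C → m + n < B
    both l r = ≤-<-trans (+-mono-≤ l r) room

  -- tB are the blocks of the sum of a valid tiling and uB those of the sum over all tiles.  The two fixed demands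
  -- complement them: p + t and q + (u - t) have the digit β - 1 in every block but the lowest, where it is β, so
  -- that both sums are powers of two.
  tB uB full pB qB : Class Color → ℕ
  tB first     = dig C C 0
  tB (pre c)   = dig C (C ∸ code c) 0
  tB mid       = dig C C 1
  tB lastfirst = dig 0 (code fin) 1
  tB last      = dig 0 (code fin) 1
  uB first     = dig ΣL ΣB 0
  uB (pre c)   = dig (ΣL + ΣR) ΣB 0
  uB mid       = dig (ΣL + ΣR) (ΣB + ΣT) N
  uB lastfirst = dig ΣR ΣT N
  uB last      = dig 0 ΣT N
  full first   = β
  full _       = β ∸ 1
  pB c = full c ∸ tB c
  qB c = full c + tB c ∸ uB c

  private
    0<B : 0 < B
    0<B = <-trans (s≤s z≤n) 1<B
    C≤ΣL : C + 1 ≤ ΣL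
    C≤ΣL = ≤-trans (+-monoʳ-≤ C {1} (s≤s z≤n)) (+-monoʳ-≤ C (m≤m+n C _))
    C≤ΣL' : C ≤ ΣL
    C≤ΣL' = m≤m+n C _
    C≤ΣB : C ≤ ΣB
    C≤ΣB = m≤m+n C _
    1≤N : 1 ≤ N
    1≤N = s≤s z≤n
    fin≤ΣT : code fin ≤ ΣT
    fin≤ΣT = sumBy-∈ ttop {tiles} {done'} (Any.there (Any.there (Any.here refl)))

    t≤u : ∀ c → tB c ≤ uB c
    t≤u first     = dig-≤ C≤ΣL' C≤ΣB z≤n
    t≤u (pre c)   = dig-≤ {C} {C ∸ code c} (≤-trans C≤ΣL' (m≤m+n ΣL ΣR)) (≤-trans (m∸n≤m C (code c)) C≤ΣB) z≤n
    t≤u mid       = dig-≤ (≤-trans C≤ΣL' (m≤m+n ΣL ΣR)) (≤-trans C≤ΣB (m≤m+n ΣB ΣT)) 1≤N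
    t≤u lastfirst = dig-≤ {0} {code fin} {1} {ΣR} z≤n fin≤ΣT 1≤N
    t≤u last      = dig-≤ {0} {code fin} {1} {0} z≤n fin≤ΣT 1≤N

    u<β : ∀ c → uB c < β
    u<β first     = dig-< (half L≤) (half B≤) 0<B
    u<β (pre c)   = dig-< (both L≤ R≤) (half B≤) 0<B
    u<β mid       = dig-< (both L≤ R≤) (both B≤ T≤) N<B
    u<β lastfirst = dig-< (half R≤) (half T≤) N<B
    u<β last      = dig-< 0<B (half T≤) N<B

    β>0 : 0 < β
    β>0 = ≤-<-trans z≤n (u<β mid)

    <⇒≤∸1 : ∀ {m n} → m < n → m ≤ n ∸ 1
    <⇒≤∸1 (s≤s le) = le

    u≤full : ∀ c → uB c ≤ full c
    u≤full first     = <⇒≤ (u<β first)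
    u≤full (pre c)   = <⇒≤∸1 (u<β (pre c))
    u≤full mid       = <⇒≤∸1 (u<β mid)
    u≤full lastfirst = <⇒≤∸1 (u<β lastfirst)
    u≤full last      = <⇒≤∸1 (u<β last)

    -- Strictness matters because `full first` is β itself: with equality the digit of q would be β.
    -- It comes from the two copies of `idle` at the head of the list, each adding `C` to the total
    -- of the left complements.
    tu-first : tB first < uB first
    tu-first = ≤-trans (≤-reflexive (lem C (B * (C + B * 0)))) (dig-≤ {C + 1} {C} {0} C≤ΣL C≤ΣB z≤n)
      where
      lem : ∀ c x → suc (c + x) ≡ c + 1 + x
      lem = solve-∀

    pred< : ∀ {n} → 0 < n → n ∸ 1 < n
    pred< (s≤s z≤n) = ≤-refl

  p+t : ∀ c → pB c + tB c ≡ full c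
  p+t c = m∸n+n≡m (≤-trans (t≤u c) (u≤full c))

  q+u : ∀ c → qB c + uB c ≡ full c + tB c
  q+u c = m∸n+n≡m (≤-trans (u≤full c) (m≤m+n (full c) (tB c)))

  p<β : ∀ c → pB c < β
  p<β first     = ∸-monoʳ-< {β} {tB first} {0} (≤-<-trans z≤n (≤-trans (≤-reflexive (+-comm 1 0)) C>0)) (≤-trans (t≤u first) (u≤full first))
    where
    C>0 : 0 < tB first
    C>0 = ≤-trans (s≤s z≤n) (m≤m+n C _)
  p<β (pre c)   = ≤-<-trans (m∸n≤m (β ∸ 1) (tB (pre c))) (pred< β>0)
  p<β mid       = ≤-<-trans (m∸n≤m (β ∸ 1) (tB mid)) (pred< β>0)
  p<β lastfirst = ≤-<-trans (m∸n≤m (β ∸ 1) (tB lastfirst)) (pred< β>0)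
  p<β last      = ≤-<-trans (m∸n≤m (β ∸ 1) (tB last)) (pred< β>0)

  q<β : ∀ c → qB c < β
  q<β first = +-cancelʳ-< (uB first) _ _ (subst (_< β + uB first) (sym (q+u first)) (+-monoʳ-< β tu-first))
  q<β (pre c)   = ≤-<-trans (∸-≤ (t≤u (pre c))) (pred< β>0)
    where
    ∸-≤ : ∀ {a t u} → t ≤ u → a + t ∸ u ≤ a
    ∸-≤ {a} {t} {u} le = ≤-trans (∸-monoʳ-≤ (a + t) le) (≤-reflexive (m+n∸n≡m a t))
  q<β mid       = ≤-<-trans (≤-trans (∸-monoʳ-≤ (β ∸ 1 + tB mid) (t≤u mid)) (≤-reflexive (m+n∸n≡m (β ∸ 1) (tB mid)))) (pred< β>0)
  q<β lastfirst = ≤-<-trans (≤-trans (∸-monoʳ-≤ (β ∸ 1 + tB lastfirst) (t≤u lastfirst)) (≤-reflexive (m+n∸n≡m (β ∸ 1) (tB lastfirst)))) (pred< β>0)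
  q<β last      = ≤-<-trans (≤-trans (∸-monoʳ-≤ (β ∸ 1 + tB last) (t≤u last)) (≤-reflexive (m+n∸n≡m (β ∸ 1) (tB last)))) (pred< β>0)

  -- Blocks s and s + 1, then `z` zero blocks, then the top colour in the middle digit of block s +
  -- P, where P is `2 + z`. The unit digit above it is not written: it is the implicit leading one
  -- of the numeral. The first `true` yields the factor 2 that the items share with p and q.
  itemBits : ℕ → ℕ → Tile → List Bool
  itemBits z s τ = true ∷ blk w (replicate s 0 ++ (cl τ + B * cb τ) ∷ trgt τ ∷ replicate z 0) ++ bits (e + e) (B * ttop τ)

  item-value : ∀ z s τ → bval (itemBits z s τ) ≡ 2 * (β ^ s * Period.K (2 + z) τ)
  item-value z s τ = trans (bval-true (blk w blocks ++ tp)) (cong (2 *_) (trans (cong₂ _+_ len-eq num-eq)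
      (lem (β ^ s) β (β ^ z) B (cl τ + B * cb τ) (trgt τ) (ttop τ))))
    where
    blocks = replicate s 0 ++ (cl τ + B * cb τ) ∷ trgt τ ∷ replicate z 0
    tp = bits (e + e) (B * ttop τ)
    β^blocks : 2 ^ length (blk w blocks) ≡ β ^ s * (β * (β * β ^ z))
    β^blocks = trans (cong (2 ^_) (trans (length-blk w blocks) (*-comm (length blocks) w))) (trans (sym (^-*-assoc 2 w (length blocks)))
      (trans (cong (_^ length blocks) β-pow) (trans (cong (β ^_) (trans (length-++ (replicate s 0)) (cong₂ (λ a b → a + (2 + b)) (length-replicate s) (length-replicate z))))
        (^-distribˡ-+-* β s (2 + z)))))
    len-eq : 2 ^ length (blk w blocks ++ tp) ≡ β ^ s * (β * (β * β ^ z)) * (B * B)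
    len-eq = trans (cong (2 ^_) (length-++ (blk w blocks))) (trans (^-distribˡ-+-* 2 (length (blk w blocks)) (length tp))
      (cong₂ _*_ β^blocks (trans (cong (2 ^_) (length-bits (e + e) _)) (^-distribˡ-+-* 2 e e))))
    low : (cl τ + B * cb τ) < β
    low = subst (_< β) (cong (λ v → cl τ + B * v) (trans (cong (cb τ +_) (*-zeroʳ B)) (+-identityʳ (cb τ))))
      (dig-< {cl τ} {cb τ} {0} (≤-<-trans (m∸n≤m C (tlft τ)) C<B) (≤-<-trans (m∸n≤m C (tbot τ)) C<B) 0<B)
    fitting : All (_< 2 ^ w) blocks
    fitting = subst (λ b → All (_< b) blocks) (sym β-pow) (zeros s (low ∷ (≤-<-trans (code-≤ (ahead τ)) (<-≤-trans C<B B≤β)) ∷ zeros' z))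
      where
      B≤β : B ≤ β
      B≤β = ≤-trans (≤-reflexive (sym (*-identityʳ B))) (*-monoʳ-≤ B (*-mono-≤ 0<B 0<B))
      zeros' : ∀ n → All (_< β) (replicate n 0)
      zeros' zero    = []
      zeros' (suc n) = β>0 ∷ zeros' n
      zeros : ∀ n {xs} → All (_< β) xs → All (_< β) (replicate n 0 ++ xs)
      zeros zero    a = a
      zeros (suc n) a = β>0 ∷ zeros n a
    val-eq : val β blocks ≡ β ^ s * (cl τ + B * cb τ + β * (trgt τ + β * 0))
    val-eq = trans (val-++ β (replicate s 0) _) (cong₂ _+_ (val-zeros β s) (cong₂ (λ a b → β ^ a * (cl τ + B * cb τ + β * (trgt τ + β * b))) (length-replicate s) (val-zeros β z)))
    num-eq : num (blk w blocks ++ tp) ≡ β ^ s * (cl τ + B * cb τ + β * (trgt τ + β * 0)) + β ^ s * (β * (β * β ^ z)) * (B * ttop τ)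
    num-eq = trans (num-++ (blk w blocks) tp) (cong₂ _+_ (trans (num-blk w blocks fitting) (trans (cong (λ b → val b blocks) β-pow) val-eq))
      (cong₂ _*_ β^blocks (num-bits (e + e) (B * ttop τ) (<-≤-trans (*-monoʳ-< B {{>-nonZero 0<B}} (≤-<-trans (code-≤ (above τ)) C<B)) (≤-reflexive (sym (^-distribˡ-+-* 2 e e)))))))
    lem : ∀ p β q B a r t → p * (β * (β * q)) * (B * B) + (p * (a + β * (r + β * 0)) + p * (β * (β * q)) * (B * t)) ≡ p * (a + β * r + β * (β * q) * (B * t + B * B))
    lem = solve-∀

  blocks-value : ∀ (f : Class Color → ℕ) cs → (∀ c → f c < β) → bval (true ∷ blk w (map f cs)) ≡ 2 * (β ^ length cs + val β (map f cs))
  blocks-value f cs f< = trans (bval-true (blk w (map f cs))) (cong (2 *_) (cong₂ _+_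
    (trans (cong (2 ^_) (trans (length-blk w (map f cs)) (trans (*-comm (length (map f cs)) w) (cong (w *_) (length-map f cs)))))
      (trans (sym (^-*-assoc 2 w (length cs))) (cong (_^ length cs) β-pow)))
    (trans (num-blk w (map f cs) (subst (λ b → All (_< b) (map f cs)) (sym β-pow) (every cs))) (cong (λ b → val b (map f cs)) β-pow))))
    where
    every : ∀ cs → All (_< β) (map f cs)
    every []       = []
    every (c ∷ cs) = f< c ∷ every cs

  -- With `H = 4 * β ^ j`, twice the square of `H` is `32 * β ^ (2 * j)`. The first five digits
  -- supply `2 ^ 5`, and each group of `w + w` zeros a factor `β * β`.
  boundBits : ℕ → List Bool
  boundBits j = true ∷ false ∷ false ∷ false ∷ false ∷ times j (replicate (w + w) false)

  times-false : ∀ j n → num (times j (replicate n false)) ≡ 0 × length (times j (replicate n false)) ≡ j * n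
  times-false zero    n = refl , refl
  times-false (suc j) n = let e₁ , e₂ = times-false j n in
    trans (num-++ (replicate n false) _) (trans (cong₂ (λ a b → a + 2 ^ length (replicate n false) * b) (num-zeros n) e₁) (*-zeroʳ (2 ^ length (replicate n false)))) ,
    trans (length-++ (replicate n false)) (cong₂ _+_ (length-replicate n) e₂)

  bound-value : ∀ j → let H = 2 * (β ^ j + β ^ j) in bval (boundBits j) ≡ H * H + H * H
  bound-value j = trans (bval-true zs) (trans (cong₂ (λ a b → 2 * (2 ^ (4 + a) + 2 * (2 * (2 * (2 * b))))) (proj₂ (times-false j (w + w))) (proj₁ (times-false j (w + w))))
      (trans (lem₁ (2 ^ (j * (w + w)))) (trans (cong (λ v → 32 * v) pow) (lem₂ (β ^ j)))))
    where
    zs = false ∷ false ∷ false ∷ false ∷ times j (replicate (w + w) false)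
    lem₁ : ∀ x → 2 * (2 * (2 * (2 * (2 * x))) + 2 * (2 * (2 * (2 * 0)))) ≡ 32 * x
    lem₁ = solve-∀
    lem₂ : ∀ x → 32 * (x * x) ≡ 2 * (x + x) * (2 * (x + x)) + 2 * (x + x) * (2 * (x + x))
    lem₂ = solve-∀
    pow : 2 ^ (j * (w + w)) ≡ β ^ j * β ^ j
    pow = trans (cong (2 ^_) (lem₃ j w)) (trans (^-distribˡ-+-* 2 (w * j) (w * j)) (cong (λ v → v * v) (trans (sym (^-*-assoc 2 w j)) (cong (_^ j) β-pow))))
      where
      lem₃ : ∀ j w → j * (w + w) ≡ w * j + w * j
      lem₃ = solve-∀

-- Histories, tilings and the instance

sum-zeros : ∀ n → sumBy bval (replicate n []) ≡ 0
sum-zeros zero    = refl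
sum-zeros (suc n) = sum-zeros n

module Partition (M : TM) (e : ℕ) (wide : Wide M e)
  (x : List Bool) (W T : ℕ) where
  open Numbers M e wide public

  -- Splitting off two cells gives the row length the form `2 + z`, so that blocks s, s + 1 and s +
  -- P of an item are distinct, with `z` blocks between the last two.
  init₂ : List Color
  -- Two blanks for each of the `T` steps and two for the pass that places the head.
  init₂ = map cel (known x) ++ cel b0 ∷ cel b1 ∷ wits W ++ map cel (replicate (suc (suc (T * 2))) blank)

  init : List Color
  init = cel blank ∷ start ∷ init₂

  z P R : ℕ
  z = length init₂
  P = 2 + z
  R = suc T * P

  private
    codes≤ : ∀ cs → All (_≤ C) (map code cs)
    codes≤ []       = []
    codes≤ (c ∷ cs) = code-≤ c ∷ codes≤ cs

  open Period P public hiding (T; module Items; module Target)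
  open Period.Items P bval (itemBits z) (item-value z) public
  open Period.Target P R (code fin) (code-≤ fin) (map code init) (length-map code init) (codes≤ init) (s≤s z≤n) public

  History : Set
  History = ∃ λ X → length X ≡ suc T * P × Pass (cel blank) (init ++ X) (X ++ fins P) (cel blank)

  private
    map-codes : ∀ {A : Set} (f : A → Color) xs → map (code ∘ f) xs ≡ map code (map f xs)
    map-codes f xs = map-∘ xs

    fins-code : ∀ n → replicate n (code fin) ≡ map code (fins n)
    fins-code n = sym (map-replicate code n fin)

    cons-pass : ∀ τ {l bs ts r} → behind τ ≡ l → Valid τ → Pass (ahead τ) bs ts r → Pass l (below τ ∷ bs) (above τ ∷ ts) r
    cons-pass τ refl v p = v ∷ p

    chain-pass : ∀ τs l → All (_∈ tiles) τs → HChain (code l) τs → Pass l (map below τs) (map above τs) (cel blank)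
    chain-pass []       l []       ch = subst (λ r → Pass l [] [] r) (code-injective {l} {cel blank} ch) []
    chain-pass (τ ∷ τs) l (m ∷ ms) (e₁ , ch) = cons-pass τ (code-injective {behind τ} {l} e₁) (∈-valid m) (chain-pass τs (ahead τ) ms ch)

    pass-chain : ∀ {l bs ts r} → Pass l bs ts r → r ≡ cel blank →
      ∃ λ τs → All (_∈ tiles) τs × HChain (code l) τs × map below τs ≡ bs × map above τs ≡ ts
    pass-chain [] refl = [] , [] , refl , refl , refl
    pass-chain (_∷_ {b} {l} {t} {l'} o p) eq = let τs , ms , ch , e₁ , e₂ = pass-chain p eq in
      tile b l t l' ∷ τs , valid-∈ o ∷ ms , (refl , ch) , cong (b ∷_) e₁ , cong (t ∷_) e₂

  solved-history : ∀ {τs} → Solved τs → History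
  solved-history {τs} sol = X , lenX , subst₂ (λ u v → Pass (cel blank) u v (cel blank)) e₁ e₂ (chain-pass τs (cel blank) (Solved.known sol) (Solved.horiz sol))
    where
    eq : map below τs ++ fins P ≡ init ++ map above τs
    eq = map-code-injective (trans (map-++ code (map below τs) (fins P)) (trans (cong₂ _++_ (sym (map-codes below τs)) (sym (fins-code P)))
      (trans (Solved.vert sol) (trans (cong (map code init ++_) (map-codes above τs)) (sym (map-++ code init (map above τs)))))))
    len-b : length (map below τs) ≡ P + R
    len-b = trans (length-map below τs) (Solved.long sol)
    parts = ++-overlap init (map below τs) eq (subst (P ≤_) (sym len-b) (m≤m+n P R))
    X = proj₁ parts
    e₁ = proj₁ (proj₂ parts)
    e₂ = proj₂ (proj₂ parts)
    lenX : length X ≡ suc T * P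
    lenX = +-cancelˡ-≡ P _ _ (trans (sym (length-++ init)) (trans (cong length (sym e₁)) len-b))

  history-solved : History → ∃ Solved
  history-solved (X , lenX , p) = let τs , ms , ch , e₁ , e₂ = pass-chain p refl in τs , record
    { long = trans (sym (length-map below τs)) (trans (cong length e₁) (trans (length-++ init) (cong (P +_) lenX)))
    ; known = ms ; horiz = ch
    ; vert = trans (cong₂ _++_ (trans (map-codes below τs) (cong (map code) e₁)) (fins-code P))
        (trans (sym (map-++ code (init ++ X) (fins P))) (trans (cong (map code) (++-assoc init X (fins P)))
          (trans (map-++ code init (X ++ fins P)) (cong (map code init ++_) (trans (cong (map code) (sym e₂)) (sym (map-codes above τs))))))) }

  cls : List (Class Color)
  cls = first ∷ map pre (start ∷ init₂) ++ replicate R mid ++ lastfirst ∷ replicate (suc z) last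

  J' : ℕ
  J' = length cls

  private
    tH tV tC : Class Color → ℕ
    tH first = C
    tH (pre _) = C
    tH mid = C
    tH lastfirst = 0
    tH last = 0
    tV first = C
    tV (pre c) = C ∸ code c
    tV mid = C
    tV lastfirst = code fin
    tV last = code fin
    tC first = 0
    tC (pre _) = 0
    tC mid = 1
    tC lastfirst = 1
    tC last = 1

    tB-dig : ∀ c → tB c ≡ dig (tH c) (tV c) (tC c)
    tB-dig first     = refl
    tB-dig (pre _)   = refl
    tB-dig mid       = refl
    tB-dig lastfirst = refl
    tB-dig last      = refl

    val-dig : ∀ cs → val β (map tB cs) ≡ val β (map tH cs) + B * (val β (map tV cs) + B * val β (map tC cs))
    val-dig [] = sym (lem B)
      where
      lem : ∀ B → 0 + B * (0 + B * 0) ≡ 0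
      lem = solve-∀
    val-dig (c ∷ cs) = trans (cong₂ (λ a b → a + β * b) (tB-dig c) (val-dig cs)) (lem B β (tH c) (tV c) (tC c) (val β (map tH cs)) (val β (map tV cs)) (val β (map tC cs)))
      where
      lem : ∀ B β h v c hs vs cs → h + B * (v + B * c) + β * (hs + B * (vs + B * cs)) ≡ h + β * hs + B * (v + β * vs + B * (c + β * cs))
      lem = solve-∀

    cls-map : ∀ (f : Class Color → ℕ) (g : ℕ → ℕ) m l → f first ≡ g 0 → (∀ c → f (pre c) ≡ g (code c)) → f mid ≡ m → f lastfirst ≡ l → f last ≡ l →
      map f cls ≡ map g (map code init) ++ replicate R m ++ replicate P l
    cls-map f g m l e₁ e₂ e₃ e₄ e₅ = cong₂ _∷_ e₁ (trans (map-++ f (map pre (start ∷ init₂)) _) (cong₂ _++_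
      (trans (sym (map-∘ (start ∷ init₂))) (trans (map-cong e₂ (start ∷ init₂)) (map-∘ (start ∷ init₂))))
      (trans (map-++ f (replicate R mid) _) (cong₂ _++_ (trans (map-replicate f R mid) (cong (replicate R) e₃))
        (cong₂ _∷_ e₄ (trans (map-replicate f (suc z) last) (cong (replicate (suc z)) e₅)))))))

  target-value : val β (map tB cls) ≡ target
  target-value = trans (val-dig cls) (cong₂ (λ a b → a + B * b) (cong (val β) (cls-map tH (λ _ → C) C 0 refl (λ _ → refl) refl refl refl))
    (cong₂ (λ a b → a + B * b) (cong (val β) (cls-map tV (C ∸_) C (code fin) refl (λ _ → refl) refl refl refl))
      (cong (val β) (cls-map tC (λ _ → 0) 1 1 refl (λ _ → refl) refl refl refl))))

  full-value : val β (map full cls) ≡ β ^ J'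
  full-value = trans (cong (λ l → β + β * val β l) rest-full)
    (trans (sym (*-suc β (val β (replicate (length tl) (β ∸ 1))))) (cong (β *_) (val-full β (length tl) β>0')))
    where
    tl = map pre (start ∷ init₂) ++ replicate R mid ++ lastfirst ∷ replicate (suc z) last
    β>0' : 0 < β
    β>0' = ≤-<-trans z≤n (p<β mid)
    consts : ∀ cs → All (λ c → full c ≡ β ∸ 1) cs → map full cs ≡ replicate (length cs) (β ∸ 1)
    consts []       []       = refl
    consts (c ∷ cs) (p ∷ ps) = cong₂ _∷_ p (consts cs ps)
    pres : ∀ xs {ys} → All (λ c → full c ≡ β ∸ 1) ys → All (λ c → full c ≡ β ∸ 1) (map pre xs ++ ys)
    pres []       a = a
    pres (x ∷ xs) a = refl ∷ pres xs a
    reps : ∀ n c {ys} → full c ≡ β ∸ 1 → All (λ c → full c ≡ β ∸ 1) ys → All (λ c → full c ≡ β ∸ 1) (replicate n c ++ ys)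
    reps zero    c p a = a
    reps (suc n) c p a = p ∷ reps n c p a
    rest-full : map full tl ≡ replicate (length tl) (β ∸ 1)
    rest-full = consts tl (pres (start ∷ init₂) (reps R mid refl (refl ∷ subst (All _) (++-identityʳ _) (reps (suc z) last refl []))))

  ones-+ : ∀ a b → ones (a + b) ≡ ones a + β ^ a * ones b
  ones-+ a b = trans (cong (val β) (sym (replicate-++ a b))) (trans (val-++ β (replicate a 1) (replicate b 1)) (cong (λ n → ones a + β ^ n * ones b) (length-replicate a)))

  -- This counts what all tiles at all places put into each block. The lowest block gets no right
  -- colours and blocks below P no tops or units; block P + R gets right colours but no left or
  -- bottom ones, and the blocks above it only tops and units.
  all-value : val β (map uB cls) ≡ ΣK tiles * ones (P + R)
  all-value = trans expand
    (trans (alg B β (β ^ n₁) (β ^ R) (ones n₁) (ones R) (sumBy cl tiles) (sumBy cb tiles) (sumBy trgt tiles) (sumBy ttop tiles) N)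
      (sym (trans (cong (_* ones (P + R)) ΣK-split)
        (spread (sumBy cl tiles + B * sumBy cb tiles) (β * sumBy trgt tiles) (β * β ^ n₁ * (B * sumBy ttop tiles + B * B * N)) _ _ _ _ o₁ o₂ o₃))))
    where
    n₁ = suc z
    len-pre : length (map uB (map pre (start ∷ init₂))) ≡ n₁
    len-pre = trans (length-map uB (map pre (start ∷ init₂))) (length-map pre (start ∷ init₂))
    pre-part : val β (map uB (map pre (start ∷ init₂))) ≡ dig (sumBy cl tiles + sumBy trgt tiles) (sumBy cb tiles) 0 * ones n₁
    pre-part = trans (cong (val β) (trans (sym (map-∘ (start ∷ init₂))) (map-const (dig (sumBy cl tiles + sumBy trgt tiles) (sumBy cb tiles) 0) (start ∷ init₂)))) (val-replicate β n₁ _)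
    ends-part : val β (map uB (lastfirst ∷ replicate (suc z) last)) ≡ uB lastfirst + β * (uB last * ones n₁)
    ends-part = cong (λ v → uB lastfirst + β * v) (trans (cong (val β) (map-replicate uB (suc z) last)) (val-replicate β n₁ (uB last)))
    mid-part : val β (map uB (replicate R mid ++ lastfirst ∷ replicate (suc z) last)) ≡ uB mid * ones R + β ^ R * (uB lastfirst + β * (uB last * ones n₁))
    mid-part = trans (cong (val β) (map-++ uB (replicate R mid) _)) (trans (val-++ β (map uB (replicate R mid)) _)
      (cong₂ _+_ (trans (cong (val β) (map-replicate uB R mid)) (val-replicate β R (uB mid)))
        (cong₂ (λ n v → β ^ n * v) (trans (length-map uB (replicate R mid)) (length-replicate R)) ends-part)))
    expand : val β (map uB cls) ≡ uB first + β * (uB (pre start) * ones n₁ + β ^ n₁ * (uB mid * ones R + β ^ R * (uB lastfirst + β * (uB last * ones n₁))))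
    expand = cong (λ v → uB first + β * v) (trans (cong (val β) (map-++ uB (map pre (start ∷ init₂)) _))
      (trans (val-++ β (map uB (map pre (start ∷ init₂))) _) (cong₂ _+_ pre-part (cong₂ (λ n v → β ^ n * v) len-pre mid-part))))
    ΣK-split : ΣK tiles ≡ (sumBy cl tiles + B * sumBy cb tiles) + β * sumBy trgt tiles + β * β ^ n₁ * (B * sumBy ttop tiles + B * B * N)
    ΣK-split = lem B β (β * β ^ n₁) (sumBy cl tiles) (sumBy cb tiles) (sumBy trgt tiles) (sumBy ttop tiles) N
      where
      lem : ∀ B β p l b r t n → l + β * r + B * (b + p * t) + B * B * (p * n) ≡ (l + B * b) + β * r + p * (B * t + B * B * n)
      lem = solve-∀
    -- Three splittings of the same repunit, one for each offset at which a place contributes: 0, 1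
    -- and P.
    o₁ : ones (P + R) ≡ 1 + β * (ones n₁ + β ^ n₁ * ones R)
    o₁ = cong (λ v → 1 + β * v) (ones-+ n₁ R)
    o₂ : ones (P + R) ≡ ones n₁ + β ^ n₁ * (ones R + β ^ R * (1 + β * 0))
    o₂ = trans (cong ones (lem n₁ R)) (trans (ones-+ n₁ (R + 1)) (cong (λ v → ones n₁ + β ^ n₁ * v) (ones-+ R 1)))
      where
      lem : ∀ a b → suc a + b ≡ a + (b + 1)
      lem = solve-∀
    o₃ : ones (P + R) ≡ ones R + β ^ R * (1 + β * ones n₁)
    o₃ = trans (cong ones (+-comm P R)) (ones-+ R P)
    spread : ∀ α ρ γ o a b c → o ≡ a → o ≡ b → o ≡ c → (α + ρ + γ) * o ≡ α * a + ρ * b + γ * c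
    spread α ρ γ o .o .o .o refl refl refl = lem α ρ γ o
      where
      lem : ∀ α ρ γ o → (α + ρ + γ) * o ≡ α * o + ρ * o + γ * o
      lem = solve-∀
    alg : ∀ B β A D x y l b r t n →
      (l + B * (b + B * 0)) + β * ((l + r + B * (b + B * 0)) * x + A * ((l + r + B * (b + t + B * n)) * y + D * ((r + B * (t + B * n)) + β * ((0 + B * (t + B * n)) * x)))) ≡
      (l + B * b) * (1 + β * (x + A * y)) + β * r * (x + A * (y + D * (1 + β * 0))) + β * A * (B * t + B * B * n) * (y + D * (1 + β * x))
    alg = solve-∀

  pBits qBits : List Bool
  pBits = true ∷ blk w (map pB cls)
  qBits = true ∷ blk w (map qB cls)

  -- One `β ^ J'` is the implicit leading one of `pBits` and `qBits`; the other is the sum of their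
  -- complementary digits, by `full-value`. The factor 2 is the one common to p, q and the items.
  H : ℕ
  H = 2 * (β ^ J' + β ^ J')

  p-value : bval pBits + 2 * target ≡ H
  p-value = trans (cong₂ (λ a b → a + 2 * b) (blocks-value pB cls p<β) (sym target-value))
    (trans (lem (β ^ J') (val β (map pB cls)) (val β (map tB cls))) (cong (λ v → 2 * (β ^ J' + v)) (trans (val-map-+ β pB tB p+t cls) full-value)))
    where
    lem : ∀ a b c → 2 * (a + b) + 2 * c ≡ 2 * (a + (b + c))
    lem = solve-∀

  -- If a subset of the items has sum `2 * target`, the remaining items amount to what q lacks to
  -- `H`. So both sides balance as soon as the side of p does.
  q-value : bval qBits + sumBy bval (upTo (P + R)) ≡ H + 2 * target
  q-value = trans (cong₂ _+_ (blocks-value qB cls q<β) (trans (cong (sumBy bval) (upTo-items (P + R))) (trans (sum-items (P + R) 0) (cong (λ v → 2 * (1 * v)) (sym all-value)))))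
    (trans (lem₁ (β ^ J') (val β (map qB cls)) (val β (map uB cls)))
      (trans (cong (λ v → 2 * (β ^ J' + v)) (trans (val-map-+ β qB uB q+u cls) (trans (sym (val-map-+ β full tB (λ _ → refl) cls)) (cong₂ _+_ full-value target-value)))) (lem₂ (β ^ J') target)))
    where
    lem₁ : ∀ a b c → 2 * (a + b) + 2 * (1 * c) ≡ 2 * (a + (b + c))
    lem₁ = solve-∀
    lem₂ : ∀ a t → 2 * (a + (a + t)) ≡ 2 * (a + a) + 2 * t
    lem₂ = solve-∀

  -- Items of demand 0 leave the attainable sums unchanged. They allow the number of columns to be
  -- rounded up to a power of two, which the program can write easily.
  module Padded (pads : ℕ) (i : List Bool) (is : List (List Bool)) (its≡ : replicate pads [] ++ upTo (P + R) ≡ i ∷ is) where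

    its : List (List Bool)
    its = i ∷ is

    open Grid {length is} (bval pBits) (bval qBits) (λ j → bval (lookup its j)) using (r; dem; res; forward; module Conv)

    inst : List Bool → Instance
    inst bb = record { k = suc (length is) ; root = r ; demand = dem ; resist = res ; bound = bval bb }

    private
      total : sumBy bval its ≡ sumBy bval (upTo (P + R))
      total = trans (cong (sumBy bval) (sym its≡)) (trans (cong sum (map-++ bval (replicate pads []) _)) (trans (sum-++ (map bval (replicate pads [])) _) (cong (_+ sumBy bval (upTo (P + R))) (sum-zeros pads))))

      balance : bval pBits + (bval qBits + S (λ j → bval (lookup its j))) ≡ H + H
      balance = trans (cong (λ v → bval pBits + (bval qBits + v)) (trans (sum-S bval its) total)) (trans (cong (bval pBits +_) q-value)
        (trans (lem (bval pBits) H (2 * target)) (cong (_+ H) p-value)))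
        where
        lem : ∀ p h t → p + (h + t) ≡ p + t + h
        lem = solve-∀

      H>0 : 0 < H
      H>0 = <-≤-trans (s≤s z≤n) (subst (bval pBits ≤_) p-value (m≤m+n (bval pBits) (2 * target)))

      sub-pads : ∀ n {ys m} → Sub bval (replicate n [] ++ ys) m → Sub bval ys m
      sub-pads zero    s        = s
      sub-pads (suc n) (take s) = sub-pads n s
      sub-pads (suc n) (drop s) = sub-pads n s

      loss-bound : bval (boundBits J') ≡ H * H + H * H
      loss-bound = bound-value J'

    private
      solution-subset : ∀ τs → Solved τs → Sub bval its (2 * target)
      solution-subset τs sol = subst (λ l → Sub bval l (2 * target)) its≡ (sub-++⁺ (sub-none (replicate pads [])) chosen)
        where
        chosen : Sub bval (upTo (P + R)) (2 * target)
        chosen = subst₂ (Sub bval) (trans (cong (items 0) (Solved.long sol)) (sym (upTo-items (P + R))))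
          (cong (2 *_) (trans (+-identityʳ _) (solved-T sol))) (place 0 τs (Solved.known sol))

      subset-solution : Sub bval its (2 * target) → ∃ Solved
      subset-solution sub = finish (collect (P + R) 0 (subst (λ l → Sub bval l (2 * target)) (upTo-items (P + R)) (sub-pads pads (subst (λ l → Sub bval l (2 * target)) (sym its≡) sub))))
        where
        finish : (∃ λ tss → length tss ≡ P + R × All Chosen tss × 2 * target ≡ 2 * (1 * Period.T P tss)) → ∃ Solved
        finish (tss , len , ok , eq) = T-solved tss len ok (trans (sym (+-identityʳ (Period.T P tss))) (sym (*-cancelˡ-≡ target (1 * Period.T P tss) 2 eq)))

      rest-half : ∀ {m n} → m + n ≡ sumBy bval its → m ≡ 2 * target → bval qBits + n ≡ H
      rest-half {m} {n} e refl = +-cancelʳ-≡ (2 * target) (bval qBits + n) H (trans (+-assoc (bval qBits) n (2 * target))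
        (trans (cong (bval qBits +_) (trans (+-comm n (2 * target)) (trans e total))) q-value))

    subset-yes : Sub bval its (2 * target) → YesInstance (inst (boundBits J'))
    subset-yes sub = chosen (sel-sub sub)
      where
      chosen : (∃ λ (sel : Fin (length its) → Bool) → S (λ j → ind (sel j) (bval (lookup its j))) ≡ 2 * target ×
                2 * target + S (λ j → ind (not (sel j)) (bval (lookup its j))) ≡ sumBy bval its) → YesInstance (inst (boundBits J'))
      chosen (sel , e₁ , e₂) = spanned (forward sel (trans (cong (bval pBits +_) e₁) p-value) (rest-half e₂ refl))
        where
        spanned : (∃ λ F → SpanningTree F × ∃ λ D → IsDown r F D × loss res dem F D ≤ H * H + H * H) → YesInstance (inst (boundBits J'))
        spanned (F , tr , D , dn , lo) = F , tr , D , dn , ≤-trans lo (≤-reflexive (sym loss-bound))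

    yes-subset : YesInstance (inst (boundBits J')) → Sub bval its (2 * target)
    yes-subset (F , tr , D , dn , lo) = chosen (Conv.backward balance H>0 F tr D dn (≤-trans lo (≤-reflexive loss-bound)))
      where
      chosen : (∃ λ (sel : Fin (length its) → Bool) → bval pBits + S (λ j → ind (sel j) (bval (lookup its j))) ≡ H) → Sub bval its (2 * target)
      chosen (sel , e) = subst (Sub bval its) (+-cancelˡ-≡ (bval pBits) _ _ (trans e (sym p-value))) (sub-sel bval its sel)

    yes⁺ : History → YesInstance (inst (boundBits J'))
    yes⁺ h = subset-yes (solution-subset (proj₁ (history-solved h)) (proj₂ (history-solved h)))

    yes⁻ : YesInstance (inst (boundBits J')) → History
    yes⁻ y = solved-history (proj₂ (subset-solution (yes-subset y)))

-- The program that writes the instance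

incs : ∀ {K} → ℕ → Fin K → Cmd K
incs zero    i = skip
incs (suc n) i = inc i ▹ incs n i

rept : ∀ {K} → ℕ → Cmd K → Cmd K
rept zero    c = skip
rept (suc n) c = c ▹ rept n c

emitAll : ∀ {K} → List Bool → Cmd K
emitAll []       = skip
emitAll (b ∷ bs) = emitAll bs ▹ emit b

for : ∀ {K} → Fin K → Fin K → Cmd K → Cmd K
for i j c = while i j (c ▹ inc i) ▹ clr i

addTo : ∀ {K} → Fin K → Fin K → Fin K → Cmd K
addTo t i j = for i j (inc t)

-- Output is built from its end, so a loop counting upwards leaves the text of its last round in
-- front.
down : ℕ → (ℕ → List Bool) → List Bool
down zero    f = []
down (suc v) f = f v ++ down v f

down-const : ∀ v c → down v (λ _ → c) ≡ times v c
down-const zero    c = refl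
down-const (suc v) c = cong (c ++_) (down-const v c)

down-suc : ∀ v f → down (suc v) f ≡ down v (f ∘ suc) ++ f 0
down-suc zero    f = ++-identityʳ (f 0)
down-suc (suc v) f = trans (cong (f (suc v) ++_) (down-suc v f)) (sym (++-assoc (f (suc v)) (down v (f ∘ suc)) (f 0)))

-- The reversal due to backward output undoes the reversal of the stored input, so the input appears
-- in its original order.
down-nth : ∀ (g : Bool → List Bool) X → down (length X) (λ a → g (nthB X a)) ≡ concatMap g (reverse X)
down-nth g []      = refl
down-nth g (b ∷ X) = trans (down-suc (length X) (λ a → g (nthB (b ∷ X) a))) (trans (cong (_++ g b) (down-nth g X))
  (sym (trans (cong (concatMap g) (unfold-reverse b X)) (trans (concatMap-++ g (reverse X) [ b ]) (cong (concatMap g (reverse X) ++_) (++-identityʳ (g b)))))))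

module Exec' {K : ℕ} (X : List Bool) (Y : ℕ) where

  infix 3 _⊢_⟶_
  record _⊢_⟶_ (c : Cmd K) (σ σ' : State K) : Set where
    constructor runs
    field
      {ops} : ℕ
      ops≤  : ops ≤ cost c Y
      big   : Big X c σ ops σ'

  seq : ∀ {c d σ σ' σ''} → c ⊢ σ ⟶ σ' → d ⊢ σ' ⟶ σ'' → c ▹ d ⊢ σ ⟶ σ''
  seq (runs l x) (runs r y) = runs (+-mono-≤ l r) (⇓seq x y)

  infixr 4 _then_
  _then_ : ∀ {c d σ σ' σ''} → c ⊢ σ ⟶ σ' → d ⊢ σ' ⟶ σ'' → c ▹ d ⊢ σ ⟶ σ''
  _then_ = seq

  to : ∀ {c σ σ' σ''} → σ' ≡ σ'' → c ⊢ σ ⟶ σ' → c ⊢ σ ⟶ σ''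
  to refl r = r

  run-inc : ∀ {i ρ o} → inc i ⊢ (ρ , o) ⟶ (ρ [ i ]≔ suc (ρ ! i) , o)
  run-inc = runs ≤-refl ⇓inc

  run-clr : ∀ {i ρ o} → clr i ⊢ (ρ , o) ⟶ (ρ [ i ]≔ 0 , o)
  run-clr = runs ≤-refl ⇓clr

  run-skip : ∀ {σ} → skip ⊢ σ ⟶ σ
  run-skip = runs ≤-refl ⇓skip

  run-while : ∀ {i j c} (st : ℕ → State K) v → v ≤ Y →
    (∀ a → a < v → proj₁ (st a) ! i < proj₁ (st a) ! j) → proj₁ (st v) ! j ≤ proj₁ (st v) ! i →
    (∀ a → a < v → c ⊢ st a ⟶ st (suc a)) → while i j c ⊢ st 0 ⟶ st v
  run-while {i} {j} {c} st v v≤Y go stop body = let m , m≤ , x = loop-from v 0 (+-identityʳ v) in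
      runs (≤-trans m≤ (+-monoˡ-≤ 1 (*-monoˡ-≤ (suc (cost c Y)) v≤Y))) x
    where
    loop-from : ∀ d a → d + a ≡ v → ∃ λ m → m ≤ d * suc (cost c Y) + 1 × Big X (while i j c) (st a) m (st v)
    loop-from zero    a refl = 1 , ≤-refl , ⇓stop stop
    loop-from (suc d) a e = let
        a<v = subst (suc a ≤_) e (s≤s (m≤n+m a d))
        runs {m} m≤ x = body a a<v
        m' , m'≤ , y = loop-from d (suc a) (trans (+-suc d a) e)
      in suc (m + m') , ≤-trans (s≤s (+-mono-≤ m≤ m'≤)) (≤-reflexive (cong suc (sym (+-assoc (cost c Y) _ 1)))) , ⇓again (go a a<v) x y

  update-0 : ∀ (ρ : Vec ℕ K) i → ρ ! i ≡ 0 → ρ [ i ]≔ 0 ≡ ρ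
  update-0 ρ i e = trans (cong (λ v → ρ [ i ]≔ v) (sym e)) ([]≔-lookup ρ i)

  -- The family `ρ` holds 0 at the loop counter, whose value is overlaid during the loop; the states
  -- before and after the loop are then members of the family.
  run-for : ∀ {i j c} (ρ : ℕ → Vec ℕ K) (o : ℕ → List Bool) v → v ≤ Y → i ≢ j →
    (∀ a → ρ a ! i ≡ 0) → (∀ a → ρ a ! j ≡ v) →
    (∀ a → a < v → c ⊢ (ρ a [ i ]≔ a , o a) ⟶ (ρ (suc a) [ i ]≔ a , o (suc a))) →
    for i j c ⊢ (ρ 0 , o 0) ⟶ (ρ v , o v)
  run-for {i} {j} {c} ρ o v v≤Y i≢j at-i at-j body = subst (λ r → for i j c ⊢ (r , o 0) ⟶ (ρ v , o v)) (update-0 (ρ 0) i (at-i 0))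
    (seq (run-while st v v≤Y
           (λ a a<v → subst₂ _<_ (sym (lookup∘update i (ρ a) a)) (sym (trans (lookup∘update′ (i≢j ∘ sym) (ρ a) a) (at-j a))) a<v)
           (≤-reflexive (trans (lookup∘update′ (i≢j ∘ sym) (ρ v) v) (trans (at-j v) (sym (lookup∘update i (ρ v) v)))))
           (λ a a<v → seq (body a a<v) (to (cong (_, o (suc a)) (trans ([]≔-idempotent (ρ (suc a)) i) (cong (λ w → ρ (suc a) [ i ]≔ suc w) (lookup∘update i (ρ (suc a)) a)))) run-inc)))
      (to (cong (_, o v) (trans ([]≔-idempotent (ρ v) i) (update-0 (ρ v) i (at-i v)))) run-clr))
    where
    st : ℕ → State K
    st a = ρ a [ i ]≔ a , o a

  Emits : Cmd K → Vec ℕ K → List Bool → Set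
  Emits c ρ f = ∀ o → c ⊢ (ρ , o) ⟶ (ρ , f ++ o)

  emits-all : ∀ bs {ρ} → Emits (emitAll bs) ρ bs
  emits-all []       o = run-skip
  emits-all (b ∷ bs) o = seq (emits-all bs o) (runs ≤-refl ⇓emit)

  emits-seq : ∀ {c d ρ f g} → Emits c ρ f → Emits d ρ g → Emits (c ▹ d) ρ (g ++ f)
  emits-seq {f = f} {g} x y o = to (cong (_ ,_) (sym (++-assoc g f o))) (seq (x o) (y (f ++ o)))

  emits-to : ∀ {c ρ f g} → f ≡ g → Emits c ρ f → Emits c ρ g
  emits-to refl x = x

  emits-for : ∀ {i j c ρ} (f : ℕ → List Bool) v → v ≤ Y → i ≢ j → ρ ! i ≡ 0 → ρ ! j ≡ v →
    (∀ a → a < v → Emits c (ρ [ i ]≔ a) (f a)) → Emits (for i j c) ρ (down v f)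
  emits-for {ρ = ρ} f v v≤Y i≢j at-i at-j body o = run-for (λ _ → ρ) (λ a → down a f ++ o) v v≤Y i≢j (λ _ → at-i) (λ _ → at-j)
    (λ a a<v → to (cong (_ ,_) (sym (++-assoc (f a) (down a f) o))) (body a a<v (down a f ++ o)))

  emits-times : ∀ {i j c ρ f} v → v ≤ Y → i ≢ j → ρ ! i ≡ 0 → ρ ! j ≡ v → (∀ ρ' → Emits c ρ' f) → Emits (for i j c) ρ (times v f)
  emits-times {f = f} v v≤Y i≢j at-i at-j body = emits-to (down-const v f) (emits-for (λ _ → f) v v≤Y i≢j at-i at-j (λ a _ → body _))

  -- Starting the loop counter at `d` yields `d` fewer rounds without a subtraction on registers.
  emits-from : ∀ {i j c ρ f} d v → v ≤ Y → i ≢ j → ρ ! i ≡ 0 → ρ ! j ≡ v + d → (∀ ρ' → Emits c ρ' f) →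
    Emits (incs d i ▹ for i j c) ρ (times v f)
  emits-from {i} {j} {c} {ρ} {f} d v v≤Y i≢j at-i at-j body o =
    seq (subst (λ r → incs d i ⊢ (r , o) ⟶ (ρ [ i ]≔ d , o)) (update-0 ρ i at-i) (count d 0 d (+-identityʳ d)))
      (seq (run-while st v v≤Y
             (λ a a<v → subst₂ _<_ (sym (lookup∘update i ρ (a + d))) (sym (trans (lookup∘update′ (i≢j ∘ sym) ρ (a + d)) at-j)) (+-monoˡ-< d a<v))
             (≤-reflexive (trans (lookup∘update′ (i≢j ∘ sym) ρ (v + d)) (trans at-j (sym (lookup∘update i ρ (v + d))))))
             (λ a a<v → seq (body _ (times a f ++ o))
               (to (cong₂ _,_ (trans ([]≔-idempotent ρ i) (cong (λ w → ρ [ i ]≔ suc w) (lookup∘update i ρ (a + d)))) (sym (++-assoc f (times a f) o))) run-inc)))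
        (to (cong (_, times v f ++ o) (trans ([]≔-idempotent ρ i) (update-0 ρ i at-i))) run-clr))
    where
    st : ℕ → State K
    st a = ρ [ i ]≔ (a + d) , times a f ++ o
    count : ∀ k a d → k + a ≡ d → incs k i ⊢ (ρ [ i ]≔ a , o) ⟶ (ρ [ i ]≔ d , o)
    count zero    a .a refl = run-skip
    count (suc k) a d  e = seq (to (cong (_, o) (trans ([]≔-idempotent ρ i) (cong (λ w → ρ [ i ]≔ suc w) (lookup∘update i ρ a)))) run-inc) (count k (suc a) d (trans (+-suc k a) e))

  accumulate : ∀ {i j c ρ o} t δ v w → v ≤ Y → i ≢ j → t ≢ i → t ≢ j → ρ ! i ≡ 0 → ρ ! j ≡ v → ρ ! t ≡ w →
    (∀ a → a < v → c ⊢ ((ρ [ t ]≔ (a * δ + w)) [ i ]≔ a , o) ⟶ ((ρ [ t ]≔ (δ + (a * δ + w))) [ i ]≔ a , o)) →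
    for i j c ⊢ (ρ , o) ⟶ (ρ [ t ]≔ (v * δ + w) , o)
  accumulate {i} {j} {c} {ρ} {o} t δ v w v≤Y i≢j t≢i t≢j at-i at-j at-t body =
    subst (λ r → for i j c ⊢ (r , o) ⟶ (ρ [ t ]≔ (v * δ + w) , o)) (trans (cong (λ u → ρ [ t ]≔ u) (sym at-t)) ([]≔-lookup ρ t))
      (run-for (λ a → ρ [ t ]≔ (a * δ + w)) (λ _ → o) v v≤Y i≢j
        (λ a → trans (lookup∘update′ (t≢i ∘ sym) ρ _) at-i) (λ a → trans (lookup∘update′ (t≢j ∘ sym) ρ _) at-j)
        (λ a a<v → to (cong (λ u → (ρ [ t ]≔ u) [ i ]≔ a , o) (sym (+-assoc δ (a * δ) w))) (body a a<v)))

  run-addTo : ∀ {i j ρ o} t v w → v ≤ Y → i ≢ j → t ≢ i → t ≢ j → ρ ! i ≡ 0 → ρ ! j ≡ v → ρ ! t ≡ w →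
    addTo t i j ⊢ (ρ , o) ⟶ (ρ [ t ]≔ (v + w) , o)
  run-addTo {i} {j} {ρ} {o} t v w v≤Y i≢j t≢i t≢j at-i at-j at-t = to (cong (λ u → ρ [ t ]≔ (u + w) , o) (*-identityʳ v))
    (accumulate t 1 v w v≤Y i≢j t≢i t≢j at-i at-j at-t λ a a<v → to (cong (_, o)
      (trans (cong (λ u → (ρ [ t ]≔ (a * 1 + w)) [ i ]≔ a [ t ]≔ suc u) (trans (lookup∘update′ t≢i (ρ [ t ]≔ (a * 1 + w)) a) (lookup∘update t ρ _)))
        (trans ([]≔-commutes (ρ [ t ]≔ (a * 1 + w)) i t (t≢i ∘ sym)) (cong (_[ i ]≔ a) ([]≔-idempotent ρ t))))) run-inc)

  run-incs : ∀ k {t ρ o} w → ρ ! t ≡ w → incs k t ⊢ (ρ , o) ⟶ (ρ [ t ]≔ (k + w) , o)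
  run-incs zero    {t} {ρ} {o} w refl = to (cong (_, o) (sym ([]≔-lookup ρ t))) run-skip
  run-incs (suc k) {t} {ρ} {o} w refl = seq run-inc
    (to (cong (_, o) (trans ([]≔-idempotent ρ t) (cong (λ u → ρ [ t ]≔ u) (+-suc k w)))) (run-incs k (suc w) (lookup∘update t ρ (suc w))))

  run-rept : ∀ k {c} (st : ℕ → State K) → (∀ a → a < k → c ⊢ st a ⟶ st (suc a)) → rept k c ⊢ st 0 ⟶ st k
  run-rept zero    st body = run-skip
  run-rept (suc k) st body = seq (body 0 (s≤s z≤n)) (run-rept k (st ∘ suc) (λ a a<k → body (suc a) (s≤s a<k)))

-- Registers and the sizes of the instance

pattern rn = zero
pattern rW = suc zero
pattern rT = suc (suc zero)
pattern rz = suc (suc (suc zero))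
pattern rR = suc (suc (suc (suc zero)))
pattern rL = suc (suc (suc (suc (suc zero))))
pattern rw = suc (suc (suc (suc (suc (suc zero)))))
pattern rc = suc (suc (suc (suc (suc (suc (suc zero))))))
pattern rs = suc (suc (suc (suc (suc (suc (suc (suc zero)))))))
pattern ri = suc (suc (suc (suc (suc (suc (suc (suc (suc zero))))))))
pattern rj = suc (suc (suc (suc (suc (suc (suc (suc (suc (suc zero)))))))))
pattern ra = suc (suc (suc (suc (suc (suc (suc (suc (suc (suc (suc zero))))))))))
pattern rb = suc (suc (suc (suc (suc (suc (suc (suc (suc (suc (suc (suc zero)))))))))))

Reg : Set
Reg = Fin 13

regs : (n W T z R L w c s i j a b : ℕ) → Vec ℕ 13
regs n W T z R L w c s i j a b = n ∷ W ∷ T ∷ z ∷ R ∷ L ∷ w ∷ c ∷ s ∷ i ∷ j ∷ a ∷ b ∷ []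

mulStep : Reg → Cmd 13
mulStep src = for ri rb (addTo ra rj src) ▹ clr rb ▹ addTo rb ri ra ▹ clr ra

-- `rb` is raised to the power `src ^ k`, and `rc` collects `k` copies of it and `k` more, which is
-- `polyBound k`.
polyP : ℕ → Reg → Reg → Cmd 13
polyP k src dst = inc rb ▹ rept k (mulStep src) ▹ rept k (addTo rc ri rb) ▹ incs k rc ▹ clr rb ▹ addTo dst ri rc ▹ clr rc

doubleP : Reg → Cmd 13
doubleP t = addTo ra ri t ▹ addTo t ri ra ▹ clr ra

-- `sv` bounds the length of `pairEnc x w` for admissible witnesses, and `Tv` the time on such
-- inputs. `Lv` is the number of places, and `cv` counts one column per item and one for the root,
-- before padding. Most sums are bracketed in the order of the program's additions, so that the
-- states match by computation.
module Sizes (c d N n : ℕ) where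
  Wv sv Tv zv Rv Lv cv : ℕ
  Wv = polyBound c n
  sv = Wv + (2 + (n + (n + 0)))
  Tv = polyBound d sv
  zv = Tv + (Tv + (Wv + (4 + (n + (n + 0)))))
  Rv = suc Tv * (2 + zv)
  Lv = 2 + zv + Rv
  cv = suc (N * Lv)

  -- Everything a loop may count to; the sum dominates each entry. The powers are of successors
  -- because a smaller power of 0 can exceed a larger one.
  bounds : List ℕ
  bounds = suc n ^ c ∷ suc sv ^ d ∷ n ∷ sv ∷ Wv ∷ Tv ∷ zv ∷ Rv ∷ Lv ∷ (cv + cv) ∷ []

  Yv : ℕ
  Yv = sumBy id bounds

  bounded : ∀ {v} → v ∈ bounds → v ≤ Yv
  bounded = sumBy-∈ id

  pow≤ : ∀ {σ c k} → k ≤ c → σ ^ k ≤ suc σ ^ c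
  pow≤ {σ} {c} {k} k≤c = ≤-trans (^-monoˡ-≤ k (n≤1+n σ)) (^-monoʳ-≤ (suc σ) k≤c)

setupP : (c d N : ℕ) → Cmd 13
setupP c d N = polyP c rn rW ▹
  (addTo rs ri rn ▹ addTo rs ri rn ▹ incs 2 rs ▹ addTo rs ri rW) ▹
  polyP d rs rT ▹ clr rs ▹
  (addTo rz ri rn ▹ addTo rz ri rn ▹ incs 4 rz ▹ addTo rz ri rW ▹ addTo rz ri rT ▹ addTo rz ri rT) ▹
  (for ri rT (addTo rR rj rz ▹ incs 2 rR) ▹ addTo rR ri rz ▹ incs 2 rR) ▹
  (addTo rL ri rz ▹ addTo rL ri rR ▹ incs 2 rL) ▹
  (rept N (addTo rc ri rL) ▹ inc rc) ▹
  (inc rw ▹ while rw rc (doubleP rw))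

module SetupRun (c d N : ℕ) (x : List Bool) where
  n : ℕ
  n = length x
  open Sizes c d N n public
  open Exec' {13} (reverse x) Yv public

  run-poly : ∀ k (src dst : Reg) {σ u} n W T z R L w s {o} → (∀ c i j a b → regs n W T z R L w c s i j a b ! src ≡ σ) →
    rj ≢ src → ra ≢ src → dst ≢ ri → dst ≢ rc → (∀ c → regs n W T z R L w c s 0 0 0 0 ! dst ≡ u) →
    (∀ j → j ≤ k → σ ^ j ≤ Yv) → σ ≤ Yv → polyBound k σ ≤ Yv →
    polyP k src dst ⊢ (regs n W T z R L w 0 s 0 0 0 0 , o) ⟶ ((regs n W T z R L w (polyBound k σ) s 0 0 0 0 [ dst ]≔ (polyBound k σ + u)) [ rc ]≔ 0 , o)
  run-poly k src dst {σ} {u} n W T z R L w s {o} at-src j≢ a≢ dst≢i dst≢c at-dst pw σ≤ v≤ =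
    run-inc then
    run-rept k (λ a → v13 0 0 (σ ^ a) , o) (λ a a<k →
      accumulate ra σ (σ ^ a) 0 (pw a (<⇒≤ a<k)) (λ ()) (λ ()) (λ ()) refl refl refl
        (λ a' _ → run-addTo ra σ (a' * σ + 0) σ≤ j≢ (λ ()) a≢ refl (at-src 0 a' 0 (a' * σ + 0) (σ ^ a)) refl) then
      run-clr then
      run-addTo rb (σ ^ a * σ + 0) 0 (subst (_≤ Yv) (sym (lem₁ (σ ^ a) σ)) (pw (suc a) a<k)) (λ ()) (λ ()) (λ ()) refl refl refl then
      to (cong (λ b → v13 0 0 b , o) (lem₂ (σ ^ a) σ)) run-clr) then
    run-rept k (λ a → v13 (a * σ ^ k) 0 (σ ^ k) , o) (λ a a<k →
      run-addTo rc (σ ^ k) (a * σ ^ k) (pw k ≤-refl) (λ ()) (λ ()) (λ ()) refl refl refl) then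
    run-incs k (k * σ ^ k) refl then
    run-clr then
    to (cong (λ v → regs n W T z R L w v s 0 0 0 0 [ dst ]≔ (v + u) , o) (+-comm k (k * σ ^ k)))
      (run-addTo dst (k + k * σ ^ k) u (subst (_≤ Yv) (+-comm (k * σ ^ k) k) v≤) (λ ()) dst≢i dst≢c refl refl (at-dst _)) then
    run-clr
    where
    v13 : ℕ → ℕ → ℕ → Vec ℕ 13
    v13 c a b = regs n W T z R L w c s 0 0 a b
    lem₁ : ∀ b σ → b * σ + 0 ≡ σ * b
    lem₁ = solve-∀
    lem₂ : ∀ b σ → b * σ + 0 + 0 ≡ σ * b
    lem₂ = solve-∀

  run-double : ∀ (t : Reg) {ρ o} v → v ≤ Yv → ri ≢ t → ra ≢ t → t ≢ ri → t ≢ ra → ρ ! ri ≡ 0 → ρ ! ra ≡ 0 → ρ ! t ≡ v →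
    doubleP t ⊢ (ρ , o) ⟶ (((ρ [ ra ]≔ (v + 0)) [ t ]≔ ((v + 0) + v)) [ ra ]≔ 0 , o)
  run-double t {ρ} v v≤ i≢t a≢t t≢i t≢a at-i at-a at-t =
    run-addTo ra v 0 v≤ i≢t (λ ()) a≢t at-i at-t at-a then
    run-addTo t (v + 0) v (≤-trans (≤-reflexive (+-identityʳ v)) v≤) (λ ()) t≢i t≢a (trans (lookup∘update′ {i = ri} {ra} (λ ()) ρ (v + 0)) at-i) (lookup∘update ra ρ (v + 0))
      (trans (lookup∘update′ t≢a ρ (v + 0)) at-t) then
    run-clr

  module _ {l : ℕ} (enough : cv ≤ 2 ^ l) (below : ∀ a → a < l → 2 ^ a < cv) (l≤ : l ≤ cv) where

    2^l≤ : 2 ^ l ≤ cv + cv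
    2^l≤ = go l below
      where
      go : ∀ l → (∀ a → a < l → 2 ^ a < cv) → 2 ^ l ≤ cv + cv
      go zero    f = s≤s z≤n
      go (suc a) f = ≤-trans (≤-reflexive (cong (2 ^ a +_) (+-identityʳ (2 ^ a)))) (+-mono-≤ (<⇒≤ (f a ≤-refl)) (<⇒≤ (f a ≤-refl)))

    private
      ∈0 : ∀ {v : ℕ} {vs : List ℕ} → v ∈ (v ∷ vs)
      ∈0 = Any.here refl

    n≤ : n ≤ Yv
    n≤ = bounded (Any.there (Any.there ∈0))
    m≤ : sv ≤ Yv
    m≤ = bounded (Any.there (Any.there (Any.there ∈0)))
    W≤ : Wv ≤ Yv
    W≤ = bounded (Any.there (Any.there (Any.there (Any.there ∈0))))
    T≤ : Tv ≤ Yv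
    T≤ = bounded (Any.there (Any.there (Any.there (Any.there (Any.there ∈0)))))
    z≤ : zv ≤ Yv
    z≤ = bounded (Any.there (Any.there (Any.there (Any.there (Any.there (Any.there ∈0))))))
    R≤ : Rv ≤ Yv
    R≤ = bounded (Any.there (Any.there (Any.there (Any.there (Any.there (Any.there (Any.there ∈0)))))))
    L≤ : Lv ≤ Yv
    L≤ = bounded (Any.there (Any.there (Any.there (Any.there (Any.there (Any.there (Any.there (Any.there ∈0))))))))
    2c≤ : cv + cv ≤ Yv
    2c≤ = bounded (Any.there (Any.there (Any.there (Any.there (Any.there (Any.there (Any.there (Any.there (Any.there ∈0)))))))))

    private
      pow-n : ∀ j → j ≤ c → n ^ j ≤ Yv
      pow-n j le = ≤-trans (pow≤ le) (bounded ∈0)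
      pow-m : ∀ j → j ≤ d → sv ^ j ≤ Yv
      pow-m j le = ≤-trans (pow≤ le) (bounded (Any.there ∈0))

      v9 : (n W T z R L w c s : ℕ) → Vec ℕ 13
      v9 n W T z R L w c s = regs n W T z R L w c s 0 0 0 0

      stage₁ : polyP c rn rW ⊢ (v9 n 0 0 0 0 0 0 0 0 , []) ⟶ (v9 n Wv 0 0 0 0 0 0 0 , [])
      stage₁ = to (cong (λ v → v9 n v 0 0 0 0 0 0 0 , []) (+-identityʳ Wv))
        (run-poly c rn rW n 0 0 0 0 0 0 0 (λ _ _ _ _ _ → refl) (λ ()) (λ ()) (λ ()) (λ ()) (λ _ → refl) pow-n n≤ W≤)

      stage₂ : (addTo rs ri rn ▹ addTo rs ri rn ▹ incs 2 rs ▹ addTo rs ri rW) ⊢ (v9 n Wv 0 0 0 0 0 0 0 , []) ⟶ (v9 n Wv 0 0 0 0 0 0 sv , [])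
      stage₂ = run-addTo rs n 0 n≤ (λ ()) (λ ()) (λ ()) refl refl refl then run-addTo rs n (n + 0) n≤ (λ ()) (λ ()) (λ ()) refl refl refl then
        run-incs 2 (n + (n + 0)) refl then run-addTo rs Wv (2 + (n + (n + 0))) W≤ (λ ()) (λ ()) (λ ()) refl refl refl

      stage₃ : polyP d rs rT ⊢ (v9 n Wv 0 0 0 0 0 0 sv , []) ⟶ (v9 n Wv Tv 0 0 0 0 0 sv , [])
      stage₃ = to (cong (λ v → v9 n Wv v 0 0 0 0 0 sv , []) (+-identityʳ Tv))
        (run-poly d rs rT n Wv 0 0 0 0 0 sv (λ _ _ _ _ _ → refl) (λ ()) (λ ()) (λ ()) (λ ()) (λ _ → refl) pow-m m≤ T≤)

      stage₄ : (addTo rz ri rn ▹ addTo rz ri rn ▹ incs 4 rz ▹ addTo rz ri rW ▹ addTo rz ri rT ▹ addTo rz ri rT) ⊢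
        (v9 n Wv Tv 0 0 0 0 0 0 , []) ⟶ (v9 n Wv Tv zv 0 0 0 0 0 , [])
      stage₄ = run-addTo rz n 0 n≤ (λ ()) (λ ()) (λ ()) refl refl refl then run-addTo rz n (n + 0) n≤ (λ ()) (λ ()) (λ ()) refl refl refl then
        run-incs 4 (n + (n + 0)) refl then run-addTo rz Wv (4 + (n + (n + 0))) W≤ (λ ()) (λ ()) (λ ()) refl refl refl then
        run-addTo rz Tv (Wv + (4 + (n + (n + 0)))) T≤ (λ ()) (λ ()) (λ ()) refl refl refl then
        run-addTo rz Tv (Tv + (Wv + (4 + (n + (n + 0))))) T≤ (λ ()) (λ ()) (λ ()) refl refl refl

      stage₅ : (for ri rT (addTo rR rj rz ▹ incs 2 rR) ▹ addTo rR ri rz ▹ incs 2 rR) ⊢ (v9 n Wv Tv zv 0 0 0 0 0 , []) ⟶ (v9 n Wv Tv zv Rv 0 0 0 0 , [])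
      stage₅ = accumulate rR (2 + zv) Tv 0 T≤ (λ ()) (λ ()) (λ ()) refl refl refl
          (λ a a<v → run-addTo rR zv (a * (2 + zv) + 0) z≤ (λ ()) (λ ()) (λ ()) refl refl refl then run-incs 2 (zv + (a * (2 + zv) + 0)) refl) then
        run-addTo rR zv (Tv * (2 + zv) + 0) z≤ (λ ()) (λ ()) (λ ()) refl refl refl then
        to (cong (λ v → v9 n Wv Tv zv v 0 0 0 0 , []) (lem zv (Tv * (2 + zv)))) (run-incs 2 (zv + (Tv * (2 + zv) + 0)) refl)
        where
        lem : ∀ z t → 2 + (z + (t + 0)) ≡ 2 + z + t
        lem = solve-∀

      stage₆ : (addTo rL ri rz ▹ addTo rL ri rR ▹ incs 2 rL) ⊢ (v9 n Wv Tv zv Rv 0 0 0 0 , []) ⟶ (v9 n Wv Tv zv Rv Lv 0 0 0 , [])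
      stage₆ = run-addTo rL zv 0 z≤ (λ ()) (λ ()) (λ ()) refl refl refl then run-addTo rL Rv (zv + 0) R≤ (λ ()) (λ ()) (λ ()) refl refl refl then
        to (cong (λ v → v9 n Wv Tv zv Rv v 0 0 0 , []) (lem zv Rv)) (run-incs 2 (Rv + (zv + 0)) refl)
        where
        lem : ∀ z r → 2 + (r + (z + 0)) ≡ 2 + z + r
        lem = solve-∀

      stage₇ : (rept N (addTo rc ri rL) ▹ inc rc) ⊢ (v9 n Wv Tv zv Rv Lv 0 0 0 , []) ⟶ (v9 n Wv Tv zv Rv Lv 0 cv 0 , [])
      stage₇ = run-rept N (λ a → v9 n Wv Tv zv Rv Lv 0 (a * Lv) 0 , []) (λ a _ → run-addTo rc Lv (a * Lv) L≤ (λ ()) (λ ()) (λ ()) refl refl refl) then run-inc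

      stage₈ : (inc rw ▹ while rw rc (doubleP rw)) ⊢ (v9 n Wv Tv zv Rv Lv 0 cv 0 , []) ⟶ (v9 n Wv Tv zv Rv Lv (2 ^ l) cv 0 , [])
      stage₈ = run-inc then run-while (λ a → v9 n Wv Tv zv Rv Lv (2 ^ a) cv 0 , []) l (≤-trans l≤ (≤-trans (m≤m+n cv cv) 2c≤)) below enough
        (λ a a<l → to (cong (λ v → v9 n Wv Tv zv Rv Lv v cv 0 , []) (lem (2 ^ a)))
          (run-double rw (2 ^ a) (≤-trans (<⇒≤ (below a a<l)) (≤-trans (m≤m+n cv cv) 2c≤)) (λ ()) (λ ()) (λ ()) (λ ()) refl refl refl))
        where
        lem : ∀ v → v + 0 + v ≡ v + (v + 0)
        lem = solve-∀

    ready : Vec ℕ 13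
    ready = regs n Wv Tv zv Rv Lv (2 ^ l) cv 0 0 0 0 0

    run-setup : setupP c d N ⊢ (vreplicate 13 0 [ rn ]≔ n , []) ⟶ (ready , [])
    run-setup = stage₁ then stage₂ then stage₃ then run-clr then stage₄ then stage₅ then stage₆ then stage₇ then stage₈

-- Writing the encoding

dbl-++ : ∀ xs ys → dbl (xs ++ ys) ≡ dbl xs ++ dbl ys
dbl-++ xs ys = concatMap-++ _ xs ys

dbl-blk : ∀ w xs → dbl (blk w xs) ≡ concatMap (dbl ∘ bits w) xs
dbl-blk w []       = refl
dbl-blk w (x ∷ xs) = trans (dbl-++ (bits w x) _) (cong (dbl (bits w x) ++_) (dbl-blk w xs))

++-congˡ : ∀ {u v : List Bool} r → u ≡ v → u ++ r ≡ v ++ r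
++-congˡ r refl = refl

concatMap-replicate : ∀ {A : Set} (g : A → List Bool) n c → concatMap g (replicate n c) ≡ times n (g c)
concatMap-replicate g zero    c = refl
concatMap-replicate g (suc n) c = cong (g c ++_) (concatMap-replicate g n c)

concatMap-map : ∀ {A B : Set} (g : B → List Bool) (f : A → B) xs → concatMap g (map f xs) ≡ concatMap (g ∘ f) xs
concatMap-map g f []       = refl
concatMap-map g f (x ∷ xs) = cong (g (f x) ++_) (concatMap-map g f xs)

dbl-replicate : ∀ n b → dbl (replicate n b) ≡ times n (b ∷ b ∷ [])
dbl-replicate zero    b = refl
dbl-replicate (suc n) b = cong (λ l → b ∷ b ∷ l) (dbl-replicate n b)

times-+ : ∀ m n c → times (m + n) c ≡ times m c ++ times n c
times-+ zero    n c = refl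
times-+ (suc m) n c = trans (cong (c ++_) (times-+ m n c)) (sym (++-assoc c (times m c) (times n c)))

times-pairs : ∀ n c → times (n * 2) c ≡ times n (c ++ c)
times-pairs zero    c = refl
times-pairs (suc n) c = trans (cong (λ l → c ++ c ++ l) (times-pairs n c)) (sym (++-assoc c c _))

dbl-times : ∀ n c → dbl (times n c) ≡ times n (dbl c)
dbl-times zero    c = refl
dbl-times (suc n) c = trans (dbl-++ c (times n c)) (cong (dbl c ++_) (dbl-times n c))

module Emission (M : TM) (e : ℕ) (wide : Wide M e) where
  open Numbers M e wide

  put : (Class Color → ℕ) → Class Color → List Bool
  put f c = dbl (bits w (f c))

  -- The text of a block depends only on its class and is a constant of the program; only the
  -- repetition counts and the input bits come from registers. Blocks are written from the highest
  -- to the lowest because the output grows to the left.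
  blocksP : (Class Color → ℕ) → Cmd 13
  blocksP f = emitAll (false ∷ true ∷ []) ▹ for ri rz (block last) ▹ block last ▹ block lastfirst ▹ for ri rR (block mid) ▹
    for ri rT (block (pre (cel blank)) ▹ block (pre (cel blank))) ▹ block (pre (cel blank)) ▹ block (pre (cel blank)) ▹
    for ri rW (block (pre wit)) ▹ block (pre (cel b1)) ▹ block (pre (cel b0)) ▹
    for ri rn (ifX ri (block (pre (cel b1)) ▹ block (pre (cel b1))) (block (pre (cel b0)) ▹ block (pre (cel b0)))) ▹
    block (pre start) ▹ block first ▹ emitAll (true ∷ true ∷ [])
    where
    block : Class Color → Cmd 13
    block c = emitAll (put f c)

  zero-block : List Bool
  zero-block = dbl (bits w 0)

  low-blocks top-block : Tile → List Bool
  low-blocks τ = dbl (bits w (cl τ + B * cb τ)) ++ dbl (bits w (trgt τ))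
  top-block τ = dbl (bits (e + e) (B * ttop τ)) ++ (false ∷ true ∷ [])

  itemP : Tile → Cmd 13
  itemP τ = emitAll (top-block τ) ▹ for ri rz (emitAll zero-block) ▹ emitAll (low-blocks τ) ▹ for ri rs (emitAll zero-block) ▹ emitAll (true ∷ true ∷ [])

  tilesP : List Tile → Cmd 13
  tilesP []       = skip
  tilesP (τ ∷ τs) = tilesP τs ▹ itemP τ

  itemsP : Cmd 13
  itemsP = for rs rL (tilesP tiles)

  gap : List Bool
  gap = dbl (replicate (w + w) false)

  boundP : Cmd 13
  boundP = emitAll (false ∷ true ∷ []) ▹ for ri rz (emitAll gap) ▹ emitAll gap ▹ emitAll gap ▹ for ri rR (emitAll gap) ▹
    for ri rz (emitAll gap) ▹ emitAll gap ▹ emitAll gap ▹ emitAll (dbl (true ∷ false ∷ false ∷ false ∷ false ∷ []))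

  -- There are `2 ^ l` columns. A vertex row or a row of vertical edges has `2 ^ l` entries, a row
  -- of horizontal edges one fewer, and `d` also discounts entries written separately next to the
  -- root.
  zerosP : ℕ → Cmd 13
  zerosP d = incs d ri ▹ for ri rw (emitAll (E []))

  -- The number of edges in a row, `2 ^ l - 1`, consists of `l` digits 1 in bijective binary.
  -- Doubling 1 up to `2 ^ l` takes `l` rounds, each of which emits one such digit, doubled.
  sizeP : Cmd 13
  sizeP = emitAll (false ∷ true ∷ []) ▹ inc rj ▹ while rj rw (emitAll (false ∷ false ∷ []) ▹ doubleP rj)

  encodeP : Cmd 13
  encodeP = boundP ▹ zerosP 0 ▹ zerosP 1 ▹ emitAll (E (false ∷ [])) ▹ zerosP 1 ▹ zerosP 1 ▹ zerosP 2 ▹ emitAll (E (false ∷ [])) ▹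
    zerosP 0 ▹ itemsP ▹ while rc rw (emitAll (E []) ▹ inc rc) ▹ blocksP qB ▹ zerosP 2 ▹ blocksP pB ▹
    emitAll (E []) ▹ emitAll (E []) ▹ emitAll (E []) ▹ sizeP

  module Correct (c d : ℕ) (x : List Bool) {l : ℕ} where
    open SetupRun c d N x
    module Q = Partition M e wide x Wv Tv

    length-known : length (known x) ≡ n + (n + 0)
    length-known = trans (length-map bitSym (concatMap (λ b → b ∷ b ∷ []) x)) (go x)
      where
      go : ∀ x → length (concatMap (λ b → b ∷ b ∷ []) x) ≡ length x + (length x + 0)
      go []      = refl
      go (b ∷ x) = trans (cong (λ v → suc (suc v)) (go x)) (cong suc (sym (+-suc (length x) (length x + 0))))

    z-eq : Q.z ≡ zv
    z-eq = trans (length-++ (map cel (known x))) (trans (cong₂ _+_ (trans (length-map cel (known x)) length-known)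
      (cong (λ v → suc (suc v)) (trans (length-++ (wits Wv)) (cong₂ _+_ (length-replicate Wv) (trans (length-map cel (replicate (2 + Tv * 2) blank)) (length-replicate (2 + Tv * 2)))))))
      (lem n Wv Tv))
      where
      lem : ∀ n W T → n + (n + 0) + (2 + (W + (2 + T * 2))) ≡ T + (T + (W + (4 + (n + (n + 0)))))
      lem = solve-∀

    R-eq : Q.R ≡ Rv
    R-eq = cong (λ v → suc Tv * (2 + v)) z-eq

    L-eq : Q.P + Q.R ≡ Lv
    L-eq = cong₂ (λ a b → 2 + a + b) z-eq R-eq

    module At (enough : cv ≤ 2 ^ l) (below : ∀ a → a < l → 2 ^ a < cv) (l≤ : l ≤ cv) where

      private
        n≤' = n≤ enough below l≤
        W≤' = W≤ enough below l≤
        T≤' = T≤ enough below l≤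
        z≤' = z≤ enough below l≤
        R≤' = R≤ enough below l≤
        L≤' = L≤ enough below l≤
        w≤' : 2 ^ l ≤ Yv
        w≤' = ≤-trans (2^l≤ enough below l≤) (2c≤ enough below l≤)

        const : ∀ bs → (ρ : Vec ℕ 13) → Emits (emitAll bs) ρ bs
        const bs ρ = emits-all bs

        bit-block : (Class Color → ℕ) → Bool → List Bool
        bit-block f b = put f (pre (cel (bitSym b)))

      emits-blocks : ∀ f {ρ} → ρ ! ri ≡ 0 → ρ ! rz ≡ zv → ρ ! rR ≡ Rv → ρ ! rT ≡ Tv → ρ ! rW ≡ Wv → ρ ! rn ≡ n →
        Emits (blocksP f) ρ (E (true ∷ blk w (map f Q.cls)))
      emits-blocks f {ρ} at-i at-z at-R at-T at-W at-n o = to (cong (ρ ,_) shape)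
        (emits-all _ o then emits-times zv z≤' (λ ()) at-i at-z (const (put f last)) _ then
         emits-all _ _ then emits-all _ _ then emits-times Rv R≤' (λ ()) at-i at-R (const (put f mid)) _ then
         emits-times Tv T≤' (λ ()) at-i at-T (λ ρ' → emits-seq {ρ = ρ'} (emits-all (put f (pre (cel blank)))) (emits-all (put f (pre (cel blank))))) _ then
         emits-all _ _ then emits-all _ _ then emits-times Wv W≤' (λ ()) at-i at-W (const (put f (pre wit))) _ then
         emits-all _ _ then emits-all _ _ then emits-for (λ a → bit-block f (nthB (reverse x) a) ++ bit-block f (nthB (reverse x) a)) n n≤' (λ ()) at-i at-n reading _ then
         emits-all _ _ then emits-all _ _ then emits-all _ _)
        where
        cT cF : Cmd 13
        cT = emitAll (bit-block f true) ▹ emitAll (bit-block f true)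
        cF = emitAll (bit-block f false) ▹ emitAll (bit-block f false)
        reading : ∀ a → a < n → Emits (ifX ri cT cF)
                  (ρ [ ri ]≔ a) (bit-block f (nthB (reverse x) a) ++ bit-block f (nthB (reverse x) a))
        reading a _ o = go (nthB (reverse x) a) refl
          where
          same : ∀ {v} → nthB (reverse x) a ≡ v → nthB (reverse x) ((ρ [ ri ]≔ a) ! ri) ≡ v
          same e' = trans (cong (nthB (reverse x)) (lookup∘update ri ρ a)) e'
          go : ∀ b → nthB (reverse x) a ≡ b → ifX ri cT cF ⊢
               (ρ [ ri ]≔ a , o) ⟶ (ρ [ ri ]≔ a , (bit-block f b ++ bit-block f b) ++ o)
          go true e' with emits-seq {ρ = ρ [ ri ]≔ a} (emits-all (bit-block f true)) (emits-all (bit-block f true)) o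
          ... | runs le big = runs (s≤s (≤-trans le (m≤m+n (cost cT Yv) (cost cF Yv)))) (⇓true (same e') big)
          go false e' with emits-seq {ρ = ρ [ ri ]≔ a} (emits-all (bit-block f false)) (emits-all (bit-block f false)) o
          ... | runs le big = runs (s≤s (≤-trans le (m≤n+m (cost cF Yv) (cost cT Yv)))) (⇓false (same e') big)

        g = put f
        knowns : ∀ x → concatMap (g ∘ pre) (map cel (known x)) ≡ concatMap (λ b → bit-block f b ++ bit-block f b) x
        knowns []      = refl
        knowns (b ∷ x) = trans (cong (λ v → bit-block f b ++ bit-block f b ++ v) (knowns x)) (sym (++-assoc (bit-block f b) (bit-block f b) _))
        split : ∀ {A : Set} (h : A → List Bool) ys zs {u v} r → concatMap h ys ≡ u → concatMap h zs ++ r ≡ v → concatMap h (ys ++ zs) ++ r ≡ u ++ v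
        split h ys zs r refl refl = trans (cong (_++ r) (concatMap-++ h ys zs)) (++-assoc (concatMap h ys) (concatMap h zs) r)
        blanks' : ∀ r → concatMap (g ∘ pre) (map cel (replicate (2 + Tv * 2) blank)) ++ r ≡
          g (pre (cel blank)) ++ g (pre (cel blank)) ++ times Tv (g (pre (cel blank)) ++ g (pre (cel blank))) ++ r
        blanks' r = trans (cong (_++ r) (trans (cong (concatMap (g ∘ pre)) (map-replicate cel (2 + Tv * 2) blank)) (trans (concatMap-replicate (g ∘ pre) (2 + Tv * 2) (cel blank))
            (cong (λ v → g (pre (cel blank)) ++ g (pre (cel blank)) ++ v) (times-pairs Tv (g (pre (cel blank))))))))
          (trans (++-assoc (g (pre (cel blank))) _ r) (cong (g (pre (cel blank)) ++_) (++-assoc (g (pre (cel blank))) _ r)))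
        tail-eq : ∀ r → concatMap g (replicate Q.R mid ++ lastfirst ∷ replicate (suc Q.z) last) ++ r ≡ times Rv (g mid) ++ g lastfirst ++ g last ++ times zv (g last) ++ r
        tail-eq r = split g (replicate Q.R mid) _ r (trans (concatMap-replicate g Q.R mid) (cong (λ v → times v (g mid)) R-eq))
          (trans (++-assoc (g lastfirst) _ r) (cong (g lastfirst ++_) (trans (++-assoc (g last) _ r) (cong (λ v → g last ++ v ++ r)
            (trans (concatMap-replicate g Q.z last) (cong (λ v → times v (g last)) z-eq))))))
        init-eq : ∀ r → concatMap (g ∘ pre) Q.init₂ ++ r ≡ concatMap (λ b → bit-block f b ++ bit-block f b) x ++ g (pre (cel b0)) ++ g (pre (cel b1)) ++ times Wv (g (pre wit)) ++
          g (pre (cel blank)) ++ g (pre (cel blank)) ++ times Tv (g (pre (cel blank)) ++ g (pre (cel blank))) ++ r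
        init-eq r = split (g ∘ pre) (map cel (known x)) _ r (knowns x) (trans (++-assoc (g (pre (cel b0))) _ r) (cong (g (pre (cel b0)) ++_)
          (trans (++-assoc (g (pre (cel b1))) _ r) (cong (g (pre (cel b1)) ++_) (split (g ∘ pre) (wits Wv) _ r (concatMap-replicate (g ∘ pre) Wv wit) (blanks' r))))))
        bits-eq : down n (λ a → bit-block f (nthB (reverse x) a) ++ bit-block f (nthB (reverse x) a)) ≡ concatMap (λ b → bit-block f b ++ bit-block f b) x
        bits-eq = trans (cong (λ k → down k (λ a → bit-block f (nthB (reverse x) a) ++ bit-block f (nthB (reverse x) a))) (sym (length-reverse x)))
          (trans (down-nth (λ b → bit-block f b ++ bit-block f b) (reverse x)) (cong (concatMap (λ b → bit-block f b ++ bit-block f b)) (reverse-involutive x)))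
        shape : (true ∷ true ∷ []) ++ g first ++ g (pre start) ++ down n (λ a → bit-block f (nthB (reverse x) a) ++ bit-block f (nthB (reverse x) a)) ++
                g (pre (cel b0)) ++ g (pre (cel b1)) ++ times Wv (g (pre wit)) ++ g (pre (cel blank)) ++ g (pre (cel blank)) ++
                times Tv (g (pre (cel blank)) ++ g (pre (cel blank))) ++ times Rv (g mid) ++ g lastfirst ++ g last ++ times zv (g last) ++ (false ∷ true ∷ []) ++ o ≡
                E (true ∷ blk w (map f Q.cls)) ++ o
        shape = sym (cong (λ v → true ∷ true ∷ v) (trans (++-assoc (dbl (blk w (map f Q.cls))) (false ∷ true ∷ []) o)
          (trans (cong (_++ (false ∷ true ∷ o)) (trans (dbl-blk w (map f Q.cls)) (concatMap-map (dbl ∘ bits w) f Q.cls)))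
          (trans (++-assoc (g first) _ _) (cong (g first ++_) (trans (split g (map pre (start ∷ Q.init₂)) _ _ (concatMap-map g pre (start ∷ Q.init₂)) (tail-eq (false ∷ true ∷ o)))
            (trans (++-assoc (g (pre start)) _ _) (cong (g (pre start) ++_) (trans (init-eq _) (++-congˡ _ (sym bits-eq)))))))))))

      emits-item : ∀ τ s {ρ} → s ≤ Yv → ρ ! ri ≡ 0 → ρ ! rz ≡ zv → ρ ! rs ≡ s → Emits (itemP τ) ρ (E (itemBits Q.z s τ))
      emits-item τ s {ρ} s≤ at-i at-z at-s o = to (cong (ρ ,_) shape)
        (emits-all (top-block τ) o then emits-times zv z≤' (λ ()) at-i at-z (const zero-block) _ then emits-all (low-blocks τ) _ then
         emits-times s s≤ (λ ()) at-i at-s (const zero-block) _ then emits-all (true ∷ true ∷ []) _)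
        where
        X₁ = replicate s 0 ++ (cl τ + B * cb τ) ∷ trgt τ ∷ replicate Q.z 0
        tp = bits (e + e) (B * ttop τ)
        blocks-eq : ∀ r → concatMap (dbl ∘ bits w) X₁ ++ r ≡ times s zero-block ++ low-blocks τ ++ times zv zero-block ++ r
        blocks-eq r = trans (cong (_++ r) (trans (concatMap-++ (dbl ∘ bits w) (replicate s 0) _) (cong₂ _++_ (concatMap-replicate (dbl ∘ bits w) s 0)
            (trans (sym (++-assoc (dbl (bits w (cl τ + B * cb τ))) (dbl (bits w (trgt τ))) _)) (cong (low-blocks τ ++_) (trans (concatMap-replicate (dbl ∘ bits w) Q.z 0) (cong (λ v → times v zero-block) z-eq)))))))
          (trans (++-assoc (times s zero-block) _ r) (cong (times s zero-block ++_) (++-assoc (low-blocks τ) (times zv zero-block) r)))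
        shape : (true ∷ true ∷ []) ++ times s zero-block ++ low-blocks τ ++ times zv zero-block ++ top-block τ ++ o ≡ E (itemBits Q.z s τ) ++ o
        shape = sym (cong (λ v → true ∷ true ∷ v) (trans (cong (λ v → (v ++ (false ∷ true ∷ [])) ++ o) (dbl-++ (blk w X₁) tp))
          (trans (cong (_++ o) (++-assoc (dbl (blk w X₁)) (dbl tp) (false ∷ true ∷ []))) (trans (++-assoc (dbl (blk w X₁)) (top-block τ) o)
            (trans (++-congˡ (top-block τ ++ o) (dbl-blk w X₁)) (blocks-eq (top-block τ ++ o)))))))

      emits-tiles : ∀ τs s {ρ} → s ≤ Yv → ρ ! ri ≡ 0 → ρ ! rz ≡ zv → ρ ! rs ≡ s → Emits (tilesP τs) ρ (concatMap E (map (itemBits Q.z s) τs))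
      emits-tiles []       s s≤ at-i at-z at-s o = run-skip
      emits-tiles (τ ∷ τs) s s≤ at-i at-z at-s = emits-seq (emits-tiles τs s s≤ at-i at-z at-s) (emits-item τ s s≤ at-i at-z at-s)

      down-upTo : ∀ k → down k (λ s → concatMap E (map (itemBits Q.z s) tiles)) ≡ concatMap E (Q.upTo k)
      down-upTo zero    = refl
      down-upTo (suc k) = trans (cong (concatMap E (map (itemBits Q.z k) tiles) ++_) (down-upTo k)) (sym (concatMap-++ E (map (itemBits Q.z k) tiles) (Q.upTo k)))

      emits-items : ∀ {ρ} → ρ ! ri ≡ 0 → ρ ! rz ≡ zv → ρ ! rs ≡ 0 → ρ ! rL ≡ Lv → Emits itemsP ρ (concatMap E (Q.upTo Lv))
      emits-items {ρ} at-i at-z at-s at-L = emits-to (down-upTo Lv) (emits-for (λ s → concatMap E (map (itemBits Q.z s) tiles)) Lv L≤' (λ ()) at-s at-L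
        (λ a a<L → emits-tiles tiles a (≤-trans (<⇒≤ a<L) L≤') (trans (lookup∘update′ {i = ri} {rs} (λ ()) ρ a) at-i) (trans (lookup∘update′ {i = rz} {rs} (λ ()) ρ a) at-z) (lookup∘update rs ρ a)))

      J-eq : Q.J' ≡ 2 + zv + (Rv + (2 + zv))
      J-eq = trans (cong suc (trans (length-++ (map pre (start ∷ Q.init₂))) (cong₂ _+_ (length-map pre (start ∷ Q.init₂))
        (trans (length-++ (replicate Q.R mid)) (cong₂ (λ a b → a + suc b) (length-replicate Q.R) (length-replicate (suc Q.z))))))) (cong₂ (λ a b → 2 + a + (b + (2 + a))) z-eq R-eq)

      emits-bound : ∀ {ρ} → ρ ! ri ≡ 0 → ρ ! rz ≡ zv → ρ ! rR ≡ Rv → Emits boundP ρ (E (boundBits Q.J'))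
      emits-bound {ρ} at-i at-z at-R o = to (cong (ρ ,_) shape)
        (emits-all _ o then emits-times zv z≤' (λ ()) at-i at-z (const gap) _ then emits-all gap _ then emits-all gap _ then
         emits-times Rv R≤' (λ ()) at-i at-R (const gap) _ then emits-times zv z≤' (λ ()) at-i at-z (const gap) _ then emits-all gap _ then emits-all gap _ then
         emits-all (dbl (true ∷ false ∷ false ∷ false ∷ false ∷ [])) _)
        where
        gaps : ∀ r → times Q.J' gap ++ r ≡ gap ++ gap ++ times zv gap ++ times Rv gap ++ gap ++ gap ++ times zv gap ++ r
        gaps r = trans (cong (λ v → times v gap ++ r) J-eq) (trans (cong (_++ r) (trans (times-+ (2 + zv) (Rv + (2 + zv)) gap) (cong (times (2 + zv) gap ++_) (times-+ Rv (2 + zv) gap))))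
          (trans (++-assoc (times (2 + zv) gap) _ r) (trans (cong (times (2 + zv) gap ++_) (trans (++-assoc (times Rv gap) _ r) (cong (times Rv gap ++_) (open2 r)))) (open2 _))))
          where
          open2 : ∀ r → times (2 + zv) gap ++ r ≡ gap ++ gap ++ times zv gap ++ r
          open2 r = trans (++-assoc gap _ r) (cong (gap ++_) (++-assoc gap _ r))
        shape : dbl (true ∷ false ∷ false ∷ false ∷ false ∷ []) ++ gap ++ gap ++ times zv gap ++ times Rv gap ++ gap ++ gap ++ times zv gap ++ (false ∷ true ∷ []) ++ o ≡ E (boundBits Q.J') ++ o
        shape = sym (cong (λ v → true ∷ true ∷ false ∷ false ∷ false ∷ false ∷ false ∷ false ∷ false ∷ false ∷ v)
          (trans (++-assoc (dbl (times Q.J' (replicate (w + w) false))) (false ∷ true ∷ []) o) (trans (++-congˡ (false ∷ true ∷ o) (dbl-times Q.J' (replicate (w + w) false))) (gaps (false ∷ true ∷ o)))))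

      module Fill (n' pads : ℕ) (n'-eq : n' + 2 ≡ 2 ^ l) (pads-eq : pads + cv ≡ 2 ^ l) where

        private
          at-c : ℕ → Vec ℕ 13
          at-c c' = regs n Wv Tv zv Rv Lv (2 ^ l) c' 0 0 0 0 0

          zeros : ∀ d v {c'} → v + d ≡ 2 ^ l → Emits (zerosP d) (at-c c') (times v (E []))
          zeros d v e' = emits-from d v (≤-trans (≤-trans (m≤m+n v d) (≤-reflexive e')) w≤') (λ ()) refl (sym e') (const (E []))

          zeros₀ : ∀ {c'} → Emits (zerosP 0) (at-c c') (times (suc (suc n')) (E []))
          zeros₀ = zeros 0 (suc (suc n')) (trans (+-identityʳ _) (trans (+-comm 2 n') n'-eq))
          zeros₁ : ∀ {c'} → Emits (zerosP 1) (at-c c') (times (suc n') (E []))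
          zeros₁ = zeros 1 (suc n') (trans (+-comm (suc n') 1) (trans (+-comm 2 n') n'-eq))
          zeros₂ : ∀ {c'} → Emits (zerosP 2) (at-c c') (times n' (E []))
          zeros₂ = zeros 2 n' n'-eq

          padding : ∀ o → while rc rw (emitAll (E []) ▹ inc rc) ⊢ (at-c cv , o) ⟶ (at-c (2 ^ l) , times pads (E []) ++ o)
          padding o = to (cong (λ v → at-c v , times pads (E []) ++ o) pads-eq)
            (run-while (λ a → at-c (a + cv) , times a (E []) ++ o) pads (≤-trans (≤-trans (m≤m+n pads cv) (≤-reflexive pads-eq)) w≤')
              (λ a a<v → <-≤-trans (+-monoˡ-< cv a<v) (≤-reflexive pads-eq)) (≤-reflexive (sym pads-eq))
              (λ a a<v → emits-all (E []) _ then run-inc))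

          sizing : ∀ o → sizeP ⊢ (at-c (2 ^ l) , o) ⟶ (regs n Wv Tv zv Rv Lv (2 ^ l) (2 ^ l) 0 0 (2 ^ l) 0 0 , E (replicate l false) ++ o)
          sizing o = emits-all (false ∷ true ∷ []) o then run-inc then
            to (cong (regs n Wv Tv zv Rv Lv (2 ^ l) (2 ^ l) 0 0 (2 ^ l) 0 0 ,_) (trans (++-congˡ _ (sym (dbl-replicate l false))) (sym (++-assoc (dbl (replicate l false)) (false ∷ true ∷ []) o))))
            (run-while (λ a → regs n Wv Tv zv Rv Lv (2 ^ l) (2 ^ l) 0 0 (2 ^ a) 0 0 , times a (false ∷ false ∷ []) ++ false ∷ true ∷ o) l
              (≤-trans (≤-trans (n≤2^n l) ≤-refl) w≤') (λ a a<l → ^-monoʳ-< 2 (s≤s (s≤s z≤n)) a<l) ≤-refl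
              (λ a a<l → emits-all (false ∷ false ∷ []) _ then
                to (cong (λ v → regs n Wv Tv zv Rv Lv (2 ^ l) (2 ^ l) 0 0 v 0 0 , false ∷ false ∷ times a (false ∷ false ∷ []) ++ false ∷ true ∷ o) (lem (2 ^ a)))
                  (run-double rj (2 ^ a) (≤-trans (^-monoʳ-≤ 2 (<⇒≤ a<l)) w≤') (λ ()) (λ ()) (λ ()) (λ ()) refl refl refl)))
            where
            lem : ∀ v → v + 0 + v ≡ v + (v + 0)
            lem = solve-∀

        encoding : List Bool
        encoding = E (replicate l false) ++ E [] ++ E [] ++ E [] ++ E Q.pBits ++ times n' (E []) ++ E Q.qBits ++ times pads (E []) ++ concatMap E (Q.upTo Lv) ++
          times (suc (suc n')) (E []) ++ E (false ∷ []) ++ times n' (E []) ++ times (suc n') (E []) ++ times (suc n') (E []) ++ E (false ∷ []) ++ times (suc n') (E []) ++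
          times (suc (suc n')) (E []) ++ E (boundBits Q.J') ++ []

        run-encode : ∃ λ ρ → encodeP ⊢ (ready enough below l≤ , []) ⟶ (ρ , encoding)
        run-encode = _ , (emits-bound refl refl refl [] then zeros₀ _ then zeros₁ _ then emits-all (E (false ∷ [])) _ then zeros₁ _ then zeros₁ _ then zeros₂ _ then
          emits-all (E (false ∷ [])) _ then zeros₀ _ then emits-items refl refl refl refl _ then padding _ then
          emits-blocks qB refl refl refl refl refl refl _ then zeros₂ _ then emits-blocks pB refl refl refl refl refl refl _ then
          emits-all (E []) _ then emits-all (E []) _ then emits-all (E []) _ then sizing _)

-- The reduction

private
  flatten : ∀ (kb z pb t₀ qb u v t₂ ef t₁ bb : List Bool) →
    kb ++ z ++ z ++ ((z ++ pb ++ t₀) ++ (qb ++ u ++ v) ++ t₂ ++ []) ++ (((ef ++ t₀) ++ t₁ ++ t₁ ++ []) ++ ((ef ++ t₁) ++ t₂ ++ [])) ++ bb ≡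
    kb ++ z ++ z ++ z ++ pb ++ t₀ ++ qb ++ u ++ v ++ t₂ ++ ef ++ t₀ ++ t₁ ++ t₁ ++ ef ++ t₁ ++ t₂ ++ bb ++ []
  flatten kb z pb t₀ qb u v t₂ ef t₁ bb = solve (++-monoid Bool)

polyBound-mono : ∀ c {m n} → m ≤ n → polyBound c m ≤ polyBound c n
polyBound-mono c le = +-monoˡ-≤ c (*-monoʳ-≤ c (^-monoˡ-≤ c le))

module Reduction (M : TM) (c d : ℕ) (halts : ∀ x → Halted M (runOn M (polyBound d (length x)) x)) (e : ℕ) (wide : Wide M e) where
  open Emission M e wide

  N₀ : ℕ
  N₀ = length (TileSet.tiles M)

  Witness : List Bool → Set
  Witness x = ∃ λ w → length w ≤ polyBound c (length x) × Accepts M (pairEnc x w)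

  module For (x : List Bool) where
    open Sizes c d N₀ (length x)

    l : ℕ
    l = proj₁ (log cv)
    enough : cv ≤ 2 ^ l
    enough = proj₁ (proj₂ (log cv))
    below : ∀ a → a < l → 2 ^ a < cv
    below = proj₁ (proj₂ (proj₂ (log cv)))
    l≤ : l ≤ cv
    l≤ = proj₂ (proj₂ (proj₂ (log cv)))

    pads n' : ℕ
    pads = 2 ^ l ∸ cv
    n' = 2 ^ l ∸ 2

    pads-eq : pads + cv ≡ 2 ^ l
    pads-eq = m∸n+n≡m enough

    n'-eq : n' + 2 ≡ 2 ^ l
    n'-eq = m∸n+n≡m (≤-trans (s≤s (s≤s z≤n)) enough)

    open Correct c d x {l} using (module At; module Q; L-eq) public
    open At enough below l≤ using (module Fill) public
    open Fill n' pads n'-eq pads-eq public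

    private
      length-upTo : ∀ k → length (Q.upTo k) ≡ N₀ * k
      length-upTo zero    = sym (*-zeroʳ N₀)
      length-upTo (suc k) = trans (length-++ (map (Q.itemBits Q.z k) Q.tiles)) (trans (cong₂ _+_ (length-map (Q.itemBits Q.z k) Q.tiles) (length-upTo k)) (sym (*-suc N₀ k)))

      its₀ : List (List Bool)
      its₀ = replicate pads [] ++ Q.upTo (Q.P + Q.R)

      length-its : length its₀ ≡ suc n'
      length-its = suc-injective (trans (cong suc (trans (length-++ (replicate pads [])) (cong₂ _+_ (length-replicate pads) (trans (length-upTo (Q.P + Q.R)) (cong (N₀ *_) L-eq)))))
        (trans (sym (+-suc pads (N₀ * Lv))) (trans pads-eq (trans (sym n'-eq) (+-comm n' 2)))))

      nonempty : ∀ (ys : List (List Bool)) {k} → length ys ≡ suc k → ∃ λ y → ∃ λ zs → ys ≡ y ∷ zs × length zs ≡ k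
      nonempty (y ∷ zs) refl = y , zs , refl , refl

      head-tail = nonempty its₀ length-its

    module Inst = Q.Padded pads (proj₁ head-tail) (proj₁ (proj₂ head-tail)) (proj₁ (proj₂ (proj₂ head-tail)))

    inst : Instance
    inst = Inst.inst (Q.boundBits Q.J')

    private
      is-length : length (proj₁ (proj₂ head-tail)) ≡ n'
      is-length = proj₂ (proj₂ (proj₂ head-tail))

      columns : bval (replicate l false) ≡ length its₀
      columns = suc-injective (trans (bval-num (replicate l false)) (trans (cong₂ (λ a b → 2 ^ a + b) (length-replicate l) (num-zeros l))
        (trans (+-identityʳ (2 ^ l)) (trans (sym n'-eq) (trans (+-comm n' 2) (cong suc (sym length-its)))))))

      items-eq : concatMap E its₀ ≡ times pads (E []) ++ concatMap E (Q.upTo Lv)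
      items-eq = trans (concatMap-++ E (replicate pads []) (Q.upTo (Q.P + Q.R))) (cong₂ _++_ (concatMap-replicate E pads []) (cong (concatMap E ∘ Q.upTo) L-eq))

    encode-inst : encode inst ≡ encoding
    encode-inst = trans (encode-grid Q.pBits Q.qBits (replicate l false) (Q.boundBits Q.J') its₀ (proj₁ (proj₂ (proj₂ head-tail))) columns)
      (trans (cong₂ (λ k its → E (replicate l false) ++ E [] ++ E [] ++ ((E [] ++ E Q.pBits ++ times k (E [])) ++ (E Q.qBits ++ its) ++ times (suc (suc k)) (E []) ++ []) ++
          (((E (false ∷ []) ++ times k (E [])) ++ times (suc k) (E []) ++ times (suc k) (E []) ++ []) ++ ((E (false ∷ []) ++ times (suc k) (E [])) ++ times (suc (suc k)) (E []) ++ [])) ++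
          E (Q.boundBits Q.J')) is-length items-eq)
        (flatten (E (replicate l false)) (E []) (E Q.pBits) (times n' (E [])) (E Q.qBits) (times pads (E [])) (concatMap E (Q.upTo Lv)) (times (suc (suc n')) (E []))
          (E (false ∷ [])) (times (suc n') (E [])) (E (Q.boundBits Q.J'))))

    res≤1 : ∀ e → Instance.resist inst e ≤ 1
    res≤1 (hor zero zero)    = ≤-refl
    res≤1 (hor zero (suc _)) = z≤n
    res≤1 (hor (suc _) _)    = z≤n
    res≤1 (ver zero zero)    = ≤-refl
    res≤1 (ver zero (suc _)) = z≤n
    res≤1 (ver (suc _) _)    = z≤n

    private
      length-pair : ∀ w → length w ≤ Wv → length (pairEnc x w) ≤ sv
      length-pair w le = ≤-trans (≤-reflexive (trans (length-++ (concatMap (λ b → b ∷ b ∷ []) x)) (cong (_+ suc (suc (length w))) (dbl-length x))))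
        (≤-trans (+-monoʳ-≤ (length x + (length x + 0)) (s≤s (s≤s le))) (≤-reflexive (lem (length x) Wv)))
        where
        dbl-length : ∀ x → length (concatMap (λ b → b ∷ b ∷ []) x) ≡ length x + (length x + 0)
        dbl-length []      = refl
        dbl-length (b ∷ x) = trans (cong (λ v → suc (suc v)) (dbl-length x)) (cong suc (sym (+-suc (length x) (length x + 0))))
        lem : ∀ n W → n + (n + 0) + suc (suc W) ≡ W + (2 + (n + (n + 0)))
        lem = solve-∀

      -- The number of rows must not depend on the unknown witness; monotonicity of `polyBound`
      -- gives one time that serves all admissible witnesses.
      halted-T : ∀ w → length w ≤ Wv → Halted M (runOn M Tv (pairEnc x w))
      halted-T w le = halted-≤ M (initConf M (pairEnc x w)) (polyBound-mono d (length-pair w le)) (halts (pairEnc x w))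

      won : ∀ w → length w ≤ Wv → Accepts M (pairEnc x w) → Q.Won (runOn M Tv (pairEnc x w))
      won w le (t , ht , acc) = halted-T w le ,
        trans (cong (TM.accepting M ∘ state) (halted-unique M Tv t (initConf M (pairEnc x w)) (halted-T w le) ht)) acc

      run-history : ∀ w → length w ≤ Wv → Q.Won (runOn M Tv (pairEnc x w)) → Q.History
      run-history w le wn = Q.accepted⁺ x Wv Tv (Tv * 2) {Q.P} w ≤-refl refl le wn

      history-run : Q.History → ∃ λ w → length w ≤ Wv × Q.Won (runOn M Tv (pairEnc x w))
      history-run (X , len , pass) = Q.accepted⁻ x Wv Tv (Tv * 2) {Q.P} {X} ≤-refl refl len pass

    complete : Witness x → EDNR-grid3-01 encoding
    complete (w , le , acc) = inst , encode-inst , res≤1 ,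
      Inst.yes⁺ (run-history w le (won w le acc))

    -- The word may be presented as the encoding of some other instance; its solution is carried
    -- over to `inst`, the one whose solutions are understood.
    sound : EDNR-grid3-01 encoding → Witness x
    sound (I , eq , _ , yes-I) = extract (history-run (Inst.yes⁻ (encode-yes I inst (trans eq (sym encode-inst)) yes-I)))
      where
      extract : (∃ λ w → length w ≤ Wv × Q.Won (runOn M Tv (pairEnc x w))) → Witness x
      extract (w , le , ht , acc) = w , le , Tv , ht , acc

  reduction : List Bool → List Bool
  reduction x = For.encoding x

  private
    module Sz (n : ℕ) = Sizes c d N₀ n

    pW : Poly Sz.Wv
    pW = poly (con c ⊗ at _ (poly-^ poly-id c) ⊕ con c)
    ps : Poly Sz.sv
    ps = poly (at _ pW ⊕ (con 2 ⊕ (at _ poly-id ⊕ (at _ poly-id ⊕ con 0))))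
    pT : Poly Sz.Tv
    pT = poly (con d ⊗ at _ (poly-^ ps d) ⊕ con d)
    pz : Poly Sz.zv
    pz = poly (at _ pT ⊕ (at _ pT ⊕ (at _ pW ⊕ (con 4 ⊕ (at _ poly-id ⊕ (at _ poly-id ⊕ con 0))))))
    pR : Poly Sz.Rv
    pR = poly ((con 1 ⊕ at _ pT) ⊗ (con 2 ⊕ at _ pz))
    pL : Poly Sz.Lv
    pL = poly (con 2 ⊕ at _ pz ⊕ at _ pR)
    pc : Poly Sz.cv
    pc = poly (con 1 ⊕ con N₀ ⊗ at _ pL)
    pY : Poly Sz.Yv
    pY = poly (at _ (poly-^ {suc} (poly (con 1 ⊕ at _ poly-id)) c) ⊕ (at _ (poly-^ {λ n → suc (Sz.sv n)} (poly (con 1 ⊕ at _ ps)) d) ⊕ (at _ poly-id ⊕ (at _ ps ⊕ (at _ pW ⊕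
      (at _ pT ⊕ (at _ pz ⊕ (at _ pR ⊕ (at _ pL ⊕ ((at _ pc ⊕ at _ pc) ⊕ con 0))))))))))

    runs-on : ∀ x → ∃ λ ρ → ∃ λ m → m ≤ cost (setupP c d N₀ ▹ encodeP) (Sz.Yv (length x)) ×
      Big (reverse x) (setupP c d N₀ ▹ encodeP) (vreplicate 13 0 [ rn ]≔ length x , []) m (ρ , reduction x)
    runs-on x = finish (For.run-encode x)
      where
      open SetupRun c d N₀ x
      finish : (∃ λ ρ → encodeP ⊢ (ready (For.enough x) (For.below x) (For.l≤ x) , []) ⟶ (ρ , reduction x)) → _
      finish (ρ , r₂) = ρ , _⊢_⟶_.ops all , _⊢_⟶_.ops≤ all , _⊢_⟶_.big all
        where
        all : setupP c d N₀ ▹ encodeP ⊢ (vreplicate 13 0 [ rn ]≔ length x , []) ⟶ (ρ , reduction x)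
        all = run-setup (For.enough x) (For.below x) (For.l≤ x) then r₂

  reduction-computable : PolyComputable reduction
  reduction-computable = Whole.whole-computable rn (setupP c d N₀ ▹ encodeP) reduction Sz.Yv pY runs-on

private
  reduce : ∀ L (M : TM) (c d : ℕ) → (∀ x → Halted M (runOn M (polyBound d (length x)) x)) →
    (∀ x → (L x → ∃ λ w → length w ≤ polyBound c (length x) × Accepts M (pairEnc x w)) × ((∃ λ w → length w ≤ polyBound c (length x) × Accepts M (pairEnc x w)) → L x)) →
    ∀ e → Wide M e →
    L ≤ₚ EDNR-grid3-01
  reduce L M c d halts spec e wide = reduction , reduction-computable , λ x → (λ Lx → For.complete x (proj₁ (spec x) Lx)) , (λ y → proj₂ (spec x) (For.sound x y))
    where
    open Reduction M c d halts e wide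

theorem1 : NPHard EDNR-grid3-01
-- The reflexivity proof fixes the width `e` as the least one that `Wide` admits.
theorem1 L (M , (d , halts) , c , spec) = reduce L M c d halts spec _ ≤-refl
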